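{- Let $n \ge 1$, $l \ge 0$ be integers, $w, X_1,\ldots,X_n$ indeterminates, and for an integer $m\ge 0$ let $$R_m = \prod_{i=1}^n (X_i^{ -1}+1+w+X_i)\cdot \frac{\det_{1 \le i, j \le n} \left( X_i^{j-1} (1+X_i)^{j-1} (1+ w X_i)^{n-j} - X_i^{m+2n-j} (1+X_i^{ -1})^{j-1} (1+w X_i^{ -1})^{n-j} \right)}{\prod_{i=1}^n (1-X_i) \prod_{1 \le i < j \le n} (1-X_i X_j)(X_j-X_i)}.$$ (1) Let $m=2l+1$ and $E_j=(n-j+l+1,\,j-l-2)$ for $j=1,\ldots,n$. Then $R_m = (-1)^{\binom{n+1}{2}} \prod_{i=1}^n X_i^{l}(X_i^{ -1}+1+w+X_i)(1+X_i)\cdot \sum_{\mathcal{F}} \operatorname{sign}(\mathcal{F})\operatorname{wt}(\mathcal{F})$, where the sum is over all families $\mathcal{F}$ with endpoints $(E_j)$ whose initial segments are pairwise vertex-disjoint (the same holds with the sum over all families with endpoints $(E_j)$). If $w=1$, the same identity holds with the sum restricted to families of pairwise vertex-disjoint paths. If $w=0$, the identity holds with $E_j$ replaced by $E'_j=(n-j+l+1,\,2j-n-l-2)$ and the sum over families of pairwise vertex-disjoint paths. Moreover, for $w\in\{0,1\}$ (with endpoints $E'_j$ in the case $w=0$), $R_m = \prod_{i=1}^n X_i^{l}(X_i^{ -1}+1+w+X_i)(1+X_i) \sum_{\mathcal{F}} (-1)^{\sum_{i: s_i=\alpha_i} i}\operatorname{wt}(\mathcal{F})$, the sum over families of pairwise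 vertex-disjoint paths. (2) Let $m=2l$ and let $E_j=\{(n-j+l+1,\,j-l-2),(n-j+l,\,j-l-1)\}$ be a set of two endpoints, $j=1,\ldots,n$. Then all statements of (1) hold with these endpoint sets, with the overall factor $(-1)^{\binom{n+1}{2}} \prod_{i=1}^n X_i^{l}(X_i^{ -1}+1+w+X_i)$ (respectively $\prod_{i=1}^n X_i^{l}(X_i^{ -1}+1+w+X_i)$ in the version with sign $(-1)^{\sum_{i:s_i=\alpha_i} i}$), and for $w=0$ with $E'_j=\{(n-j+l+1,\,2j-n-l-2),(n-j+l,\,2j-n-l-1)\}$.
   Context: For $i=1,\ldots,n$ let $\alpha_i=(-3i+1,-i+1)$, $\beta_i=(-i+1,-3i+1)$, $A_i=\{\alpha_i,\beta_i\}$. An admissible path from $s\in A_i$ to a lattice point $e$ is a lattice path consisting of an initial segment from $s$ to a point $P$ on the line $x+y=0$, all of whose points satisfy $x+y\le 0$, using only steps $(1,1),(-1,1)$ if $s=\alpha_i$ and only steps $(1,1),(1,-1)$ if $s=\beta_i$, followed by a segment from $P$ to $e$ using only steps $(1,0),(0,1)$ ($P$ is the last point of the path on $x+y=0$). The weight of such a path, when its endpoint is regarded as the endpoint of index $j$, is the product of: for each step of type $(-1,1)$ or $(1,-1)$ lying on the line $x+y=-2d$ ($d\ge 0$), the factor $X_{d/2+1}$ if $d$ is even and $X_{(d+1)/2}^{ -1}$ if $d$ is odd; and for each step $(1,0)$ whose starting point satisfies $x+y\ge j-1$, the factor $w$; all other steps have weight $1$. Given endpoints (or endpoint sets) indexed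 by $j=1,\ldots,n$, a family $\mathcal{F}$ consists of a permutation $\sigma\in\mathcal{S}_n$, a choice $s_i\in A_i$ for each $i$, (in the case of endpoint sets, a choice of endpoint $e_i$ in the $\sigma(i)$-th set), and for each $i$ an admissible path from $s_i$ to the $\sigma(i)$-th endpoint, weighted with index $\sigma(i)$. Its weight $\operatorname{wt}(\mathcal{F})$ is the product of the path weights and $\operatorname{sign}(\mathcal{F})=\operatorname{sgn}\sigma\cdot(-1)^{\#\{i:\, s_i=\beta_i\}}$. -}

module Defs where

open import Level using (Level)
open import Algebra.Bundles using (CommutativeRing)
open import Data.Bool using (Bool; true; false; if_then_else_; _∧_; _∨_; not)
open import Data.Nat as ℕ using (ℕ; zero; suc)
open import Data.Integer as ℤ using (ℤ; +_)
open import Data.Fin as Fin using (Fin; toℕ)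
open import Data.Fin.Properties using () renaming (_≟_ to _≟F_)
open import Data.List as List using (List; []; _∷_; concatMap; map; filter; allFin; foldr; upTo)
open import Data.Bool.ListAction using (and; or)
open import Data.Nat.ListAction using (sum)
open import Data.Vec as Vec using (Vec; []; _∷_; lookup)
open import Data.Product using (_×_; _,_; proj₁; proj₂)
open import Relation.Nullary using (does)

allVecs : {A : Set} {n : ℕ} → (Fin n → List A) → List (Vec A n)
allVecs {n = zero}  f = [] ∷ []
allVecs {n = suc n} f =
  concatMap (λ a → map (a ∷_) (allVecs (λ i → f (Fin.suc i)))) (f Fin.zero)

listsOfLen : ℕ → List (List Bool)
listsOfLen zero    = [] ∷ []
listsOfLen (suc k) = concatMap (λ bs → (true ∷ bs) ∷ (false ∷ bs) ∷ []) (listsOfLen k)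

listsUpTo : ℕ → List (List Bool)
listsUpTo k = concatMap listsOfLen (upTo (suc k))

ordPairs : (n : ℕ) → List (Fin n × Fin n)
ordPairs n = concatMap (λ i → map (i ,_) (filter (λ j → toℕ i ℕ.<? toℕ j) (allFin n))) (allFin n)

isInjᵇ : {n : ℕ} → Vec (Fin n) n → Bool
isInjᵇ {n} v = and (map (λ p → not (does (lookup v (proj₁ p) ≟F lookup v (proj₂ p)))) (ordPairs n))

perms : (n : ℕ) → List (Vec (Fin n) n)
perms n = filter (λ v → Data.Bool._≟_ (isInjᵇ v) true) (allVecs (λ _ → allFin n))
  where import Data.Bool

inversions : {n : ℕ} → Vec (Fin n) n → ℕ
inversions {n} v = List.length (filter (λ p → toℕ (lookup v (proj₂ p)) ℕ.<? toℕ (lookup v (proj₁ p))) (ordPairs n))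

odd : ℕ → Bool
odd zero    = false
odd (suc k) = not (odd k)

-- Lattice points, starting points, endpoints (indices j are 1-based as
-- in the paper; for a : Fin n the paper's index is suc (toℕ a))

Point : Set
Point = ℤ × ℤ

_⊕_ : Point → Point → Point
(a , b) ⊕ (c , d) = (a ℤ.+ c , b ℤ.+ d)

diagSum : Point → ℤ
diagSum (x , y) = x ℤ.+ y

_==ᵖ_ : Point → Point → Bool
(a , b) ==ᵖ (c , d) = does (a ℤ.≟ c) ∧ does (b ℤ.≟ d)

data Start : Set where
  α β : Start

startPt : ℕ → Start → Point
startPt i α = (+ 1 ℤ.- + (3 ℕ.* i) , + 1 ℤ.- + i)
startPt i β = (+ 1 ℤ.- + i , + 1 ℤ.- + (3 ℕ.* i))

initStep : Start → Bool → Point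
initStep s     true  = (+ 1 , + 1)
initStep α     false = (ℤ.- + 1 , + 1)
initStep β     false = (+ 1 , ℤ.- + 1)

finStep : Bool → Point
finStep true  = (+ 1 , + 0)
finStep false = (+ 0 , + 1)

walk : (Bool → Point) → Point → List Bool → List Point
walk f p []       = p ∷ []
walk f p (b ∷ bs) = p ∷ walk f (p ⊕ f b) bs

endOf : (Bool → Point) → Point → List Bool → Point
endOf f p []       = p
endOf f p (b ∷ bs) = endOf f (p ⊕ f b) bs

-- A path is given by its starting type, the step sequence of its initial
-- segment and the step sequence of its second segment.
record Path : Set where
  constructor mkPath
  field
    start : Start
    init  : List Bool
    fin   : List Bool
open Path public

turnPt : ℕ → Path → Point
turnPt i p = endOf (initStep (start p)) (startPt i (start p)) (init p)

initPts : ℕ → Path → List Point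
initPts i p = walk (initStep (start p)) (startPt i (start p)) (init p)

finPts : ℕ → Path → List Point
finPts i p = walk finStep (turnPt i p) (fin p)

allPts : ℕ → Path → List Point
allPts i p = initPts i p List.++ finPts i p

admissibleᵇ : ℕ → Path → Point → Bool
admissibleᵇ i p e =
  and (map (λ q → diagSum q ℤ.≤ᵇ + 0) (initPts i p))
  ∧ does (diagSum (turnPt i p) ℤ.≟ + 0)
  ∧ (endOf finStep (turnPt i p) (fin p) ==ᵖ e)

-- all admissible paths from s_i to e.  Length bounds: the initial segment
-- has at most |e_y - s_y| + |e_x - s_x| steps and the second segment has
-- exactly e_x + e_y steps, so nothing is missed.
admPaths : ℕ → Start → Point → List Path
admPaths i s e =
  filter (λ p → Data.Bool._≟_ (admissibleᵇ i p e) true)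
    (concatMap (λ ini → map (mkPath s ini) (listsOfLen ℤ.∣ diagSum e ∣))
       (listsUpTo (ℤ.∣ proj₂ e ℤ.- proj₂ (startPt i s) ∣ ℕ.+ ℤ.∣ proj₁ e ℤ.- proj₁ (startPt i s) ∣)))
  where import Data.Bool

record Family (n : ℕ) : Set where
  constructor mkFam
  field
    σ      : Vec (Fin n) n      -- permutation: path i goes to endpoint (set) σ(i)
    starts : Vec Start n
    ends   : Vec Point n        -- chosen endpoint e_i in the σ(i)-th set
    paths  : Vec Path n         -- the path of index i (start paths[i] = s_i)
open Family public

families : (n : ℕ) → (Fin n → List Point) → List (Family n)
families n E =
  concatMap (λ σ →
  concatMap (λ ss →
  concatMap (λ es →
    map (mkFam σ ss es)
      (allVecs (λ i → admPaths (suc (toℕ i)) (lookup ss i) (lookup es i))))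
    (allVecs (λ i → E (lookup σ i))))
    (allVecs (λ _ → α ∷ β ∷ [])))
  (perms n)

disjointᵇ : List Point → List Point → Bool
disjointᵇ xs ys = not (or (concatMap (λ x → map (x ==ᵖ_) ys) xs))

initDisjointᵇ : {n : ℕ} → Family n → Bool
initDisjointᵇ {n} F = and (map (λ p →
  disjointᵇ (initPts (suc (toℕ (proj₁ p))) (lookup (paths F) (proj₁ p)))
            (initPts (suc (toℕ (proj₂ p))) (lookup (paths F) (proj₂ p)))) (ordPairs n))

pathsDisjointᵇ : {n : ℕ} → Family n → Bool
pathsDisjointᵇ {n} F = and (map (λ p →
  disjointᵇ (allPts (suc (toℕ (proj₁ p))) (lookup (paths F) (proj₁ p)))
            (allPts (suc (toℕ (proj₂ p))) (lookup (paths F) (proj₂ p)))) (ordPairs n))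

data Restriction : Set where
  allFamilies disjointInitial disjointPaths : Restriction

restrictᵇ : {n : ℕ} → Restriction → Family n → Bool
restrictᵇ allFamilies     F = true
restrictᵇ disjointInitial F = initDisjointᵇ F
restrictᵇ disjointPaths   F = pathsDisjointᵇ F

data SignType : Set where
  standardSign alphaSign : SignType

isβ : Start → Bool
isβ α = false
isβ β = true

signExp : {n : ℕ} → SignType → Family n → ℕ
signExp {n} standardSign F =
  inversions (σ F) ℕ.+ List.length (filter (λ i → Data.Bool._≟_ (isβ (lookup (starts F) i)) true) (allFin n))
  where import Data.Bool
signExp {n} alphaSign F =
  sum (map (λ i → if isβ (lookup (starts F) i) then 0 else suc (toℕ i)) (allFin n))

-- Endpoints of Theorem 4.1 (j is the paper's 1-based index)

Ept : ℕ → ℕ → ℕ → Point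
Ept n l j = (+ n ℤ.- + j ℤ.+ + l ℤ.+ + 1 , + j ℤ.- + l ℤ.- + 2)

Ept₂ : ℕ → ℕ → ℕ → Point
Ept₂ n l j = (+ n ℤ.- + j ℤ.+ + l , + j ℤ.- + l ℤ.- + 1)

Ept' : ℕ → ℕ → ℕ → Point
Ept' n l j = (+ n ℤ.- + j ℤ.+ + l ℤ.+ + 1 , + (2 ℕ.* j) ℤ.- + n ℤ.- + l ℤ.- + 2)

Ept₂' : ℕ → ℕ → ℕ → Point
Ept₂' n l j = (+ n ℤ.- + j ℤ.+ + l , + (2 ℕ.* j) ℤ.- + n ℤ.- + l ℤ.- + 1)

E-odd E-odd' E-even E-even' : (n l : ℕ) → Fin n → List Point
E-odd   n l a = Ept  n l (suc (toℕ a)) ∷ []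
E-odd'  n l a = Ept' n l (suc (toℕ a)) ∷ []
E-even  n l a = Ept  n l (suc (toℕ a)) ∷ Ept₂  n l (suc (toℕ a)) ∷ []
E-even' n l a = Ept' n l (suc (toℕ a)) ∷ Ept₂' n l (suc (toℕ a)) ∷ []

-- Ring-valued quantities, in an arbitrary commutative ring R with
-- elements w and X_1..X_n together with inverses Xinv_i of X_i.

module RingPart {c ℓ : Level} (R : CommutativeRing c ℓ) where
  open CommutativeRing R public

  pow : Carrier → ℕ → Carrier
  pow x zero    = 1#
  pow x (suc k) = x * pow x k

  negOnePow : ℕ → Carrier
  negOnePow k = if odd k then - 1# else 1#

  ΣL : {A : Set} → List A → (A → Carrier) → Carrier
  ΣL xs f = foldr (λ a r → f a + r) 0# xs

  ΠL : {A : Set} → List A → (A → Carrier) → Carrier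
  ΠL xs f = foldr (λ a r → f a * r) 1# xs

  ∏ : {n : ℕ} → (Fin n → Carrier) → Carrier
  ∏ {n} f = ΠL (allFin n) f

  ∏< : {n : ℕ} → (Fin n → Fin n → Carrier) → Carrier
  ∏< {n} f = ΠL (ordPairs n) (λ p → f (proj₁ p) (proj₂ p))

  det : {n : ℕ} → (Fin n → Fin n → Carrier) → Carrier
  det {n} M = ΣL (perms n) (λ v → negOnePow (inversions v) * ∏ (λ i → M i (lookup v i)))

  pick : {n : ℕ} → (Fin n → Carrier) → Carrier → ℕ → Carrier
  pick {zero}  f d k       = d
  pick {suc n} f d zero    = f Fin.zero
  pick {suc n} f d (suc k) = pick (λ i → f (Fin.suc i)) d k

  -- weight of a side step of the initial segment starting at point q,
  -- q on the line x+y = -2d:  X_{d/2+1} (d even), X_{(d+1)/2}^{-1} (d odd)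
  sideWeight : {n : ℕ} → (X Xinv : Fin n → Carrier) → Point → Carrier
  sideWeight X Xinv q =
    let d = ℤ.∣ diagSum q ∣ ℕ./ 2 in
    if odd d then pick Xinv 1# (d ℕ./ 2) else pick X 1# (d ℕ./ 2)

  initWeight : {n : ℕ} → (X Xinv : Fin n → Carrier) → Start → Point → List Bool → Carrier
  initWeight X Xinv s q []           = 1#
  initWeight X Xinv s q (true  ∷ bs) = initWeight X Xinv s (q ⊕ initStep s true) bs
  initWeight X Xinv s q (false ∷ bs) = sideWeight X Xinv q * initWeight X Xinv s (q ⊕ initStep s false) bs

  finWeight : Carrier → ℕ → Point → List Bool → Carrier
  finWeight w j q []           = 1#
  finWeight w j q (true  ∷ bs) =
    (if + j ℤ.- + 1 ℤ.≤ᵇ diagSum q then w else 1#) * finWeight w j (q ⊕ finStep true) bs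
  finWeight w j q (false ∷ bs) = finWeight w j (q ⊕ finStep false) bs

  -- weight of a path of index i (1-based) regarded as ending at endpoint index j (1-based)
  pathWeight : {n : ℕ} → Carrier → (X Xinv : Fin n → Carrier) → ℕ → ℕ → Path → Carrier
  pathWeight w X Xinv i j p =
    initWeight X Xinv (start p) (startPt i (start p)) (init p)
    * finWeight w j (turnPt i p) (fin p)

  famWeight : {n : ℕ} → Carrier → (X Xinv : Fin n → Carrier) → Family n → Carrier
  famWeight w X Xinv F =
    ∏ (λ i → pathWeight w X Xinv (suc (toℕ i)) (suc (toℕ (lookup (σ F) i))) (lookup (paths F) i))

  famSum : {n : ℕ} → SignType → Restriction → (Fin n → List Point) →
           Carrier → (X Xinv : Fin n → Carrier) → Carrier
  famSum {n} st r E w X Xinv =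
    ΣL (filter (λ F → Data.Bool._≟_ (restrictᵇ r F) true) (families n E))
       (λ F → negOnePow (signExp st F) * famWeight w X Xinv F)
    where import Data.Bool

  Rnum : (n m : ℕ) → Carrier → (X Xinv : Fin n → Carrier) → Carrier
  Rnum n m w X Xinv =
    ∏ (λ i → Xinv i + 1# + w + X i) *
    det (λ i j →
      pow (X i) (toℕ j) * pow (1# + X i) (toℕ j) * pow (1# + w * X i) (n ℕ.∸ suc (toℕ j))
      - pow (X i) (m ℕ.+ 2 ℕ.* n ℕ.∸ suc (toℕ j)) * pow (1# + Xinv i) (toℕ j)
          * pow (1# + w * Xinv i) (n ℕ.∸ suc (toℕ j)))

  Rden : (n : ℕ) → (X : Fin n → Carrier) → Carrier
  Rden n X = ∏ (λ i → 1# - X i) * ∏< (λ i j → (1# - X i * X j) * (X j - X i))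

  factorOdd : (n l : ℕ) → Carrier → (X Xinv : Fin n → Carrier) → Carrier
  factorOdd n l w X Xinv = ∏ (λ i → pow (X i) l * (Xinv i + 1# + w + X i) * (1# + X i))

  factorEven : (n l : ℕ) → Carrier → (X Xinv : Fin n → Carrier) → Carrier
  factorEven n l w X Xinv = ∏ (λ i → pow (X i) l * (Xinv i + 1# + w + X i))

  -- "R_m = pre · S"  stated with the denominator of R_m cleared
  RmIs : (n m : ℕ) → Carrier → (X Xinv : Fin n → Carrier) → Carrier → Set ℓ
  RmIs n m w X Xinv rhs = Rnum n m w X Xinv ≈ Rden n X * rhs

{-# OPTIONS --safe #-}
-- Summing over the initial segments turns the signed sum over all families into det B, where
-- B i j is the sum over final segments to endpoint j, starting at (-k, k), of their weights
-- times S_i(k); here S_i is the odd function on ℤ with generating function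
-- z^i / ∏_{q ≤ i} (1 - X_q z)(1 - z / X_q) for k ≥ 0.  Put u_q = X_q + 1/X_q.  As
-- S_p(k+1) + S_p(k-1) = u_p S_p(k) + S_{p-1}(k), the Newton sum
-- G_i = Σ_p ∏_{q<p} (u_i - u_q) S_p satisfies G_i(k+1) + G_i(k-1) = u_i G_i(k), so
-- X_i^k - X_i^{-k} = (X_i - 1/X_i) G_i(k) and, for even m,
-- X_i^k - X_i^{-k-1} = (1 - 1/X_i) (G_i(k) + G_i(k+1)).  Up to row factors the matrix defining
-- R_m is therefore a lower triangular matrix times B, and its diagonal gives the denominator.
-- Families with a common vertex cancel by exchanging the parts of two paths after it.  In a
-- family of disjoint paths, planarity makes a pair i < i′ an inversion of σ exactly when s_{i′}
-- is a β, which converts the sign.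
module Submission where

open import Defs
open import Data.Bool using (Bool; true; false; if_then_else_; _∧_; not; _xor_)
import Data.Bool as Bool
open import Data.Bool.Properties using (not-involutive)
open import Data.Bool.ListAction using (and; or)
open import Data.Bool.Solver using (module xor-∧-Solver)
open import Data.Nat as ℕ using (ℕ; zero; suc)
import Data.Nat.Properties as ℕP
open import Data.Fin as Fin using (Fin; toℕ)
import Data.Fin.Properties as FinP
open import Data.List as List using (List; []; _∷_; _++_; concatMap; map; filter; allFin; tabulate; foldr; upTo; length)
open import Data.List.Properties using (map-++; map-∘; map-cong; map-tabulate; filter-all; concatMap-map; concatMap-cong; map-concatMap; length-++)
open import Data.List.Membership.Propositional using (_∈_; find; lose; _∉_)
open import Data.List.Membership.Propositional.Properties using (∈-map⁺; ∈-map⁻; ∈-++⁺ˡ; ∈-++⁺ʳ; ∈-++⁻; ∈-concatMap⁺; ∈-concatMap⁻; ∈-filter⁺; ∈-filter⁻; ∈-allFin; ∈-upTo⁺; ∈-∃++)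
open import Data.List.Relation.Unary.Any using (here; there)
open import Data.List.Relation.Unary.All as All using ([]; _∷_)
import Data.List.Relation.Unary.All.Properties as AllP
open import Data.List.Relation.Unary.AllPairs as AllPairs using ([]; _∷_)
import Data.List.Relation.Unary.AllPairs.Properties as AllPairsP
open import Data.List.Relation.Unary.Unique.Propositional using (Unique)
import Data.List.Relation.Unary.Unique.Propositional.Properties as Uniq
open import Data.Vec as Vec using (Vec; []; _∷_; lookup; _[_]≔_)
open import Data.Vec.Properties using (lookup∘updateAt; lookup∘updateAt′; ∷-injective; lookup∘tabulate)
open import Data.Product using (_×_; _,_; proj₁; proj₂; ∃; ∃₂)
open import Data.Sum using (_⊎_; inj₁; inj₂)
open import Function using (_∘_; id; case_of_)
open import Relation.Nullary using (Dec; yes; no; does; ¬_; contradiction; _×-dec_)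
open import Relation.Binary using (tri<; tri≈; tri>; DecidableEquality)
open import Level using (Level)
open import Algebra.Bundles using (CommutativeRing)
import Data.Nat.Induction as ℕI
open import Data.Integer as ℤ using (ℤ; +_; -[1+_])
import Data.Integer.Properties as ℤP
open import Data.Integer.Solver using (module +-*-Solver)
open import Data.Product.Properties using (≡-dec)
open import Data.Maybe using (Maybe; just; nothing; is-just; maybe′)
open import Data.Nat.Combinatorics using (_C_; nC1≡n; nCk+nC[k+1]≡[n+1]C[k+1])
open import Data.Nat.ListAction using (sum)
open import Data.Nat.ListAction.Properties using (sum-++)
import Data.Nat.Solver as ℕSolver
import Data.Nat.DivMod as DM
open import Algebra.Properties.AbelianGroup ℤP.+-0-abelianGroup using (∙-cancelˡ)
open import Relation.Binary.PropositionalEquality as ≡ using (_≡_; _≢_; cong; cong₂; subst; subst₂)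

-- Permutations and the parity of inversions

-- The ring is arbitrary: 2 may be a zero divisor, and u_i - u_q or X_i - 1/X_i need not be
-- cancellable. So no step divides: the denominator of R_m is cleared, Newton sums take the place of
-- Lagrange interpolation, and signed sums vanish through involutions without fixed points. The
-- usual cancellation picks a first intersection, a choice that has to survive the exchange. Here
-- one vertex v is treated at a time: the exchange at v keeps the set of paths through v, so it
-- finds the same pair again, and it creates no new common vertex, so vertices treated before stay
-- good. An exchange inside initial segments moves each final segment together with its endpoint
-- index and is harmless for every w. Inside final segments the parts before v change index, and the
-- line where w sets in depends on the index; there the argument asks for final segments of weight
-- 1. For w = 1 this is clear. For w = 0 no path of nonzero weight has a horizontal step from the
-- line x + y = j - 1 on, so it ends with n - j vertical steps, and cutting these off moves E_j to
-- E'_j.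

concatMap-unique : {A B : Set} {f : A → List B} (key : B → A) {xs : List A} →
  Unique xs → (∀ {x} → x ∈ xs → Unique (f x)) → (∀ x {y} → y ∈ f x → key y ≡ x) →
  Unique (concatMap f xs)
concatMap-unique {f = f} key {xs} ux uf kf =
  Uniq.concat⁺ (AllP.map⁺ (All.tabulate uf))
    (AllPairsP.map⁺ (AllPairs.map (λ x≢y {v} (p , q) → x≢y (≡.trans (≡.sym (kf _ p)) (kf _ q))) ux))

∈-concatMap-∃⁻ : {A B : Set} (f : A → List B) (xs : List A) {y : B} → y ∈ concatMap f xs → ∃ λ x → x ∈ xs × y ∈ f x
∈-concatMap-∃⁻ f xs y∈ = find (∈-concatMap⁻ f {xs} y∈)

∈-concatMap-∃⁺ : {A B : Set} (f : A → List B) {xs : List A} {x : A} {y : B} → x ∈ xs → y ∈ f x → y ∈ concatMap f xs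
∈-concatMap-∃⁺ f x∈ y∈ = ∈-concatMap⁺ f (lose x∈ y∈)

filter-map : {A B : Set} {P : B → Set} {Q : A → Set} (P? : ∀ b → Dec (P b)) (Q? : ∀ a → Dec (Q a))
  (f : A → B) → (∀ a → does (P? (f a)) ≡ does (Q? a)) → ∀ xs →
  filter P? (map f xs) ≡ map f (filter Q? xs)
filter-map P? Q? f eq [] = ≡.refl
filter-map P? Q? f eq (x ∷ xs) rewrite eq x with does (Q? x)
... | true  = cong (f x ∷_) (filter-map P? Q? f eq xs)
... | false = filter-map P? Q? f eq xs

-- Splits off the pairs with first index 0; the others are those of `Fin n`, shifted. The inductions
-- over pairs, for parities, index sums and Vandermonde products, run along this splitting.
ordPairs-suc : ∀ n → ordPairs (suc n) ≡
  map (λ j → Fin.zero , Fin.suc j) (allFin n)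
    ++ map (λ p → Fin.suc (proj₁ p) , Fin.suc (proj₂ p)) (ordPairs n)
ordPairs-suc n = cong₂ _++_ row₀ rows
  where
  later : {k : ℕ} → Fin k → List (Fin k)
  later i = filter (λ j → toℕ i ℕ.<? toℕ j) (allFin _)
  sucs : tabulate Fin.suc ≡ map Fin.suc (allFin n)
  sucs = ≡.sym (map-tabulate id Fin.suc)
  row₀ : map (Fin.zero ,_) (later {suc n} Fin.zero) ≡ map (λ j → Fin.zero , Fin.suc j) (allFin n)
  row₀ = begin
    map (Fin.zero ,_) (later Fin.zero)
      ≡⟨ cong (map (Fin.zero ,_) ∘ filter (λ j → 0 ℕ.<? toℕ j)) sucs ⟩
    map (Fin.zero ,_) (filter (λ j → 0 ℕ.<? toℕ j) (map Fin.suc (allFin n)))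
      ≡⟨ cong (map (Fin.zero ,_)) (filter-all _ (AllP.map⁺ (All.universal (λ _ → ℕ.z<s) (allFin n)))) ⟩
    map (Fin.zero ,_) (map Fin.suc (allFin n)) ≡⟨ ≡.sym (map-∘ (allFin n)) ⟩
    map (λ j → Fin.zero , Fin.suc j) (allFin n) ∎
    where open ≡.≡-Reasoning
  row : ∀ i → map (Fin.suc i ,_) (later (Fin.suc i)) ≡
        map (λ p → Fin.suc (proj₁ p) , Fin.suc (proj₂ p)) (map (i ,_) (later i))
  row i = begin
    map (Fin.suc i ,_) (later (Fin.suc i))
      ≡⟨ cong (map (Fin.suc i ,_) ∘ filter (λ j → suc (toℕ i) ℕ.<? toℕ j)) sucs ⟩
    map (Fin.suc i ,_) (filter (λ j → suc (toℕ i) ℕ.<? toℕ j) (map Fin.suc (allFin n)))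
      ≡⟨ cong (map (Fin.suc i ,_)) (filter-map (λ j → suc (toℕ i) ℕ.<? toℕ j) (λ j → toℕ i ℕ.<? toℕ j) Fin.suc (λ _ → ≡.refl) (allFin n)) ⟩
    map (Fin.suc i ,_) (map Fin.suc (later i)) ≡⟨ ≡.sym (map-∘ (later i)) ⟩
    map (λ j → Fin.suc i , Fin.suc j) (later i) ≡⟨ map-∘ (later i) ⟩
    map (λ p → Fin.suc (proj₁ p) , Fin.suc (proj₂ p)) (map (i ,_) (later i)) ∎
    where open ≡.≡-Reasoning
  rows : concatMap (λ i → map (i ,_) (later i)) (tabulate Fin.suc) ≡
         map (λ p → Fin.suc (proj₁ p) , Fin.suc (proj₂ p)) (ordPairs n)
  rows = begin
    concatMap (λ i → map (i ,_) (later i)) (tabulate Fin.suc)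
      ≡⟨ cong (concatMap (λ i → map (i ,_) (later i))) sucs ⟩
    concatMap (λ i → map (i ,_) (later i)) (map Fin.suc (allFin n))
      ≡⟨ concatMap-map (λ i → map (i ,_) (later i)) Fin.suc (allFin n) ⟩
    concatMap (λ i → map (Fin.suc i ,_) (later (Fin.suc i))) (allFin n)
      ≡⟨ concatMap-cong row (allFin n) ⟩
    concatMap (map (λ p → Fin.suc (proj₁ p) , Fin.suc (proj₂ p)) ∘ (λ i → map (i ,_) (later i))) (allFin n)
      ≡⟨ ≡.sym (map-concatMap _ _ (allFin n)) ⟩
    map (λ p → Fin.suc (proj₁ p) , Fin.suc (proj₂ p)) (ordPairs n) ∎
    where open ≡.≡-Reasoning

∈-ordPairs⁺ : ∀ {n} {i j : Fin n} → toℕ i ℕ.< toℕ j → (i , j) ∈ ordPairs n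
∈-ordPairs⁺ {n} {i} {j} i<j =
  ∈-concatMap-∃⁺ _ (∈-allFin i) (∈-map⁺ (i ,_) (∈-filter⁺ _ (∈-allFin j) i<j))

∈-ordPairs⁻ : ∀ {n} {p : Fin n × Fin n} → p ∈ ordPairs n → toℕ (proj₁ p) ℕ.< toℕ (proj₂ p)
∈-ordPairs⁻ {n} p∈ with ∈-concatMap-∃⁻ _ (allFin n) p∈
... | i , _ , q with ∈-map⁻ (i ,_) q
... | j , r , ≡.refl = proj₂ (∈-filter⁻ (λ j → toℕ i ℕ.<? toℕ j) {xs = allFin n} r)

and-map⁺ : {A : Set} {f : A → Bool} {xs : List A} → (∀ {x} → x ∈ xs → f x ≡ true) → and (map f xs) ≡ true
and-map⁺ {xs = []} h = ≡.refl
and-map⁺ {f = f} {x ∷ xs} h rewrite h (here ≡.refl) = and-map⁺ {f = f} (h ∘ there)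

and-map⁻ : {A : Set} {f : A → Bool} {xs : List A} → and (map f xs) ≡ true → ∀ {x} → x ∈ xs → f x ≡ true
and-map⁻ {f = f} {x ∷ xs} h (here ≡.refl) with f x
... | true = ≡.refl
and-map⁻ {f = f} {x ∷ xs} h (there p) with f x
... | true = and-map⁻ {f = f} h p

does-true⁻ : ∀ {p} {P : Set p} (d : Dec P) → does d ≡ true → P
does-true⁻ (yes p) _ = p

does-true⁺ : ∀ {p} {P : Set p} (d : Dec P) → P → does d ≡ true
does-true⁺ (yes _) _ = ≡.refl
does-true⁺ (no ¬p) p = contradiction p ¬p

does-false⁺ : ∀ {p} {P : Set p} (d : Dec P) → ¬ P → does d ≡ false
does-false⁺ (no _) _ = ≡.refl
does-false⁺ (yes p) ¬p = contradiction p ¬p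

≡true? : {A : Set} (p : A → Bool) (a : A) → Dec (p a ≡ true)
≡true? p a = p a Bool.≟ true

lookup-ext : {A : Set} {n : ℕ} {u v : Vec A n} → (∀ i → lookup u i ≡ lookup v i) → u ≡ v
lookup-ext {u = []} {[]} h = ≡.refl
lookup-ext {u = x ∷ u} {y ∷ v} h = cong₂ _∷_ (h Fin.zero) (lookup-ext (h ∘ Fin.suc))

∈-allVecs⁺ : {A : Set} {n : ℕ} {f : Fin n → List A} {v : Vec A n} →
  (∀ i → lookup v i ∈ f i) → v ∈ allVecs f
∈-allVecs⁺ {v = []} h = here ≡.refl
∈-allVecs⁺ {f = f} {x ∷ v} h = 
  ∈-concatMap-∃⁺ _ (h Fin.zero) (∈-map⁺ (x ∷_) (∈-allVecs⁺ (h ∘ Fin.suc)))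

∈-allVecs⁻ : {A : Set} {n : ℕ} {f : Fin n → List A} {v : Vec A n} →
  v ∈ allVecs f → ∀ i → lookup v i ∈ f i
∈-allVecs⁻ {n = suc n} {f} v∈ i with ∈-concatMap-∃⁻ _ (f Fin.zero) v∈
... | a , a∈ , q with ∈-map⁻ (a ∷_) q
∈-allVecs⁻ {n = suc n} {f} v∈ Fin.zero    | a , a∈ , q | u , u∈ , ≡.refl = a∈
∈-allVecs⁻ {n = suc n} {f} v∈ (Fin.suc i) | a , a∈ , q | u , u∈ , ≡.refl = ∈-allVecs⁻ u∈ i

allVecs-unique : {A : Set} {n : ℕ} {f : Fin n → List A} → (∀ i → Unique (f i)) → Unique (allVecs f)
allVecs-unique {n = zero} h = [] ∷ []
allVecs-unique {n = suc n} {f} h =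
  concatMap-unique Vec.head (h Fin.zero)
    (λ _ → Uniq.map⁺ (λ e → proj₂ (∷-injective e)) (allVecs-unique (h ∘ Fin.suc)))
    (λ a q → case ∈-map⁻ (a ∷_) q of λ { (_ , _ , ≡.refl) → ≡.refl })

Inj : {n : ℕ} → Vec (Fin n) n → Set
Inj v = ∀ {i j} → lookup v i ≡ lookup v j → i ≡ j

∈-perms⁺ : ∀ {n} {v : Vec (Fin n) n} → Inj v → v ∈ perms n
∈-perms⁺ {n} {v} inj = ∈-filter⁺ (≡true? isInjᵇ) (∈-allVecs⁺ (λ i → ∈-allFin _))
  (and-map⁺ {xs = ordPairs n} λ {p} p∈ → cong not (does-false⁺ (lookup v (proj₁ p) FinP.≟ lookup v (proj₂ p))
     λ e → ℕP.<-irrefl (cong toℕ (inj e)) (∈-ordPairs⁻ p∈)))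

∈-perms⁻ : ∀ {n} {v : Vec (Fin n) n} → v ∈ perms n → Inj v
∈-perms⁻ {n} {v} v∈ = inj
  where
  distinct : ∀ {i j} → toℕ i ℕ.< toℕ j → lookup v i ≢ lookup v j
  distinct {i} {j} i<j e with and-map⁻ (proj₂ (∈-filter⁻ (≡true? isInjᵇ) {xs = allVecs (λ _ → allFin n)} v∈)) (∈-ordPairs⁺ i<j)
  ... | q rewrite does-true⁺ (lookup v i FinP.≟ lookup v j) e = case q of λ ()
  inj : Inj v
  inj {i} {j} e with ℕP.<-cmp (toℕ i) (toℕ j)
  ... | tri< i<j _ _ = contradiction e (distinct i<j)
  ... | tri≈ _ i≡j _ = FinP.toℕ-injective i≡j
  ... | tri> _ _ j<i = contradiction (≡.sym e) (distinct j<i)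

perms-unique : ∀ n → Unique (perms n)
perms-unique n = Uniq.filter⁺ (≡true? isInjᵇ) (allVecs-unique (λ _ → Uniq.allFin⁺ n))

update₂ : {A : Set} {n : ℕ} → Fin n → Fin n → A → A → Vec A n → Vec A n
update₂ a b x y v = (v [ a ]≔ x) [ b ]≔ y

swap : {A : Set} {n : ℕ} → Fin n → Fin n → Vec A n → Vec A n
swap a b v = update₂ a b (lookup v b) (lookup v a) v

module _ {A : Set} {n : ℕ} {a b : Fin n} (a≢b : a ≢ b) {x y : A} (v : Vec A n) where
  lookup-update₂ˡ : lookup (update₂ a b x y v) a ≡ x
  lookup-update₂ˡ = ≡.trans (lookup∘updateAt′ a b a≢b (v [ a ]≔ x)) (lookup∘updateAt a v)

  lookup-update₂ʳ : lookup (update₂ a b x y v) b ≡ y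
  lookup-update₂ʳ = lookup∘updateAt b (v [ a ]≔ x)

  lookup-update₂-other : ∀ {i} → i ≢ a → i ≢ b → lookup (update₂ a b x y v) i ≡ lookup v i
  lookup-update₂-other {i} i≢a i≢b =
    ≡.trans (lookup∘updateAt′ i b i≢b (v [ a ]≔ x)) (lookup∘updateAt′ i a i≢a v)

data Position {n : ℕ} (a b : Fin n) : Fin n → Set where
  at-a  : Position a b a
  at-b  : Position a b b
  other : ∀ {i} → i ≢ a → i ≢ b → Position a b i

position : ∀ {n} (a b i : Fin n) → Position a b i
position a b i with i FinP.≟ a
... | yes ≡.refl = at-a
... | no i≢a with i FinP.≟ b
... | yes ≡.refl = at-b
... | no i≢b = other i≢a i≢b

update₂-update₂ : {A : Set} {n : ℕ} {a b : Fin n} → a ≢ b → ∀ {x y x′ y′ : A} (v : Vec A n) →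
  x′ ≡ lookup v a → y′ ≡ lookup v b → update₂ a b x′ y′ (update₂ a b x y v) ≡ v
update₂-update₂ {a = a} {b} a≢b {x} {y} {x′} {y′} v ≡.refl ≡.refl = lookup-ext go
  where
  go : ∀ i → lookup (update₂ a b x′ y′ (update₂ a b x y v)) i ≡ lookup v i
  go i with position a b i
  ... | at-a = lookup-update₂ˡ a≢b (update₂ a b x y v)
  ... | at-b = lookup-update₂ʳ a≢b (update₂ a b x y v)
  ... | other p q = ≡.trans (lookup-update₂-other a≢b (update₂ a b x y v) p q) (lookup-update₂-other a≢b v p q)

swap-involutive : {A : Set} {n : ℕ} {a b : Fin n} → a ≢ b → (v : Vec A n) → swap a b (swap a b v) ≡ v
swap-involutive a≢b v = update₂-update₂ a≢b v (lookup-update₂ʳ a≢b v) (lookup-update₂ˡ a≢b v)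

swap-injective : ∀ {n} {a b : Fin n} → a ≢ b → {v : Vec (Fin n) n} → Inj v → Inj (swap a b v)
swap-injective {a = a} {b} a≢b {v} inj {i} {j} e with position a b i | position a b j
... | at-a | at-a = ≡.refl
... | at-b | at-b = ≡.refl
... | at-a | at-b = contradiction (≡.sym (inj (≡.trans (≡.sym (lookup-update₂ˡ a≢b v)) (≡.trans e (lookup-update₂ʳ a≢b v))))) a≢b
... | at-b | at-a = contradiction (inj (≡.trans (≡.sym (lookup-update₂ʳ a≢b v)) (≡.trans e (lookup-update₂ˡ a≢b v)))) a≢b
... | at-a | other p q = contradiction (≡.sym (inj (≡.trans (≡.sym (lookup-update₂ˡ a≢b v)) (≡.trans e (lookup-update₂-other a≢b v p q))))) q
... | at-b | other p q = contradiction (≡.sym (inj (≡.trans (≡.sym (lookup-update₂ʳ a≢b v)) (≡.trans e (lookup-update₂-other a≢b v p q))))) p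
... | other p q | at-a = contradiction (inj (≡.trans (≡.sym (lookup-update₂-other a≢b v p q)) (≡.trans e (lookup-update₂ˡ a≢b v)))) q
... | other p q | at-b = contradiction (inj (≡.trans (≡.sym (lookup-update₂-other a≢b v p q)) (≡.trans e (lookup-update₂ʳ a≢b v)))) p
... | other p q | other p′ q′ = inj (≡.trans (≡.sym (lookup-update₂-other a≢b v p q)) (≡.trans e (lookup-update₂-other a≢b v p′ q′)))

-- Parities are computed in `Bool` with `xor`, where a ring solver settles the bookkeeping.
xorL : {A : Set} → List A → (A → Bool) → Bool
xorL xs f = foldr (λ a r → f a xor r) false xs

odd-length-filter : {A : Set} {P : A → Set} (P? : ∀ a → Dec (P a)) (xs : List A) →
  odd (List.length (filter P? xs)) ≡ xorL xs (does ∘ P?)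
odd-length-filter P? [] = ≡.refl
odd-length-filter P? (x ∷ xs) with does (P? x)
... | true  = cong not (odd-length-filter P? xs)
... | false = odd-length-filter P? xs

xorL-++ : {A : Set} (xs ys : List A) (f : A → Bool) → xorL (xs ++ ys) f ≡ xorL xs f xor xorL ys f
xorL-++ [] ys f = ≡.refl
xorL-++ (x ∷ xs) ys f with f x | xorL-++ xs ys f
... | false | ih = ih
... | true | ih rewrite ih with xorL xs f
... | true = not-involutive _
... | false = ≡.refl

xorL-map : {A B : Set} (g : A → B) (xs : List A) (f : B → Bool) → xorL (map g xs) f ≡ xorL xs (f ∘ g)
xorL-map g [] f = ≡.refl
xorL-map g (x ∷ xs) f = cong (f (g x) xor_) (xorL-map g xs f)

module Parity {n : ℕ} where
  -- Reads against the notation: `lt x y` is true when y < x. Hence `par x v` counts modulo 2 the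
  -- inversions that x forms with the entries of `v` standing to its right.
  lt : Fin n → Fin n → Bool
  lt x y = does (toℕ y ℕ.<? toℕ x)

  par : ∀ {k} → Fin n → Vec (Fin n) k → Bool
  par x [] = false
  par x (y ∷ v) = lt x y xor par x v

  pinv : ∀ {k} → Vec (Fin n) k → Bool
  pinv [] = false
  pinv (x ∷ v) = par x v xor pinv v

  lt-irrefl : ∀ x → lt x x ≡ false
  lt-irrefl x = does-false⁺ (toℕ x ℕ.<? toℕ x) (ℕP.<-irrefl ≡.refl)

  lt-flip : ∀ {x y} → x ≢ y → lt x y ≡ not (lt y x)
  lt-flip {x} {y} x≢y with ℕP.<-cmp (toℕ x) (toℕ y)
  ... | tri< p _ ¬q
    rewrite does-true⁺ (toℕ x ℕ.<? toℕ y) p | does-false⁺ (toℕ y ℕ.<? toℕ x) ¬q = ≡.refl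
  ... | tri≈ _ e _ = contradiction (FinP.toℕ-injective e) x≢y
  ... | tri> ¬p _ q
    rewrite does-false⁺ (toℕ x ℕ.<? toℕ y) ¬p | does-true⁺ (toℕ y ℕ.<? toℕ x) q = ≡.refl

  open xor-∧-Solver

  par-update : ∀ {k} z x (v : Vec (Fin n) k) b →
    par z (v [ b ]≔ x) ≡ par z v xor (lt z (lookup v b) xor lt z x)
  par-update z x (y ∷ v) Fin.zero =
    solve 3 (λ zx zy p → zx :+ p := (zy :+ p) :+ (zy :+ zx)) ≡.refl (lt z x) (lt z y) (par z v)
  par-update z x (y ∷ v) (Fin.suc b) rewrite par-update z x v b =
    solve 3 (λ p q r → p :+ (q :+ r) := (p :+ q) :+ r) ≡.refl (lt z y) (par z v) _

  Distinct : ∀ {k} → Vec (Fin n) k → Set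
  Distinct v = ∀ {i j} → lookup v i ≡ lookup v j → i ≡ j

  -- Replacing an entry y by x changes, for every other entry z, the parity by
  -- lt x z + lt y z: when z stands to the left, both comparisons are negated.
  pinv-update : ∀ {k} x (v : Vec (Fin n) k) b → Distinct v → (∀ i → x ≢ lookup v i) →
    pinv (v [ b ]≔ x) ≡ pinv v xor (par x v xor (lt x (lookup v b) xor par (lookup v b) v))
  pinv-update x (y ∷ v) Fin.zero d x∉ rewrite lt-irrefl y =
    solve 4 (λ px i py xy → px :+ i := (py :+ i) :+ ((xy :+ px) :+ (xy :+ py))) ≡.refl
      (par x v) (pinv v) (par y v) (lt x y)
  pinv-update x (z ∷ v) (Fin.suc b) d x∉
    rewrite par-update z x v b
          | pinv-update x v b (λ e → FinP.suc-injective (d e)) (x∉ ∘ Fin.suc)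
          | lt-flip {x} {z} (x∉ Fin.zero)
          | lt-flip {lookup v b} {z} (λ e → case d {Fin.suc b} {Fin.zero} e of λ ()) =
    solve 7 (λ zv zy zx i px xy py →
        (zv :+ (zy :+ zx)) :+ (i :+ (px :+ (xy :+ py))) :=
        (zv :+ i) :+ (((con true :+ zx) :+ px) :+ (xy :+ ((con true :+ zy) :+ py)))) ≡.refl
      (par z v) (lt z (lookup v b)) (lt z x) (pinv v) (par x v) (lt x (lookup v b)) (par (lookup v b) v)

  par-swap : ∀ {k} z (v : Vec (Fin n) k) {a b} → toℕ a ℕ.< toℕ b → par z (swap a b v) ≡ par z v
  par-swap z (x ∷ v) {Fin.zero} {Fin.suc b} a<b rewrite par-update z x v b =
    solve 3 (λ zy p zx → zy :+ (p :+ (zy :+ zx)) := zx :+ p) ≡.refl (lt z (lookup v b)) (par z v) (lt z x)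
  par-swap z (x ∷ v) {Fin.suc a} {Fin.suc b} (ℕ.s≤s a<b) = cong (lt z x xor_) (par-swap z v a<b)

  -- If the head x changes places with y, the update formulas write the old and the new parity in
  -- terms of `par x v`, `par y v`, `pinv v` and `lt x y`. The contributions of third entries
  -- cancel, and the negation left over comes from the pair x, y itself.
  pinv-swap : ∀ {k} (v : Vec (Fin n) k) {a b} → toℕ a ℕ.< toℕ b → Distinct v → pinv (swap a b v) ≡ not (pinv v)
  pinv-swap (x ∷ v) {Fin.zero} {Fin.suc b} a<b d
    rewrite par-update (lookup v b) x v b | lt-irrefl (lookup v b)
          | pinv-update x v b (λ e → FinP.suc-injective (d e)) (λ i e → case d {Fin.zero} {Fin.suc i} e of λ ())
          | lt-flip {lookup v b} {x} (λ e → case d {Fin.suc b} {Fin.zero} e of λ ()) =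
    solve 4 (λ py xy i px → (py :+ (con true :+ xy)) :+ (i :+ (px :+ (xy :+ py))) := con true :+ (px :+ i)) ≡.refl
      (par (lookup v b) v) (lt x (lookup v b)) (pinv v) (par x v)
  pinv-swap (x ∷ v) {Fin.suc a} {Fin.suc b} (ℕ.s≤s a<b) d
    rewrite par-swap x v a<b | pinv-swap v a<b (λ e → FinP.suc-injective (d e)) =
    solve 2 (λ p i → p :+ (con true :+ i) := con true :+ (p :+ i)) ≡.refl (par x v) (pinv v)

  par-allFin : ∀ {k} x (v : Vec (Fin n) k) → xorL (allFin k) (λ j → lt x (lookup v j)) ≡ par x v
  par-allFin x [] = ≡.refl
  par-allFin {suc k} x (y ∷ v) = cong (lt x y xor_)
    (≡.trans (cong (λ l → xorL l (λ j → lt x (lookup (y ∷ v) j))) (≡.sym (map-tabulate id Fin.suc)))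
      (≡.trans (xorL-map Fin.suc (allFin k) (λ j → lt x (lookup (y ∷ v) j))) (par-allFin x v)))

  pinv-ordPairs : ∀ {k} (v : Vec (Fin n) k) →
    xorL (ordPairs k) (λ p → lt (lookup v (proj₁ p)) (lookup v (proj₂ p))) ≡ pinv v
  pinv-ordPairs [] = ≡.refl
  pinv-ordPairs {suc k} (x ∷ v) = begin
    xorL (ordPairs (suc k)) g ≡⟨ cong (λ l → xorL l g) (ordPairs-suc k) ⟩
    xorL (map h₀ (allFin k) ++ map h₁ (ordPairs k)) g ≡⟨ xorL-++ (map h₀ (allFin k)) _ g ⟩
    xorL (map h₀ (allFin k)) g xor xorL (map h₁ (ordPairs k)) g
      ≡⟨ cong₂ _xor_ (≡.trans (xorL-map h₀ (allFin k) g) (par-allFin x v)) (≡.trans (xorL-map h₁ (ordPairs k) g) (pinv-ordPairs v)) ⟩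
    pinv (x ∷ v) ∎
    where
    open ≡.≡-Reasoning
    g : Fin (suc k) × Fin (suc k) → Bool
    g p = lt (lookup (x ∷ v) (proj₁ p)) (lookup (x ∷ v) (proj₂ p))
    h₀ : Fin k → Fin (suc k) × Fin (suc k)
    h₀ j = Fin.zero , Fin.suc j
    h₁ : Fin k × Fin k → Fin (suc k) × Fin (suc k)
    h₁ p = Fin.suc (proj₁ p) , Fin.suc (proj₂ p)

odd-inversions-swap : ∀ {n} (v : Vec (Fin n) n) {a b} → toℕ a ℕ.< toℕ b → Inj v →
  odd (inversions (swap a b v)) ≡ not (odd (inversions v))
odd-inversions-swap {n} v {a} {b} a<b inj =
  ≡.trans (odd-inversions (swap a b v)) (≡.trans (pinv-swap v a<b inj) (cong not (≡.sym (odd-inversions v))))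
  where
  open Parity {n}
  odd-inversions : ∀ u → odd (inversions u) ≡ pinv u
  odd-inversions u = ≡.trans (odd-length-filter _ (ordPairs n)) (pinv-ordPairs u)

-- Finite sums, products and determinants

Unique-drop-middle : {A : Set} {x : A} (ys : List A) {zs : List A} → Unique (ys ++ x ∷ zs) → Unique (ys ++ zs) × x ∉ ys ++ zs
Unique-drop-middle [] (x∉ ∷ u) = u , λ p → All.lookup x∉ p ≡.refl
Unique-drop-middle {x = x} (y ∷ ys) {zs} (y∉ ∷ u) with Unique-drop-middle ys u
... | u′ , x∉ = (AllP.++⁺ (proj₁ (AllP.++⁻ ys y∉)) (All.tail (proj₂ (AllP.++⁻ ys y∉))) ∷ u′) ,
  λ { (here ≡.refl) → All.lookup y∉ (∈-++⁺ʳ ys (here ≡.refl)) ≡.refl ; (there p) → x∉ p }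

module SumsAndDeterminants {c ℓ : Level} (R : CommutativeRing c ℓ) where
  open RingPart R
  open import Relation.Binary.Reasoning.Setoid setoid
  open import Algebra.Properties.Ring ring public using (-‿distribˡ-*; -‿distribʳ-*; -‿involutive; -0#≈0#; -1*x≈-x; -‿+-comm)
  open import Algebra.Properties.CommutativeSemigroup +-commutativeSemigroup public using () renaming (interchange to +-interchange; x∙yz≈y∙xz to +-x∙yz≈y∙xz)
  open import Algebra.Properties.CommutativeSemigroup *-commutativeSemigroup public using () renaming (interchange to *-interchange; x∙yz≈y∙xz to *-x∙yz≈y∙xz)

  ΣL-cong : {A : Set} (xs : List A) {f g : A → Carrier} → (∀ {x} → x ∈ xs → f x ≈ g x) → ΣL xs f ≈ ΣL xs g
  ΣL-cong [] h = refl
  ΣL-cong (x ∷ xs) h = +-cong (h (here ≡.refl)) (ΣL-cong xs (h ∘ there))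

  ΣL-++ : {A : Set} (xs ys : List A) (f : A → Carrier) → ΣL (xs ++ ys) f ≈ ΣL xs f + ΣL ys f
  ΣL-++ [] ys f = sym (+-identityˡ _)
  ΣL-++ (x ∷ xs) ys f = trans (+-congˡ (ΣL-++ xs ys f)) (sym (+-assoc _ _ _))

  ΣL-map : {A B : Set} (g : A → B) (xs : List A) (f : B → Carrier) → ΣL (map g xs) f ≈ ΣL xs (f ∘ g)
  ΣL-map g [] f = refl
  ΣL-map g (x ∷ xs) f = +-congˡ (ΣL-map g xs f)

  ΣL-concatMap : {A B : Set} (g : A → List B) (xs : List A) (f : B → Carrier) →
    ΣL (concatMap g xs) f ≈ ΣL xs (λ x → ΣL (g x) f)
  ΣL-concatMap g [] f = refl
  ΣL-concatMap g (x ∷ xs) f = trans (ΣL-++ (g x) (concatMap g xs) f) (+-congˡ (ΣL-concatMap g xs f))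

  ΣL-+ : {A : Set} (xs : List A) (f g : A → Carrier) → ΣL xs (λ x → f x + g x) ≈ ΣL xs f + ΣL xs g
  ΣL-+ [] f g = sym (+-identityˡ _)
  ΣL-+ (x ∷ xs) f g = trans (+-congˡ (ΣL-+ xs f g)) (+-interchange _ _ _ _)

  ΣL-*ˡ : {A : Set} (xs : List A) (k : Carrier) (f : A → Carrier) → ΣL xs (λ x → k * f x) ≈ k * ΣL xs f
  ΣL-*ˡ [] k f = sym (zeroʳ k)
  ΣL-*ˡ (x ∷ xs) k f = trans (+-congˡ (ΣL-*ˡ xs k f)) (sym (distribˡ k _ _))

  ΣL-*ʳ : {A : Set} (xs : List A) (k : Carrier) (f : A → Carrier) → ΣL xs (λ x → f x * k) ≈ ΣL xs f * k
  ΣL-*ʳ xs k f = trans (ΣL-cong xs (λ _ → *-comm _ _)) (trans (ΣL-*ˡ xs k f) (*-comm _ _))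

  ΣL-zero : {A : Set} (xs : List A) {f : A → Carrier} → (∀ {x} → x ∈ xs → f x ≈ 0#) → ΣL xs f ≈ 0#
  ΣL-zero [] h = refl
  ΣL-zero (x ∷ xs) h = trans (+-cong (h (here ≡.refl)) (ΣL-zero xs (h ∘ there))) (+-identityˡ _)

  ΣL-comm : {A B : Set} (xs : List A) (ys : List B) (f : A → B → Carrier) →
    ΣL xs (λ x → ΣL ys (f x)) ≈ ΣL ys (λ y → ΣL xs (λ x → f x y))
  ΣL-comm [] ys f = sym (ΣL-zero ys (λ _ → refl))
  ΣL-comm (x ∷ xs) ys f = trans (+-congˡ (ΣL-comm xs ys f)) (sym (ΣL-+ ys _ _))

  ΣL-filter : {A : Set} {P : A → Set} (P? : ∀ a → Dec (P a)) (xs : List A) (f : A → Carrier) →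
    ΣL (filter P? xs) f ≈ ΣL xs (λ x → if does (P? x) then f x else 0#)
  ΣL-filter P? [] f = refl
  ΣL-filter P? (x ∷ xs) f with does (P? x)
  ... | true = +-congˡ (ΣL-filter P? xs f)
  ... | false = trans (ΣL-filter P? xs f) (sym (+-identityˡ _))

  ΣL-single : {A : Set} {xs : List A} → Unique xs → {a : A} → a ∈ xs → (f : A → Carrier) →
    (∀ {x} → x ∈ xs → x ≢ a → f x ≈ 0#) → ΣL xs f ≈ f a
  ΣL-single {xs = x ∷ xs} (x∉ ∷ u) (here ≡.refl) f z =
    trans (+-congˡ (ΣL-zero xs (λ y∈ → z (there y∈) (λ e → All.lookup x∉ y∈ (≡.sym e))))) (+-identityʳ _)
  ΣL-single {xs = x ∷ xs} (x∉ ∷ u) (there a∈) f z =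
    trans (+-cong (z (here ≡.refl) (All.lookup x∉ a∈)) (ΣL-single u a∈ f (z ∘ there))) (+-identityˡ _)

  ΣL-drop-middle : {A : Set} (ys : List A) (x : A) (zs : List A) (f : A → Carrier) →
    ΣL (ys ++ x ∷ zs) f ≈ f x + ΣL (ys ++ zs) f
  ΣL-drop-middle [] x zs f = refl
  ΣL-drop-middle (y ∷ ys) x zs f = trans (+-congˡ (ΣL-drop-middle ys x zs f)) (+-x∙yz≈y∙xz _ _ _)

  -- `fixfree` is a field of its own because `f a ≈ - f a` does not give `f a ≈ 0#` when 2 is a zero
  -- divisor.
  record SignReversing {A : Set} (L : List A) (φ : A → A) (f : A → Carrier) : Set ℓ where
    field
      closed     : ∀ {a} → a ∈ L → φ a ∈ L
      involutive : ∀ {a} → a ∈ L → φ (φ a) ≡ a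
      fixfree    : ∀ {a} → a ∈ L → φ a ≢ a
      reversing  : ∀ {a} → a ∈ L → f (φ a) ≈ - f a

  -- The head a and its partner φ a are removed together, and φ still maps the remainder to itself.
  -- The remainder is not a tail of the list, so the recursion runs on a bound for the length.
  ΣL-involution : {A : Set} {L : List A} {φ : A → A} {f : A → Carrier} →
    Unique L → SignReversing L φ f → ΣL L f ≈ 0#
  ΣL-involution {A} {L} {φ} {f} = go (List.length L) L ℕP.≤-refl
    where
    go : ∀ n L → List.length L ℕ.≤ n → Unique L → SignReversing L φ f → ΣL L f ≈ 0#
    go n [] _ _ _ = refl
    go (suc n) (a ∷ L) (ℕ.s≤s len) (a∉ ∷ u) S with SignReversing.closed S (here ≡.refl)
    ... | here e = contradiction e (SignReversing.fixfree S (here ≡.refl))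
    ... | there φa∈ with ∈-∃++ φa∈
    ... | ys , zs , ≡.refl = begin
      f a + ΣL (ys ++ φ a ∷ zs) f      ≈⟨ +-congˡ (ΣL-drop-middle ys (φ a) zs f) ⟩
      f a + (f (φ a) + ΣL (ys ++ zs) f) ≈⟨ sym (+-assoc _ _ _) ⟩
      f a + f (φ a) + ΣL (ys ++ zs) f  ≈⟨ +-cong (trans (+-congˡ (reversing (here ≡.refl))) (-‿inverseʳ (f a))) (go n (ys ++ zs) len′ (proj₁ du) S′) ⟩
      0# + 0# ≈⟨ +-identityˡ 0# ⟩
      0# ∎
      where
      open SignReversing S
      du = Unique-drop-middle ys u
      len′ : List.length (ys ++ zs) ℕ.≤ n
      len′ = ℕP.≤-trans (ℕP.≤-reflexive (length-++ ys)) (ℕP.≤-trans (ℕP.≤-trans (ℕP.+-monoʳ-≤ (List.length ys) (ℕP.n≤1+n _)) (ℕP.≤-reflexive (≡.sym (length-++ ys)))) len)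
      incl : ∀ {b} → b ∈ ys ++ zs → b ∈ a ∷ ys ++ φ a ∷ zs
      incl b∈ with ∈-++⁻ ys b∈
      ... | inj₁ p = there (∈-++⁺ˡ p)
      ... | inj₂ p = there (∈-++⁺ʳ ys (there p))
      b≢a : ∀ {b} → b ∈ ys ++ zs → b ≢ a
      b≢a b∈ ≡.refl with incl b∈
      ... | there q = All.lookup a∉ q ≡.refl
      ... | here _ with ∈-++⁻ ys b∈
      ...   | inj₁ p = All.lookup a∉ (∈-++⁺ˡ p) ≡.refl
      ...   | inj₂ p = All.lookup a∉ (∈-++⁺ʳ ys (there p)) ≡.refl
      closed′ : ∀ {b} → b ∈ ys ++ zs → φ b ∈ ys ++ zs
      closed′ {b} b∈ with closed (incl b∈)
      ... | here e = contradiction (subst (_∈ ys ++ zs) (≡.trans (≡.sym (involutive (incl b∈))) (cong φ e)) b∈) (proj₂ du)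
      ... | there q with ∈-++⁻ ys q
      ...   | inj₁ p = ∈-++⁺ˡ p
      ...   | inj₂ (there p) = ∈-++⁺ʳ ys p
      ...   | inj₂ (here e) = contradiction (≡.trans (≡.sym (involutive (incl b∈))) (≡.trans (cong φ e) (involutive (here ≡.refl)))) (b≢a b∈)
      S′ : SignReversing (ys ++ zs) φ f
      S′ = record { closed = closed′ ; involutive = involutive ∘ incl ; fixfree = fixfree ∘ incl ; reversing = reversing ∘ incl }

  ΠL-cong : {A : Set} (xs : List A) {f g : A → Carrier} → (∀ x → f x ≈ g x) → ΠL xs f ≈ ΠL xs g
  ΠL-cong [] h = refl
  ΠL-cong (x ∷ xs) h = *-cong (h x) (ΠL-cong xs h)

  ΠL-++ : {A : Set} (xs ys : List A) (f : A → Carrier) → ΠL (xs ++ ys) f ≈ ΠL xs f * ΠL ys f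
  ΠL-++ [] ys f = sym (*-identityˡ _)
  ΠL-++ (x ∷ xs) ys f = trans (*-congˡ (ΠL-++ xs ys f)) (sym (*-assoc _ _ _))

  ΠL-map : {A B : Set} (g : A → B) (xs : List A) (f : B → Carrier) → ΠL (map g xs) f ≈ ΠL xs (f ∘ g)
  ΠL-map g [] f = refl
  ΠL-map g (x ∷ xs) f = *-congˡ (ΠL-map g xs f)

  ΠL-* : {A : Set} (xs : List A) (f g : A → Carrier) → ΠL xs (λ x → f x * g x) ≈ ΠL xs f * ΠL xs g
  ΠL-* [] f g = sym (*-identityˡ _)
  ΠL-* (x ∷ xs) f g = trans (*-congˡ (ΠL-* xs f g)) (*-interchange _ _ _ _)

  ∏-cong : {n : ℕ} {f g : Fin n → Carrier} → (∀ i → f i ≈ g i) → ∏ f ≈ ∏ g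
  ∏-cong {n} = ΠL-cong (allFin n)

  ∏-* : {n : ℕ} (f g : Fin n → Carrier) → ∏ (λ i → f i * g i) ≈ ∏ f * ∏ g
  ∏-* {n} = ΠL-* (allFin n)

  ∏-suc : {n : ℕ} (f : Fin (suc n) → Carrier) → ∏ f ≈ f Fin.zero * ∏ (f ∘ Fin.suc)
  ∏-suc {n} f = *-congˡ (trans (reflexive (cong (λ l → ΠL l f) (≡.sym (map-tabulate id Fin.suc)))) (ΠL-map Fin.suc (allFin n) f))

  Σ-suc : {n : ℕ} (f : Fin (suc n) → Carrier) → ΣL (allFin (suc n)) f ≈ f Fin.zero + ΣL (allFin n) (f ∘ Fin.suc)
  Σ-suc {n} f = +-congˡ (trans (reflexive (cong (λ l → ΣL l f) (≡.sym (map-tabulate id Fin.suc)))) (ΣL-map Fin.suc (allFin n) f))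

  -- The factor at `a` is overwritten by 1 instead of deleted, which keeps the index set `Fin n` and
  -- allows a second factor to be extracted in the same way.
  except : {n : ℕ} → Fin n → (Fin n → Carrier) → Fin n → Carrier
  except a g i = if does (i FinP.≟ a) then 1# else g i

  ∏-except : {n : ℕ} (a : Fin n) (g : Fin n → Carrier) → ∏ g ≈ g a * ∏ (except a g)
  ∏-except {suc n} Fin.zero g = begin
    ∏ g ≈⟨ ∏-suc g ⟩
    g Fin.zero * ∏ (g ∘ Fin.suc) ≈⟨ *-congˡ (sym (trans (∏-suc (except Fin.zero g)) (*-identityˡ _))) ⟩
    g Fin.zero * ∏ (except Fin.zero g) ∎
  ∏-except {suc n} (Fin.suc a) g = begin
    ∏ g ≈⟨ ∏-suc g ⟩
    g Fin.zero * ∏ (g ∘ Fin.suc) ≈⟨ *-congˡ (∏-except a (g ∘ Fin.suc)) ⟩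
    g Fin.zero * (g (Fin.suc a) * ∏ (except a (g ∘ Fin.suc))) ≈⟨ *-x∙yz≈y∙xz _ _ _ ⟩
    g (Fin.suc a) * (g Fin.zero * ∏ (except a (g ∘ Fin.suc))) ≈⟨ *-congˡ (sym (∏-suc (except (Fin.suc a) g))) ⟩
    g (Fin.suc a) * ∏ (except (Fin.suc a) g) ∎

  ∏-zero : {n : ℕ} (a : Fin n) (g : Fin n → Carrier) → g a ≈ 0# → ∏ g ≈ 0#
  ∏-zero a g e = trans (∏-except a g) (trans (*-congʳ e) (zeroˡ _))

  -- Used for the swap of two values of a permutation in a determinant and for the exchange of two
  -- path tails in a family weight: single factors may change as long as the product of the two is
  -- kept.
  ∏-exchange : {n : ℕ} {a b : Fin n} → a ≢ b → (g h : Fin n → Carrier) →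
    (∀ {i} → i ≢ a → i ≢ b → g i ≈ h i) → g a * g b ≈ h a * h b → ∏ g ≈ ∏ h
  ∏-exchange {n} {a} {b} a≢b g h same ab = begin
    ∏ g ≈⟨ extract g ⟩
    g a * g b * ∏ (except b (except a g)) ≈⟨ *-cong ab (∏-cong pointwise) ⟩
    h a * h b * ∏ (except b (except a h)) ≈⟨ sym (extract h) ⟩
    ∏ h ∎
    where
    extract : ∀ k → ∏ k ≈ k a * k b * ∏ (except b (except a k))
    extract k = trans (∏-except a k) (trans (*-congˡ (trans (∏-except b (except a k)) (*-congʳ at-b′))) (sym (*-assoc _ _ _)))
      where
      at-b′ : except a k b ≈ k b
      at-b′ rewrite does-false⁺ (b FinP.≟ a) (a≢b ∘ ≡.sym) = refl
    pointwise : ∀ i → except b (except a g) i ≈ except b (except a h) i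
    pointwise i with i FinP.≟ b
    ... | yes _ = refl
    ... | no i≢b with i FinP.≟ a
    ... | yes _ = refl
    ... | no i≢a = same i≢a i≢b

  -- The distributive law for a product of sums. It expands the rows of a matrix product and later
  -- sums out, one after another, the paths, endpoints and starting points of a family.
  ∏-allVecs : {A : Set} {n : ℕ} (f : Fin n → List A) (g : Fin n → A → Carrier) →
    ΣL (allVecs f) (λ v → ∏ (λ i → g i (lookup v i))) ≈ ∏ (λ i → ΣL (f i) (g i))
  ∏-allVecs {n = zero} f g = +-identityʳ 1#
  ∏-allVecs {n = suc n} f g = begin
    ΣL (allVecs f) (λ v → ∏ (λ i → g i (lookup v i)))
      ≈⟨ ΣL-concatMap (λ a → map (a ∷_) (allVecs (f ∘ Fin.suc))) (f Fin.zero) _ ⟩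
    ΣL (f Fin.zero) (λ a → ΣL (map (a ∷_) (allVecs (f ∘ Fin.suc))) (λ v → ∏ (λ i → g i (lookup v i))))
      ≈⟨ ΣL-cong (f Fin.zero) (λ {a} _ → begin
          ΣL (map (a ∷_) (allVecs (f ∘ Fin.suc))) (λ v → ∏ (λ i → g i (lookup v i))) ≈⟨ ΣL-map (a ∷_) (allVecs (f ∘ Fin.suc)) _ ⟩
          ΣL (allVecs (f ∘ Fin.suc)) (λ v → ∏ (λ i → g i (lookup (a ∷ v) i)))
            ≈⟨ ΣL-cong (allVecs (f ∘ Fin.suc)) (λ {v} _ → ∏-suc (λ i → g i (lookup (a ∷ v) i))) ⟩
          ΣL (allVecs (f ∘ Fin.suc)) (λ v → g Fin.zero a * ∏ (λ i → g (Fin.suc i) (lookup v i)))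
            ≈⟨ ΣL-*ˡ (allVecs (f ∘ Fin.suc)) (g Fin.zero a) _ ⟩
          g Fin.zero a * ΣL (allVecs (f ∘ Fin.suc)) (λ v → ∏ (λ i → g (Fin.suc i) (lookup v i)))
            ≈⟨ *-congˡ (∏-allVecs (f ∘ Fin.suc) (g ∘ Fin.suc)) ⟩
          g Fin.zero a * ∏ (λ i → ΣL (f (Fin.suc i)) (g (Fin.suc i))) ∎) ⟩
    ΣL (f Fin.zero) (λ a → g Fin.zero a * ∏ (λ i → ΣL (f (Fin.suc i)) (g (Fin.suc i)))) ≈⟨ ΣL-*ʳ (f Fin.zero) _ _ ⟩
    ΣL (f Fin.zero) (g Fin.zero) * ∏ (λ i → ΣL (f (Fin.suc i)) (g (Fin.suc i))) ≈⟨ sym (∏-suc (λ i → ΣL (f i) (g i))) ⟩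
    ∏ (λ i → ΣL (f i) (g i)) ∎

  negOnePow-suc : ∀ k → negOnePow (suc k) ≈ - negOnePow k
  negOnePow-suc k with odd k
  ... | true = sym (-‿involutive 1#)
  ... | false = refl

  negOnePow-flip : ∀ {j k} → odd j ≡ not (odd k) → negOnePow j ≈ - negOnePow k
  negOnePow-flip {j} {k} e = trans (reflexive (cong (λ b → if b then - 1# else 1#) e)) (negOnePow-suc k)

  negOnePow-+ : ∀ j k → negOnePow (j ℕ.+ k) ≈ negOnePow j * negOnePow k
  negOnePow-+ zero k = sym (*-identityˡ _)
  negOnePow-+ (suc j) k = begin
    negOnePow (suc (j ℕ.+ k)) ≈⟨ negOnePow-suc (j ℕ.+ k) ⟩
    - negOnePow (j ℕ.+ k) ≈⟨ -‿cong (negOnePow-+ j k) ⟩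
    - (negOnePow j * negOnePow k) ≈⟨ -‿distribˡ-* _ _ ⟩
    - negOnePow j * negOnePow k ≈⟨ *-congʳ (sym (negOnePow-suc j)) ⟩
    negOnePow (suc j) * negOnePow k ∎

  negOnePow-square : ∀ k → negOnePow k * negOnePow k ≈ 1#
  negOnePow-square k with odd k
  ... | true = trans (-1*x≈-x (- 1#)) (-‿involutive 1#)
  ... | false = *-identityˡ 1#

  -- Determinants over an arbitrary commutative ring.

  det-cong : {n : ℕ} {M N : Fin n → Fin n → Carrier} → (∀ i j → M i j ≈ N i j) → det M ≈ det N
  det-cong {n} h = ΣL-cong (perms n) (λ _ → *-congˡ (∏-cong (λ i → h i _)))

  det-scale-rows : {n : ℕ} (k : Fin n → Carrier) (M : Fin n → Fin n → Carrier) →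
    det (λ i j → k i * M i j) ≈ ∏ k * det M
  det-scale-rows {n} k M = trans
    (ΣL-cong (perms n) (λ {v} _ → trans (*-congˡ (∏-* k (λ i → M i (lookup v i)))) (*-x∙yz≈y∙xz _ _ _)))
    (ΣL-*ˡ (perms n) (∏ k) _)

  -- The terms of v and of v with its values at a and b swapped cancel. An argument from det = -det
  -- would fail where 2 is a zero divisor.
  det-equal-rows : {n : ℕ} (M : Fin n → Fin n → Carrier) {a b : Fin n} → toℕ a ℕ.< toℕ b →
    (∀ j → M a j ≈ M b j) → det M ≈ 0#
  det-equal-rows {n} M {a} {b} a<b eq = ΣL-involution {φ = swap a b} (perms-unique n) (record
    { closed = λ {v} v∈ → ∈-perms⁺ {v = swap a b v} (swap-injective a≢b {v} (∈-perms⁻ v∈))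
    ; involutive = λ {v} _ → swap-involutive a≢b v
    ; fixfree = λ {v} v∈ e → a≢b (≡.sym (∈-perms⁻ v∈ (≡.trans (≡.sym (lookup-update₂ˡ a≢b v)) (cong (λ u → lookup u a) e))))
    ; reversing = λ {v} v∈ → trans
        (*-cong (negOnePow-flip {inversions (swap a b v)} {inversions v} (odd-inversions-swap v a<b (∈-perms⁻ v∈)))
          (∏-exchange a≢b (λ i → M i (lookup (swap a b v) i)) (λ i → M i (lookup v i))
            (λ {i} p q → reflexive (cong (M i) (lookup-update₂-other a≢b v p q)))
            (begin
              M a (lookup (swap a b v) a) * M b (lookup (swap a b v) b)
                ≈⟨ *-cong (reflexive (cong (M a) (lookup-update₂ˡ a≢b v))) (reflexive (cong (M b) (lookup-update₂ʳ a≢b v))) ⟩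
              M a (lookup v b) * M b (lookup v a) ≈⟨ *-cong (eq _) (sym (eq _)) ⟩
              M b (lookup v b) * M a (lookup v a) ≈⟨ *-comm _ _ ⟩
              M a (lookup v a) * M b (lookup v b) ∎)))
        (sym (-‿distribˡ-* _ _)) })
    where
    a≢b : a ≢ b
    a≢b e = ℕP.<-irrefl (cong toℕ e) a<b

  -- Expanding the rows of L B gives a sum over all index vectors v of ∏ L i (v i) times
  -- the determinant of the rows v i of B; triangularity and alternation leave only v = id.
  det-lower-triangular : {n : ℕ} (L B : Fin n → Fin n → Carrier) →
    (∀ {i p} → toℕ i ℕ.< toℕ p → L i p ≈ 0#) →
    det (λ i j → ΣL (allFin n) (λ p → L i p * B p j)) ≈ ∏ (λ i → L i i) * det B
  det-lower-triangular {n} L B low = begin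
    det (λ i j → ΣL (allFin n) (λ p → L i p * B p j))
      ≈⟨ ΣL-cong (perms n) (λ {v} _ → expand v) ⟩
    ΣL (perms n) (λ v → ΣL allIndices (λ u → ∏ (λ i → L i (lookup u i)) * (negOnePow (inversions v) * ∏ (λ i → B (lookup u i) (lookup v i)))))
      ≈⟨ ΣL-comm (perms n) allIndices _ ⟩
    ΣL allIndices (λ u → ΣL (perms n) (λ v → ∏ (λ i → L i (lookup u i)) * (negOnePow (inversions v) * ∏ (λ i → B (lookup u i) (lookup v i)))))
      ≈⟨ ΣL-cong allIndices (λ {u} _ → ΣL-*ˡ (perms n) _ _) ⟩
    ΣL allIndices term
      ≈⟨ ΣL-single (allVecs-unique (λ _ → Uniq.allFin⁺ n)) {idv} (∈-allVecs⁺ (λ _ → ∈-allFin _)) term (λ {u} _ → vanish u) ⟩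
    term idv
      ≈⟨ *-cong (∏-cong (λ i → reflexive (cong (L i) (lookup∘tabulate id i)))) (det-cong (λ i j → reflexive (cong (λ p → B p j) (lookup∘tabulate id i)))) ⟩
    ∏ (λ i → L i i) * det B ∎
    where
    allIndices : List (Vec (Fin n) n)
    allIndices = allVecs (λ _ → allFin n)
    idv : Vec (Fin n) n
    idv = Vec.tabulate id
    term : Vec (Fin n) n → Carrier
    term u = ∏ (λ i → L i (lookup u i)) * det (λ i j → B (lookup u i) j)
    expand : ∀ v → negOnePow (inversions v) * ∏ (λ i → ΣL (allFin n) (λ p → L i p * B p (lookup v i))) ≈
      ΣL allIndices (λ u → ∏ (λ i → L i (lookup u i)) * (negOnePow (inversions v) * ∏ (λ i → B (lookup u i) (lookup v i))))
    expand v = trans (*-congˡ (sym (∏-allVecs (λ _ → allFin n) (λ i p → L i p * B p (lookup v i)))))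
      (trans (sym (ΣL-*ˡ allIndices _ _))
        (ΣL-cong allIndices (λ {u} _ → trans (*-congˡ (∏-* (λ i → L i (lookup u i)) (λ i → B (lookup u i) (lookup v i)))) (*-x∙yz≈y∙xz _ _ _))))
    vanish : ∀ u → u ≢ idv → term u ≈ 0#
    vanish u u≢id with FinP.any? (λ i → toℕ i ℕ.<? toℕ (lookup u i))
    ... | yes (i , i<) = trans (*-congʳ (∏-zero i (λ i → L i (lookup u i)) (low i<))) (zeroˡ _)
    ... | no none with FinP.any? (λ a → FinP.any? (λ b → (toℕ a ℕ.<? toℕ b) ×-dec (lookup u a FinP.≟ lookup u b)))
    ... | yes (a , b , a<b , e) =
      trans (*-congˡ (det-equal-rows (λ i j → B (lookup u i) j) a<b (λ j → reflexive (cong (λ p → B p j) e)))) (zeroʳ _)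
    ... | no noPair = contradiction (lookup-ext (λ i → ≡.trans (fixed i (ℕI.<-wellFounded (toℕ i))) (≡.sym (lookup∘tabulate id i)))) u≢id
      where
      -- Here u i ≤ i for all i, and u has no repetition. If u i = k < i, then u k = k by strong
      -- induction, so the value k occurs both at k and at i.
      fixed : ∀ i → ℕI.Acc ℕ._<_ (toℕ i) → lookup u i ≡ i
      fixed i (ℕI.acc rs) with ℕP.m≤n⇒m<n∨m≡n (ℕP.≮⇒≥ (λ q → none (i , q)))
      ... | inj₂ e = FinP.toℕ-injective e
      ... | inj₁ k<i = contradiction (lookup u i , i , k<i , fixed (lookup u i) (rs k<i)) noPair

-- Walks and admissible paths

_≟ᵖ_ : DecidableEquality Point
_≟ᵖ_ = ≡-dec ℤ._≟_ ℤ._≟_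

==ᵖ⁻ : ∀ p q → (p ==ᵖ q) ≡ true → p ≡ q
==ᵖ⁻ (a , b) (c , d) e with a ℤ.≟ c | b ℤ.≟ d
... | yes ≡.refl | yes ≡.refl = ≡.refl

==ᵖ-refl : ∀ p → (p ==ᵖ p) ≡ true
==ᵖ-refl (a , b) rewrite does-true⁺ (a ℤ.≟ a) ≡.refl | does-true⁺ (b ℤ.≟ b) ≡.refl = ≡.refl

record Additive (g : Point → ℤ) : Set where
  constructor additive
  field add : ∀ p q → g (p ⊕ q) ≡ g p ℤ.+ g q
open Additive public

module _ {f : Bool → Point} where
  endOf-++ : ∀ q as {bs} → endOf f q (as ++ bs) ≡ endOf f (endOf f q as) bs
  endOf-++ q [] = ≡.refl
  endOf-++ q (a ∷ as) = endOf-++ (q ⊕ f a) as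

  first∈walk : ∀ q bs → q ∈ walk f q bs
  first∈walk q [] = here ≡.refl
  first∈walk q (b ∷ bs) = here ≡.refl

  last∈walk : ∀ q bs → endOf f q bs ∈ walk f q bs
  last∈walk q [] = here ≡.refl
  last∈walk q (b ∷ bs) = there (last∈walk (q ⊕ f b) bs)

  walk-++⁻ : ∀ {u} q as {bs} → u ∈ walk f q (as ++ bs) → u ∈ walk f q as ⊎ u ∈ walk f (endOf f q as) bs
  walk-++⁻ q [] u∈ = inj₂ u∈
  walk-++⁻ q (a ∷ as) (here e) = inj₁ (here e)
  walk-++⁻ q (a ∷ as) (there u∈) with walk-++⁻ (q ⊕ f a) as u∈
  ... | inj₁ p = inj₁ (there p)
  ... | inj₂ p = inj₂ p

  walk-++⁺ˡ : ∀ {u} q as {bs} → u ∈ walk f q as → u ∈ walk f q (as ++ bs)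
  walk-++⁺ˡ q [] {bs} (here ≡.refl) = first∈walk q bs
  walk-++⁺ˡ q (a ∷ as) (here e) = here e
  walk-++⁺ˡ q (a ∷ as) (there u∈) = there (walk-++⁺ˡ (q ⊕ f a) as u∈)

  walk-++⁺ʳ : ∀ {u} q as {bs} → u ∈ walk f (endOf f q as) bs → u ∈ walk f q (as ++ bs)
  walk-++⁺ʳ q [] u∈ = u∈
  walk-++⁺ʳ q (a ∷ as) u∈ = there (walk-++⁺ʳ (q ⊕ f a) as u∈)

  module _ {g : Point → ℤ} (ag : Additive g) where
    module _ (mono : ∀ b → + 0 ℤ.≤ g (f b)) where
      step-≤ : ∀ q b → g q ℤ.≤ g (q ⊕ f b)
      step-≤ q b = subst₂ ℤ._≤_ (ℤP.+-identityʳ (g q)) (≡.sym (add ag q (f b))) (ℤP.+-monoʳ-≤ (g q) (mono b))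

      walk-≤ : ∀ {u} q bs → u ∈ walk f q bs → g q ℤ.≤ g u
      walk-≤ q [] (here ≡.refl) = ℤP.≤-refl
      walk-≤ q (b ∷ bs) (here ≡.refl) = ℤP.≤-refl
      walk-≤ q (b ∷ bs) (there u∈) = ℤP.≤-trans (step-≤ q b) (walk-≤ (q ⊕ f b) bs u∈)

      walk-≤-end : ∀ {u} q bs → u ∈ walk f q bs → g u ℤ.≤ g (endOf f q bs)
      walk-≤-end q [] (here ≡.refl) = ℤP.≤-refl
      walk-≤-end q (b ∷ bs) (here ≡.refl) = walk-≤ q (b ∷ bs) (last∈walk q (b ∷ bs))
      walk-≤-end q (b ∷ bs) (there u∈) = walk-≤-end (q ⊕ f b) bs u∈

    module _ (strict : ∀ b → + 0 ℤ.< g (f b)) where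
      step-< : ∀ q b → g q ℤ.< g (q ⊕ f b)
      step-< q b = subst₂ ℤ._<_ (ℤP.+-identityʳ (g q)) (≡.sym (add ag q (f b))) (ℤP.+-monoʳ-< (g q) (strict b))

      walk-< : ∀ {u} q bs → u ∈ walk f q bs → u ≡ q ⊎ g q ℤ.< g u
      walk-< q [] (here e) = inj₁ e
      walk-< q (b ∷ bs) (here e) = inj₁ e
      walk-< q (b ∷ bs) (there u∈) = inj₂ (ℤP.<-≤-trans (step-< q b) (walk-≤ (ℤP.<⇒≤ ∘ strict) (q ⊕ f b) bs u∈))

      walk-<-end : ∀ {u} q bs → u ∈ walk f q bs → u ≡ endOf f q bs ⊎ g u ℤ.< g (endOf f q bs)
      walk-<-end q [] (here e) = inj₁ e
      walk-<-end q (b ∷ bs) (here ≡.refl) = inj₂ (ℤP.<-≤-trans (step-< q b) (walk-≤-end (ℤP.<⇒≤ ∘ strict) (q ⊕ f b) bs (first∈walk _ bs)))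
      walk-<-end q (b ∷ bs) (there u∈) = walk-<-end (q ⊕ f b) bs u∈

    endOf-unit-steps : (∀ b → g (f b) ≡ + 1) → ∀ q bs → g (endOf f q bs) ≡ g q ℤ.+ + length bs
    endOf-unit-steps unit q [] = ≡.sym (ℤP.+-identityʳ (g q))
    endOf-unit-steps unit q (b ∷ bs) = begin
      g (endOf f (q ⊕ f b) bs)     ≡⟨ endOf-unit-steps unit (q ⊕ f b) bs ⟩
      g (q ⊕ f b) ℤ.+ + length bs  ≡⟨ cong (ℤ._+ + length bs) (≡.trans (add ag q (f b)) (cong (λ z → g q ℤ.+ z) (unit b))) ⟩
      g q ℤ.+ + 1 ℤ.+ + length bs  ≡⟨ ℤP.+-assoc (g q) (+ 1) (+ length bs) ⟩
      g q ℤ.+ + suc (length bs) ∎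
      where open ≡.≡-Reasoning

diagSum-additive : Additive diagSum
diagSum-additive = additive λ (a , b) (c , d) → solve 4 (λ a b c d → (a :+ c) :+ (b :+ d) := (a :+ b) :+ (c :+ d)) ≡.refl a b c d
  where open +-*-Solver

-- Functionals adapted to the two kinds of starting points: the distance from the main
-- diagonal, the coordinate in which every step of the initial segment has length one,
-- and a potential increasing along all steps.
aside climb potential : Start → Point → ℤ
aside α (x , y) = y ℤ.- x
aside β (x , y) = x ℤ.- y
climb α (x , y) = y
climb β (x , y) = x
potential α (x , y) = x ℤ.+ (y ℤ.+ y)
potential β (x , y) = (x ℤ.+ x) ℤ.+ y

aside-additive : ∀ s → Additive (aside s)
aside-additive α = additive λ (a , b) (c , d) → solve 4 (λ a b c d → (b :+ d) :- (a :+ c) := (b :- a) :+ (d :- c)) ≡.refl a b c d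
  where open +-*-Solver
aside-additive β = additive λ (a , b) (c , d) → solve 4 (λ a b c d → (a :+ c) :- (b :+ d) := (a :- b) :+ (c :- d)) ≡.refl a b c d
  where open +-*-Solver

climb-additive : ∀ s → Additive (climb s)
climb-additive α = additive λ p q → ≡.refl
climb-additive β = additive λ p q → ≡.refl

potential-additive : ∀ s → Additive (potential s)
potential-additive α = additive λ (a , b) (c , d) → solve 4 (λ a b c d → (a :+ c) :+ ((b :+ d) :+ (b :+ d)) := (a :+ (b :+ b)) :+ (c :+ (d :+ d))) ≡.refl a b c d
  where open +-*-Solver
potential-additive β = additive λ (a , b) (c , d) → solve 4 (λ a b c d → ((a :+ c) :+ (a :+ c)) :+ (b :+ d) := ((a :+ a) :+ b) :+ ((c :+ c) :+ d)) ≡.refl a b c d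
  where open +-*-Solver

diagSum-initStep : ∀ s b → + 0 ℤ.≤ diagSum (initStep s b)
diagSum-initStep α true = ℤ.+≤+ ℕ.z≤n
diagSum-initStep α false = ℤ.+≤+ ℕ.z≤n
diagSum-initStep β true = ℤ.+≤+ ℕ.z≤n
diagSum-initStep β false = ℤ.+≤+ ℕ.z≤n

diagSum-finStep : ∀ b → diagSum (finStep b) ≡ + 1
diagSum-finStep true = ≡.refl
diagSum-finStep false = ≡.refl

diagSum-finStep->0 : ∀ b → + 0 ℤ.< diagSum (finStep b)
diagSum-finStep->0 true = ℤ.+<+ ℕ.z<s
diagSum-finStep->0 false = ℤ.+<+ ℕ.z<s

aside-initStep : ∀ s b → + 0 ℤ.≤ aside s (initStep s b)
aside-initStep α true = ℤ.+≤+ ℕ.z≤n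
aside-initStep α false = ℤ.+≤+ ℕ.z≤n
aside-initStep β true = ℤ.+≤+ ℕ.z≤n
aside-initStep β false = ℤ.+≤+ ℕ.z≤n

aside-startPt : ∀ i s → aside s (startPt i s) ≡ + (i ℕ.+ i)
aside-startPt i s = ≡.trans (lem s) (≡.trans (cong (λ z → z ℤ.- + i) (ℤP.pos-* 3 i))
    (solve 1 (λ i → con (+ 3) :* i :- i := i :+ i) ≡.refl (+ i)))
  where
  open +-*-Solver
  lem : ∀ s → aside s (startPt i s) ≡ + (3 ℕ.* i) ℤ.- + i
  lem α = solve 2 (λ i j → (con (+ 1) :- i) :- (con (+ 1) :- j) := j :- i) ≡.refl (+ i) (+ (3 ℕ.* i))
  lem β = solve 2 (λ i j → (con (+ 1) :- i) :- (con (+ 1) :- j) := j :- i) ≡.refl (+ i) (+ (3 ℕ.* i))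

climb-initStep : ∀ s b → climb s (initStep s b) ≡ + 1
climb-initStep α true = ≡.refl
climb-initStep α false = ≡.refl
climb-initStep β true = ≡.refl
climb-initStep β false = ≡.refl

climb-finStep : ∀ s b → + 0 ℤ.≤ climb s (finStep b)
climb-finStep α true = ℤ.+≤+ ℕ.z≤n
climb-finStep α false = ℤ.+≤+ ℕ.z≤n
climb-finStep β true = ℤ.+≤+ ℕ.z≤n
climb-finStep β false = ℤ.+≤+ ℕ.z≤n

potential-initStep : ∀ s b → + 0 ℤ.< potential s (initStep s b)
potential-initStep α true = ℤ.+<+ ℕ.z<s
potential-initStep α false = ℤ.+<+ ℕ.z<s
potential-initStep β true = ℤ.+<+ ℕ.z<s
potential-initStep β false = ℤ.+<+ ℕ.z<s

potential-finStep : ∀ s b → + 0 ℤ.< potential s (finStep b)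
potential-finStep α true = ℤ.+<+ ℕ.z<s
potential-finStep α false = ℤ.+<+ ℕ.z<s
potential-finStep β true = ℤ.+<+ ℕ.z<s
potential-finStep β false = ℤ.+<+ ℕ.z<s

-- Admissible paths and the completeness of their enumeration.

record Adm (i : ℕ) (p : Path) (e : Point) : Set where
  constructor mkAdm
  field
    turn-diag : diagSum (turnPt i p) ≡ + 0
    end-pt    : endOf finStep (turnPt i p) (fin p) ≡ e
open Adm public

-- No initial step lowers x + y, so the value 0 at the turning point bounds the whole segment. This
-- makes the tests in `admissibleᵇ` equivalent to the two equations of `Adm`.
initPts-≤0 : ∀ {i p e u} → Adm i p e → u ∈ initPts i p → diagSum u ℤ.≤ + 0
initPts-≤0 {i} {p} {u = u} ad u∈ = subst (diagSum u ℤ.≤_) (turn-diag ad)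
  (walk-≤-end diagSum-additive (diagSum-initStep (start p)) (startPt i (start p)) (init p) u∈)

∧-true⁻ : ∀ {a b} → a ∧ b ≡ true → a ≡ true × b ≡ true
∧-true⁻ {true} {true} _ = ≡.refl , ≡.refl

≤ᵇ-true : ∀ {a b} → a ℤ.≤ b → (a ℤ.≤ᵇ b) ≡ true
≤ᵇ-true {a} {b} h with a ℤ.≤ᵇ b | ℤP.≤⇒≤ᵇ h
... | true | _ = ≡.refl

admissible⁻ : ∀ {i p e} → admissibleᵇ i p e ≡ true → Adm i p e
admissible⁻ {i} {p} {e} h =
  let _ , h₂ = ∧-true⁻ {and (map (λ q → diagSum q ℤ.≤ᵇ + 0) (initPts i p))} h
      h₃ , h₄ = ∧-true⁻ {does (diagSum (turnPt i p) ℤ.≟ + 0)} h₂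
  in mkAdm (does-true⁻ (diagSum (turnPt i p) ℤ.≟ + 0) h₃) (==ᵖ⁻ (endOf finStep (turnPt i p) (fin p)) e h₄)

admissible⁺ : ∀ {i p e} → Adm i p e → admissibleᵇ i p e ≡ true
admissible⁺ {i} {p} {e} ad
  rewrite and-map⁺ {f = λ q → diagSum q ℤ.≤ᵇ + 0} {initPts i p} (λ u∈ → ≤ᵇ-true (initPts-≤0 ad u∈))
        | does-true⁺ (diagSum (turnPt i p) ℤ.≟ + 0) (turn-diag ad) | end-pt ad = ==ᵖ-refl e

fin-length : ∀ {i p e} → Adm i p e → diagSum e ≡ + length (fin p)
fin-length {i} {p} ad = ≡.trans (cong diagSum (≡.sym (end-pt ad)))
  (≡.trans (endOf-unit-steps diagSum-additive diagSum-finStep (turnPt i p) (fin p))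
    (≡.trans (cong (ℤ._+ + length (fin p)) (turn-diag ad)) (ℤP.+-identityˡ _)))

∣∣-bound : ∀ {m a} → + m ℤ.≤ a → m ℕ.≤ ℤ.∣ a ∣
∣∣-bound (ℤ.+≤+ h) = h

-- `climb` grows by exactly one with every initial step and never falls on final steps, so the total
-- climb from start to endpoint bounds the number of initial steps. For α it is the difference of
-- ordinates and for β that of abscissae, the two summands of the bound.
init-length : ∀ {i p e} → Adm i p e →
  length (init p) ℕ.≤ ℤ.∣ proj₂ e ℤ.- proj₂ (startPt i (start p)) ∣ ℕ.+ ℤ.∣ proj₁ e ℤ.- proj₁ (startPt i (start p)) ∣
init-length {i} {p} {e} ad = within (start p) climbs
  where
  climbs : + length (init p) ℤ.≤ climb (start p) e ℤ.- climb (start p) (startPt i (start p))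
  climbs = subst₂ ℤ._≤_
    (≡.trans (cong (ℤ._- climb (start p) (startPt i (start p)))
        (endOf-unit-steps (climb-additive (start p)) (climb-initStep (start p)) (startPt i (start p)) (init p)))
      (solve 2 (λ a b → (a :+ b) :- a := b) ≡.refl (climb (start p) (startPt i (start p))) (+ length (init p))))
    (cong (λ z → climb (start p) z ℤ.- climb (start p) (startPt i (start p))) (end-pt ad))
    (ℤP.+-monoˡ-≤ (ℤ.- climb (start p) (startPt i (start p)))
      (walk-≤ (climb-additive (start p)) (climb-finStep (start p)) (turnPt i p) (fin p) (last∈walk (turnPt i p) (fin p))))
    where open +-*-Solver
  within : ∀ s {m} → + m ℤ.≤ climb s e ℤ.- climb s (startPt i s) →
    m ℕ.≤ ℤ.∣ proj₂ e ℤ.- proj₂ (startPt i s) ∣ ℕ.+ ℤ.∣ proj₁ e ℤ.- proj₁ (startPt i s) ∣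
  within α h = ℕP.≤-trans (∣∣-bound h) (ℕP.m≤m+n _ _)
  within β h = ℕP.≤-trans (∣∣-bound h) (ℕP.m≤n+m _ _)

∈-listsOfLen : ∀ bs → bs ∈ listsOfLen (length bs)
∈-listsOfLen [] = here ≡.refl
∈-listsOfLen (true ∷ bs) = ∈-concatMap-∃⁺ _ (∈-listsOfLen bs) (here ≡.refl)
∈-listsOfLen (false ∷ bs) = ∈-concatMap-∃⁺ _ (∈-listsOfLen bs) (there (here ≡.refl))

listsOfLen-length : ∀ k {bs} → bs ∈ listsOfLen k → length bs ≡ k
listsOfLen-length zero (here ≡.refl) = ≡.refl
listsOfLen-length (suc k) bs∈ with ∈-concatMap-∃⁻ _ (listsOfLen k) bs∈
... | as , as∈ , here ≡.refl = cong suc (listsOfLen-length k as∈)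
... | as , as∈ , there (here ≡.refl) = cong suc (listsOfLen-length k as∈)

listsOfLen-unique : ∀ k → Unique (listsOfLen k)
listsOfLen-unique zero = [] ∷ []
listsOfLen-unique (suc k) = concatMap-unique (List.drop 1) (listsOfLen-unique k)
  (λ _ → ((λ ()) ∷ []) ∷ [] ∷ [])
  (λ { _ (here ≡.refl) → ≡.refl ; _ (there (here ≡.refl)) → ≡.refl })

∈-listsUpTo : ∀ {k} bs → length bs ℕ.≤ k → bs ∈ listsUpTo k
∈-listsUpTo bs h = ∈-concatMap-∃⁺ listsOfLen (∈-upTo⁺ (ℕ.s≤s h)) (∈-listsOfLen bs)

listsUpTo-unique : ∀ k → Unique (listsUpTo k)
listsUpTo-unique k = concatMap-unique length (Uniq.upTo⁺ (suc k)) (λ {j} _ → listsOfLen-unique j) (λ j → listsOfLen-length j)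

pathsWithInit : Start → Point → List Bool → List Path
pathsWithInit s e ini = map (mkPath s ini) (listsOfLen ℤ.∣ diagSum e ∣)

initBound : ℕ → Start → Point → ℕ
initBound i s e = ℤ.∣ proj₂ e ℤ.- proj₂ (startPt i s) ∣ ℕ.+ ℤ.∣ proj₁ e ℤ.- proj₁ (startPt i s) ∣

rawPaths : ℕ → Start → Point → List Path
rawPaths i s e = concatMap (pathsWithInit s e)
  (listsUpTo (initBound i s e))

∈-admPaths⁺ : ∀ {i p e} → Adm i p e → p ∈ admPaths i (start p) e
∈-admPaths⁺ {i} {p} {e} ad = ∈-filter⁺ (≡true? (λ p → admissibleᵇ i p e))
  (∈-concatMap-∃⁺ (pathsWithInit (start p) e) (∈-listsUpTo (init p) (init-length ad))
    (∈-map⁺ (mkPath (start p) (init p)) (subst (λ k → fin p ∈ listsOfLen k) (≡.sym (cong ℤ.∣_∣ (fin-length ad))) (∈-listsOfLen (fin p)))))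
  (admissible⁺ ad)

∈-admPaths⁻ : ∀ {i s p e} → p ∈ admPaths i s e → start p ≡ s × Adm i p e
∈-admPaths⁻ {i} {s} {p} {e} p∈ with ∈-filter⁻ (≡true? (λ p → admissibleᵇ i p e)) {xs = rawPaths i s e} p∈
... | p∈′ , a with ∈-concatMap-∃⁻ (pathsWithInit s e) (listsUpTo (initBound i s e)) p∈′
... | ini , _ , q with ∈-map⁻ (mkPath s ini) q
... | f , _ , ≡.refl = ≡.refl , admissible⁻ a

admPaths-unique : ∀ i s e → Unique (admPaths i s e)
admPaths-unique i s e = Uniq.filter⁺ (≡true? (λ p → admissibleᵇ i p e))
  (concatMap-unique {f = pathsWithInit s e} init (listsUpTo-unique (initBound i s e)) (λ _ → Uniq.map⁺ (cong fin) (listsOfLen-unique ℤ.∣ diagSum e ∣))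
    (λ ini q → case ∈-map⁻ (mkPath s ini) q of λ { (_ , _ , ≡.refl) → ≡.refl }))

aside-pos : ∀ {i p u} → u ∈ initPts (suc i) p → + 0 ℤ.< aside (start p) u
aside-pos {i} {p} u∈ = ℤP.<-≤-trans
  (subst (+ 0 ℤ.<_) (≡.sym (aside-startPt (suc i) (start p))) (ℤ.+<+ ℕ.z<s))
  (walk-≤ (aside-additive (start p)) (aside-initStep (start p)) (startPt (suc i) (start p)) (init p) u∈)

¬both-sides : ∀ u → + 0 ℤ.< aside α u → ¬ (+ 0 ℤ.< aside β u)
¬both-sides (x , y) a b = ℤP.<-irrefl ≡.refl (subst (+ 0 ℤ.<_) (solve 2 (λ x y → (y :- x) :+ (x :- y) := con (+ 0)) ≡.refl x y) (ℤP.+-mono-< a b))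
  where open +-*-Solver

-- Initial segments from α-points stay strictly above the main diagonal, those from β-points
-- strictly below it.
same-start : ∀ {i j p q u} → u ∈ initPts (suc i) p → u ∈ initPts (suc j) q → start p ≡ start q
same-start {p = p} {q} {u} u∈p u∈q with start p | start q | aside-pos {p = p} u∈p | aside-pos {p = q} u∈q
... | α | α | _ | _ = ≡.refl
... | β | β | _ | _ = ≡.refl
... | α | β | a | b = contradiction b (¬both-sides u a)
... | β | α | b | a = contradiction b (¬both-sides u a)

module _ (f : Bool → Point) where
  -- The cut is at the first visit of `v`. The head therefore does not meet `v` before its end,
  -- which is what makes a second cut after splicing fall at the same place.
  cutHead cutTail : Point → Point → List Bool → List Bool
  cutHead q v [] = []
  cutHead q v (b ∷ bs) = if does (q ≟ᵖ v) then [] else b ∷ cutHead (q ⊕ f b) v bs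
  cutTail q v [] = []
  cutTail q v (b ∷ bs) = if does (q ≟ᵖ v) then b ∷ bs else cutTail (q ⊕ f b) v bs

  cut-++ : ∀ q v bs → cutHead q v bs ++ cutTail q v bs ≡ bs
  cut-++ q v [] = ≡.refl
  cut-++ q v (b ∷ bs) with does (q ≟ᵖ v)
  ... | true = ≡.refl
  ... | false = cong (b ∷_) (cut-++ (q ⊕ f b) v bs)

  cut-end : ∀ {q v} bs → v ∈ walk f q bs → endOf f q (cutHead q v bs) ≡ v
  cut-end [] (here ≡.refl) = ≡.refl
  cut-end {q} {v} (b ∷ bs) v∈ with q ≟ᵖ v | v∈
  ... | yes e | _ = e
  ... | no ¬e | here e = contradiction (≡.sym e) ¬e
  ... | no ¬e | there v∈′ = cut-end bs v∈′

  cutHead-at : ∀ v bs → cutHead v v bs ≡ []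
  cutHead-at v [] = ≡.refl
  cutHead-at v (b ∷ bs) rewrite does-true⁺ (v ≟ᵖ v) ≡.refl = ≡.refl

  cutTail-at : ∀ v bs → cutTail v v bs ≡ bs
  cutTail-at v [] = ≡.refl
  cutTail-at v (b ∷ bs) rewrite does-true⁺ (v ≟ᵖ v) ≡.refl = ≡.refl

  cutHead-splice : ∀ {q v} bs → v ∈ walk f q bs → ∀ t → cutHead q v (cutHead q v bs ++ t) ≡ cutHead q v bs
  cutHead-splice [] (here ≡.refl) t = cutHead-at _ t
  cutHead-splice {q} {v} (b ∷ bs) v∈ t with q ≟ᵖ v in eq | v∈
  ... | yes ≡.refl | _ = cutHead-at q t
  ... | no ¬e | here e = contradiction (≡.sym e) ¬e
  ... | no ¬e | there v∈′ rewrite eq = cong (b ∷_) (cutHead-splice bs v∈′ t)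

  cutTail-splice : ∀ {q v} bs → v ∈ walk f q bs → ∀ t → cutTail q v (cutHead q v bs ++ t) ≡ t
  cutTail-splice [] (here ≡.refl) t = cutTail-at _ t
  cutTail-splice {q} {v} (b ∷ bs) v∈ t with q ≟ᵖ v in eq | v∈
  ... | yes ≡.refl | _ = cutTail-at q t
  ... | no ¬e | here e = contradiction (≡.sym e) ¬e
  ... | no ¬e | there v∈′ rewrite eq = cutTail-splice bs v∈′ t

-- Exchanging the tails of two paths

open import Data.List.Membership.DecPropositional _≟ᵖ_ using (_∈?_)

-- `full` chooses between whole paths and initial segments, so that one argument covers both notions
-- of disjointness.
pts : Bool → ℕ → Path → List Point
pts full i p = if full then allPts i p else initPts i p

initPts⊆pts : ∀ full {i p u} → u ∈ initPts i p → u ∈ pts full i p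
initPts⊆pts true u∈ = ∈-++⁺ˡ u∈
initPts⊆pts false u∈ = u∈

finPts⊆pts : ∀ {full} → full ≡ true → ∀ {i p u} → u ∈ finPts i p → u ∈ pts full i p
finPts⊆pts ≡.refl {i} {p} u∈ = ∈-++⁺ʳ (initPts i p) u∈

pts⁻ : ∀ full {i p u} → u ∈ pts full i p → u ∈ initPts i p ⊎ (full ≡ true × u ∈ finPts i p)
pts⁻ true {i} {p} u∈ with ∈-++⁻ (initPts i p) u∈
... | inj₁ q = inj₁ q
... | inj₂ q = inj₂ (≡.refl , q)
pts⁻ false u∈ = inj₁ u∈

low : Point → Bool
low v = does (diagSum v ℤ.≤? + 0)

-- A common vertex on x + y = 0 is low and is cut inside the initial segments, after which the whole
-- final segment changes hands. For a higher vertex the initial segments stay untouched.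
spliceAt : Bool → Point → ℕ → Path → ℕ → Path → Path
spliceAt true v i p i′ p′ = mkPath (start p)
  (cutHead (initStep (start p)) (startPt i (start p)) v (init p)
    ++ cutTail (initStep (start p′)) (startPt i′ (start p′)) v (init p′))
  (fin p′)
spliceAt false v i p i′ p′ = mkPath (start p) (init p)
  (cutHead finStep (turnPt i p) v (fin p) ++ cutTail finStep (turnPt i′ p′) v (fin p′))

splice : Point → ℕ → Path → ℕ → Path → Path
splice v = spliceAt (low v) v

-- The step `false` means different vectors for α and β, so tails of initial segments fit together
-- only for equal types; hence the first argument of `meetInit`, which `same-start` provides. Final
-- steps are the same for both types.
data Meet (full : Bool) (v : Point) (i : ℕ) (p : Path) (i′ : ℕ) (p′ : Path) : Bool → Set where
  meetInit : start p ≡ start p′ → v ∈ initPts i p → v ∈ initPts i′ p′ → Meet full v i p i′ p′ true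
  meetFin  : full ≡ true → v ∈ finPts i p → v ∈ finPts i′ p′ → Meet full v i p i′ p′ false

Meet-sym : ∀ {full v i p i′ p′ b} → Meet full v i p i′ p′ b → Meet full v i′ p′ i p b
Meet-sym (meetInit e x y) = meetInit (≡.sym e) y x
Meet-sym (meetFin e x y) = meetFin e y x

-- A final segment leaves the line x + y = 0 with its first step, so its only low vertex is the
-- turning point, which also ends the initial segment.
pts-low : ∀ {full i p e v} → Adm i p e → v ∈ pts full i p → diagSum v ℤ.≤ + 0 → v ∈ initPts i p
pts-low {full} {i} {p} ad v∈ v≤0 with pts⁻ full {i} {p} v∈
... | inj₁ q = q
... | inj₂ (_ , q) with walk-< diagSum-additive diagSum-finStep->0 (turnPt i p) (fin p) q
... | inj₁ ≡.refl = last∈walk (startPt i (start p)) (init p)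
... | inj₂ lt = contradiction (subst (ℤ._< _) (turn-diag ad) lt) (ℤP.≤⇒≯ v≤0)

pts-high : ∀ {full i p e v} → Adm i p e → v ∈ pts full i p → ¬ diagSum v ℤ.≤ + 0 → full ≡ true × v ∈ finPts i p
pts-high {full} {i} {p} ad v∈ v≰0 with pts⁻ full {i} {p} v∈
... | inj₁ q = contradiction (initPts-≤0 ad q) v≰0
... | inj₂ q = q

meet : ∀ {full v i p e i′ p′ e′} → Adm (suc i) p e → Adm (suc i′) p′ e′ →
  v ∈ pts full (suc i) p → v ∈ pts full (suc i′) p′ → Meet full v (suc i) p (suc i′) p′ (low v)
meet {full} {v} {p = p} {p′ = p′} ad ad′ v∈ v∈′ with diagSum v ℤ.≤? + 0
... | yes l = meetInit (same-start {p = p} {p′} (pts-low {full} ad v∈ l) (pts-low {full} ad′ v∈′ l)) (pts-low {full} ad v∈ l) (pts-low {full} ad′ v∈′ l)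
... | no ¬l = meetFin (proj₁ (pts-high {full} ad v∈ ¬l)) (proj₂ (pts-high {full} ad v∈ ¬l)) (proj₂ (pts-high {full} ad′ v∈′ ¬l))

cut-walk⁺ˡ : ∀ f {u} q v bs → u ∈ walk f q (cutHead f q v bs) → u ∈ walk f q bs
cut-walk⁺ˡ f q v bs u∈ = subst (λ l → _ ∈ walk f q l) (cut-++ f q v bs) (walk-++⁺ˡ q (cutHead f q v bs) u∈)

cut-walk⁺ʳ : ∀ f {u} q v bs → v ∈ walk f q bs → u ∈ walk f v (cutTail f q v bs) → u ∈ walk f q bs
cut-walk⁺ʳ f q v bs v∈ u∈ = subst (λ l → _ ∈ walk f q l) (cut-++ f q v bs)
  (walk-++⁺ʳ q (cutHead f q v bs) (subst (λ z → _ ∈ walk f z (cutTail f q v bs)) (≡.sym (cut-end f bs v∈)) u∈))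

endOf-cut : ∀ f {q v} bs → v ∈ walk f q bs → endOf f v (cutTail f q v bs) ≡ endOf f q bs
endOf-cut f {q} {v} bs v∈ = ≡.trans (cong (λ z → endOf f z (cutTail f q v bs)) (≡.sym (cut-end f bs v∈)))
  (≡.trans (≡.sym (endOf-++ q (cutHead f q v bs))) (cong (endOf f q) (cut-++ f q v bs)))

endOf-splice : ∀ f {q v q′} bs bs′ → v ∈ walk f q bs → v ∈ walk f q′ bs′ →
  endOf f q (cutHead f q v bs ++ cutTail f q′ v bs′) ≡ endOf f q′ bs′
endOf-splice f {q} {v} {q′} bs bs′ v∈ v∈′ = ≡.trans (endOf-++ q (cutHead f q v bs))
  (≡.trans (cong (λ z → endOf f z (cutTail f q′ v bs′)) (cut-end f bs v∈)) (endOf-cut f bs′ v∈′))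

walk-splice⁻ : ∀ f {u q v q′} bs bs′ → v ∈ walk f q bs →
  u ∈ walk f q (cutHead f q v bs ++ cutTail f q′ v bs′) → u ∈ walk f q (cutHead f q v bs) ⊎ u ∈ walk f v (cutTail f q′ v bs′)
walk-splice⁻ f {u} {q} {v} {q′} bs bs′ v∈ u∈ with walk-++⁻ q (cutHead f q v bs) u∈
... | inj₁ x = inj₁ x
... | inj₂ y = inj₂ (subst (λ z → _ ∈ walk f z (cutTail f q′ v bs′)) (cut-end f bs v∈) y)

-- `potential` strictly increases along a path of its type, so it records on which side of `v` a
-- vertex lies without reference to positions in the step list. Each bound uses the type of the path
-- from which the vertex comes.
BeforeOn AfterOn : Bool → Point → ℕ → Path → Point → Set
BeforeOn full v i p u = u ∈ pts full i p × (u ≡ v ⊎ potential (start p) u ℤ.< potential (start p) v)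
AfterOn full v i p u = u ∈ pts full i p × (u ≡ v ⊎ potential (start p) v ℤ.< potential (start p) u)

record Spliced (full : Bool) (v : Point) (i : ℕ) (p : Path) (i′ : ℕ) (p′ : Path) (e′ : Point) (q : Path) : Set where
  field
    same-type : start q ≡ start p
    adm       : Adm i q e′
    through   : v ∈ pts full i q
    origin    : ∀ {u} → u ∈ pts full i q → BeforeOn full v i p u ⊎ AfterOn full v i′ p′ u

spliced : ∀ {full v i p e i′ p′ e′ b} → Adm i p e → Adm i′ p′ e′ → Meet full v i p i′ p′ b →
  Spliced full v i p i′ p′ e′ (spliceAt b v i p i′ p′)
spliced {full} {v} {i} {mkPath s ini fn} {e} {i′} {mkPath .s ini′ fn′} {e′} ad ad′ (meetInit ≡.refl v∈ v∈′) = record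
  { same-type = ≡.refl
  ; adm = mkAdm (≡.trans (cong diagSum turn) (turn-diag ad′)) (≡.trans (cong (λ z → endOf finStep z fn′) turn) (end-pt ad′))
  ; through = initPts⊆pts full {i} {q} (walk-++⁺ˡ st h (subst (_∈ walk f st h) (cut-end f ini v∈) (last∈walk st h)))
  ; origin = orig }
  where
  f : Bool → Point
  f = initStep s
  st st′ : Point
  st = startPt i s
  st′ = startPt i′ s
  h t′ : List Bool
  h = cutHead f st v ini
  t′ = cutTail f st′ v ini′
  q : Path
  q = mkPath s (h ++ t′) fn′
  p p′ : Path
  p = mkPath s ini fn
  p′ = mkPath s ini′ fn′
  turn : turnPt i q ≡ turnPt i′ p′
  turn = endOf-splice f ini ini′ v∈ v∈′
  v≼turn : turnPt i′ p′ ≡ v ⊎ potential s v ℤ.< potential s (turnPt i′ p′)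
  v≼turn = walk-< (potential-additive s) (potential-initStep s) v t′ (subst (_∈ walk f v t′) (endOf-cut f ini′ v∈′) (last∈walk v t′))
  orig : ∀ {u} → u ∈ pts full i q → BeforeOn full v i p u ⊎ AfterOn full v i′ p′ u
  orig {u} u∈ with pts⁻ full {i} {q} u∈
  ... | inj₁ u∈i with walk-splice⁻ f ini ini′ v∈ u∈i
  ...   | inj₁ x = inj₁ (initPts⊆pts full {i} {p} (cut-walk⁺ˡ f st v ini x) ,
            subst (λ z → u ≡ z ⊎ potential s u ℤ.< potential s z) (cut-end f ini v∈) (walk-<-end (potential-additive s) (potential-initStep s) st h x))
  ...   | inj₂ x = inj₂ (initPts⊆pts full {i′} {p′} (cut-walk⁺ʳ f st′ v ini′ v∈′ x) , walk-< (potential-additive s) (potential-initStep s) v t′ x)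
  orig {u} u∈ | inj₂ (full≡ , u∈f) = inj₂ (finPts⊆pts full≡ {i′} {p′} u∈f′ , v≼u)
    where
    u∈f′ : u ∈ finPts i′ p′
    u∈f′ = subst (λ z → u ∈ walk finStep z fn′) turn u∈f
    v≼u : u ≡ v ⊎ potential s v ℤ.< potential s u
    v≼u with walk-< (potential-additive s) (potential-finStep s) (turnPt i′ p′) fn′ u∈f′ | v≼turn
    ... | inj₁ x | inj₁ y = inj₁ (≡.trans x y)
    ... | inj₁ x | inj₂ y = inj₂ (subst (λ z → _ ℤ.< potential s z) (≡.sym x) y)
    ... | inj₂ x | inj₁ y = inj₂ (subst (λ z → potential s z ℤ.< _) y x)
    ... | inj₂ x | inj₂ y = inj₂ (ℤP.<-trans y x)
spliced {full} {v} {i} {p} {e} {i′} {p′} {e′} ad ad′ (meetFin full≡ v∈ v∈′) = record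
  { same-type = ≡.refl
  ; adm = mkAdm (turn-diag ad) (≡.trans (endOf-splice finStep (fin p) (fin p′) v∈ v∈′) (end-pt ad′))
  ; through = finPts⊆pts full≡ {i} {q} (walk-++⁺ˡ T h (subst (_∈ walk finStep T h) (cut-end finStep (fin p) v∈) (last∈walk T h)))
  ; origin = orig }
  where
  s s′ : Start
  s = start p
  s′ = start p′
  T T′ : Point
  T = turnPt i p
  T′ = turnPt i′ p′
  h t′ : List Bool
  h = cutHead finStep T v (fin p)
  t′ = cutTail finStep T′ v (fin p′)
  q : Path
  q = mkPath s (init p) (h ++ t′)
  orig : ∀ {u} → u ∈ pts full i q → BeforeOn full v i p u ⊎ AfterOn full v i′ p′ u
  orig {u} u∈ with pts⁻ full {i} {q} u∈
  ... | inj₁ u∈i = inj₁ (initPts⊆pts full {i} {p} u∈i , u≼v)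
    where
    u≼v : u ≡ v ⊎ potential s u ℤ.< potential s v
    u≼v with walk-<-end (potential-additive s) (potential-initStep s) (startPt i s) (init p) u∈i
           | walk-< (potential-additive s) (potential-finStep s) T (fin p) v∈
    ... | inj₁ x | inj₁ y = inj₁ (≡.trans x (≡.sym y))
    ... | inj₁ x | inj₂ y = inj₂ (subst (λ z → potential s z ℤ.< _) (≡.sym x) y)
    ... | inj₂ x | inj₁ y = inj₂ (subst (λ z → _ ℤ.< potential s z) (≡.sym y) x)
    ... | inj₂ x | inj₂ y = inj₂ (ℤP.<-trans x y)
  ... | inj₂ (_ , u∈f) with walk-splice⁻ finStep (fin p) (fin p′) v∈ u∈f
  ...   | inj₁ x = inj₁ (finPts⊆pts full≡ {i} {p} (cut-walk⁺ˡ finStep T v (fin p) x) ,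
            subst (λ z → u ≡ z ⊎ potential s u ℤ.< potential s z) (cut-end finStep (fin p) v∈) (walk-<-end (potential-additive s) (potential-finStep s) T h x))
  ...   | inj₂ x = inj₂ (finPts⊆pts full≡ {i′} {p′} (cut-walk⁺ʳ finStep T′ v (fin p′) v∈′ x) , walk-< (potential-additive s′) (potential-finStep s′) v t′ x)

spliceAt-involutive : ∀ {full v i p i′ p′ b} → Meet full v i p i′ p′ b →
  spliceAt b v i (spliceAt b v i p i′ p′) i′ (spliceAt b v i′ p′ i p) ≡ p
spliceAt-involutive {v = v} {i} {mkPath s ini fn} {i′} {mkPath .s ini′ fn′} (meetInit ≡.refl v∈ v∈′) =
  cong (λ l → mkPath s l fn) (≡.trans
    (cong₂ _++_ (cutHead-splice (initStep s) ini v∈ _) (cutTail-splice (initStep s) ini′ v∈′ _))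
    (cut-++ (initStep s) (startPt i s) v ini))
spliceAt-involutive {v = v} {i} {p} {i′} {p′} (meetFin _ v∈ v∈′) =
  cong (mkPath (start p) (init p)) (≡.trans
    (cong₂ _++_ (cutHead-splice finStep (fin p) v∈ _) (cutTail-splice finStep (fin p′) v∈′ _))
    (cut-++ finStep (turnPt i p) v (fin p)))

findPair : {A : Set} → (A → Bool) → List (A × A) → Maybe (A × A)
findPair t [] = nothing
findPair t (p ∷ ps) = if t (proj₁ p) ∧ t (proj₂ p) then just p else findPair t ps

findPair-cong : {A : Set} {t t′ : A → Bool} → (∀ a → t a ≡ t′ a) → ∀ ps → findPair t ps ≡ findPair t′ ps
findPair-cong h [] = ≡.refl
findPair-cong h (p ∷ ps) rewrite h (proj₁ p) | h (proj₂ p) | findPair-cong h ps = ≡.refl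

findPair-just : {A : Set} (t : A → Bool) (ps : List (A × A)) {p : A × A} → findPair t ps ≡ just p →
  p ∈ ps × t (proj₁ p) ≡ true × t (proj₂ p) ≡ true
findPair-just t (p ∷ ps) eq with t (proj₁ p) in e₁ | t (proj₂ p) in e₂
findPair-just t (p ∷ ps) ≡.refl | true | true = here ≡.refl , e₁ , e₂
... | true | false = let m , r = findPair-just t ps eq in there m , r
... | false | _ = let m , r = findPair-just t ps eq in there m , r

findPair-complete : {A : Set} (t : A → Bool) (ps : List (A × A)) {p : A × A} → p ∈ ps →
  t (proj₁ p) ≡ true → t (proj₂ p) ≡ true → is-just (findPair t ps) ≡ true
findPair-complete t (p ∷ ps) (here ≡.refl) e₁ e₂ rewrite e₁ | e₂ = ≡.refl
findPair-complete t (q ∷ ps) (there p∈) e₁ e₂ with t (proj₁ q) ∧ t (proj₂ q)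
... | true = ≡.refl
... | false = findPair-complete t ps p∈ e₁ e₂

-- Families, their membership criterion and the exchange at a common vertex.

record InFam {n : ℕ} (E : Fin n → List Point) (F : Family n) : Set where
  field
    perm   : Inj (σ F)
    end∈   : ∀ i → lookup (ends F) i ∈ E (lookup (σ F) i)
    starts≡ : ∀ i → start (lookup (paths F) i) ≡ lookup (starts F) i
    adms   : ∀ i → Adm (suc (toℕ i)) (lookup (paths F) i) (lookup (ends F) i)
open InFam public

module _ {n : ℕ} (E : Fin n → List Point) where
  private
    withEnds : Vec (Fin n) n → Vec Start n → Vec Point n → List (Family n)
    withEnds σ ss es = map (mkFam σ ss es) (allVecs (λ i → admPaths (suc (toℕ i)) (lookup ss i) (lookup es i)))
    withStarts : Vec (Fin n) n → Vec Start n → List (Family n)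
    withStarts σ ss = concatMap (withEnds σ ss) (allVecs (λ i → E (lookup σ i)))
    allStarts : List (Vec Start n)
    allStarts = allVecs (λ _ → α ∷ β ∷ [])
    withPerm : Vec (Fin n) n → List (Family n)
    withPerm σ = concatMap (withStarts σ) allStarts

    ∈-withEnds⁻ : ∀ {F} σ′ ss es → F ∈ withEnds σ′ ss es → σ F ≡ σ′ × starts F ≡ ss × ends F ≡ es ×
      (∀ i → lookup (paths F) i ∈ admPaths (suc (toℕ i)) (lookup ss i) (lookup es i))
    ∈-withEnds⁻ σ′ ss es F∈ with ∈-map⁻ (mkFam σ′ ss es) F∈
    ... | ps , ps∈ , ≡.refl = ≡.refl , ≡.refl , ≡.refl , ∈-allVecs⁻ ps∈

    ∈-withStarts⁻ : ∀ {F} σ′ ss → F ∈ withStarts σ′ ss → σ F ≡ σ′ × starts F ≡ ss ×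
      (∀ i → lookup (ends F) i ∈ E (lookup σ′ i)) ×
      (∀ i → lookup (paths F) i ∈ admPaths (suc (toℕ i)) (lookup ss i) (lookup (ends F) i))
    ∈-withStarts⁻ σ′ ss F∈ with ∈-concatMap-∃⁻ (withEnds σ′ ss) (allVecs (λ i → E (lookup σ′ i))) F∈
    ... | es , es∈ , q with ∈-withEnds⁻ σ′ ss es q
    ... | ≡.refl , ≡.refl , ≡.refl , r = ≡.refl , ≡.refl , ∈-allVecs⁻ es∈ , r

    ∈-withPerm⁻ : ∀ {F} σ′ → F ∈ withPerm σ′ → σ F ≡ σ′ ×
      (∀ i → lookup (ends F) i ∈ E (lookup σ′ i)) ×
      (∀ i → lookup (paths F) i ∈ admPaths (suc (toℕ i)) (lookup (starts F) i) (lookup (ends F) i))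
    ∈-withPerm⁻ σ′ F∈ with ∈-concatMap-∃⁻ (withStarts σ′) allStarts F∈
    ... | ss , _ , q with ∈-withStarts⁻ σ′ ss q
    ... | ≡.refl , ≡.refl , r = ≡.refl , r

  ∈-families⁻ : ∀ {F} → F ∈ families n E → InFam E F
  ∈-families⁻ {F} F∈ with ∈-concatMap-∃⁻ withPerm (perms n) F∈
  ... | σ′ , σ∈ , q with ∈-withPerm⁻ σ′ q
  ... | ≡.refl , en , pa = record { perm = ∈-perms⁻ σ∈ ; end∈ = en ; starts≡ = λ i → proj₁ (∈-admPaths⁻ {suc (toℕ i)} {e = lookup (ends F) i} (pa i)) ; adms = λ i → proj₂ (∈-admPaths⁻ {suc (toℕ i)} {e = lookup (ends F) i} (pa i)) }

  ∈-families⁺ : ∀ {F} → InFam E F → F ∈ families n E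
  ∈-families⁺ {mkFam σ′ ss es ps} I = ∈-concatMap-∃⁺ withPerm (∈-perms⁺ {v = σ′} (perm I))
    (∈-concatMap-∃⁺ (withStarts σ′) {allStarts} (∈-allVecs⁺ (λ i → either (lookup ss i)))
      (∈-concatMap-∃⁺ (withEnds σ′ ss) (∈-allVecs⁺ (end∈ I))
        (∈-map⁺ (mkFam σ′ ss es) (∈-allVecs⁺ (λ i → subst (λ s → lookup ps i ∈ admPaths (suc (toℕ i)) s (lookup es i)) (starts≡ I i) (∈-admPaths⁺ (adms I i)))))))
    where
    either : ∀ s → s ∈ α ∷ β ∷ []
    either α = here ≡.refl
    either β = there (here ≡.refl)

  -- The involution argument needs a list without repetitions. `σ`, `starts` and `ends` recover from
  -- a family the block in which it was generated.
  families-unique : (∀ j → Unique (E j)) → Unique (families n E)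
  families-unique uE = concatMap-unique {f = withPerm} σ (perms-unique n)
    (λ {σ′} _ → concatMap-unique {f = withStarts σ′} starts (allVecs-unique (λ _ → ((λ ()) ∷ []) ∷ [] ∷ []))
      (λ {ss} _ → concatMap-unique {f = withEnds σ′ ss} ends (allVecs-unique (λ i → uE (lookup σ′ i)))
        (λ {es} _ → Uniq.map⁺ (cong paths) (allVecs-unique (λ i → admPaths-unique (suc (toℕ i)) (lookup ss i) (lookup es i))))
        (λ es q → proj₁ (proj₂ (proj₂ (∈-withEnds⁻ σ′ ss es q)))))
      (λ ss q → proj₁ (proj₂ (∈-withStarts⁻ σ′ ss q))))
    (λ σ′ q → proj₁ (∈-withPerm⁻ σ′ q))

ptsOf : ∀ {n} → Bool → Family n → Fin n → List Point
ptsOf full F i = pts full (suc (toℕ i)) (lookup (paths F) i)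

on : ∀ {n} → Bool → Point → Family n → Fin n → Bool
on full v F i = does (v ∈? ptsOf full F i)

sharedPair : ∀ {n} → Bool → Point → Family n → Maybe (Fin n × Fin n)
sharedPair {n} full v F = findPair (on full v F) (ordPairs n)

shared : ∀ {n} → Bool → Point → Family n → Bool
shared full v F = is-just (sharedPair full v F)

-- Endpoint and endpoint index travel with the tail, the starting type stays with the head. So `σ`
-- changes by a transposition while the number of β-starts is kept.
exchange : ∀ {n} → Point → Fin n → Fin n → Family n → Family n
exchange v a b F = mkFam (swap a b (σ F)) (starts F) (swap a b (ends F))
  (update₂ a b (splice v (suc (toℕ a)) (lookup (paths F) a) (suc (toℕ b)) (lookup (paths F) b))
               (splice v (suc (toℕ b)) (lookup (paths F) b) (suc (toℕ a)) (lookup (paths F) a)) (paths F))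

shared⁺ : ∀ {n full v} {F : Family n} {i j} → i ≢ j → v ∈ ptsOf full F i → v ∈ ptsOf full F j → shared full v F ≡ true
shared⁺ {n} {full} {v} {F} {i} {j} i≢j v∈i v∈j with ℕP.<-cmp (toℕ i) (toℕ j)
... | tri< i<j _ _ = findPair-complete (on full v F) (ordPairs n) (∈-ordPairs⁺ i<j) (does-true⁺ (v ∈? _) v∈i) (does-true⁺ (v ∈? _) v∈j)

... | tri≈ _ e _ = contradiction (FinP.toℕ-injective e) i≢j
... | tri> _ _ j<i = findPair-complete (on full v F) (ordPairs n) (∈-ordPairs⁺ j<i) (does-true⁺ (v ∈? _) v∈j) (does-true⁺ (v ∈? _) v∈i)

shared⁻ : ∀ {n full v} {F : Family n} → shared full v F ≡ true →
  ∃₂ λ a b → sharedPair full v F ≡ just (a , b) × toℕ a ℕ.< toℕ b × v ∈ ptsOf full F a × v ∈ ptsOf full F b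
shared⁻ {n} {full} {v} {F} h with sharedPair full v F in eq
... | just (a , b) with findPair-just (on full v F) (ordPairs n) eq
... | m , e₁ , e₂ = a , b , ≡.refl , ∈-ordPairs⁻ m , does-true⁻ (v ∈? _) e₁ , does-true⁻ (v ∈? _) e₂

module Exchange {n : ℕ} {E : Fin n → List Point} {full : Bool} {v : Point} {F : Family n} (I : InFam E F)
  {a b : Fin n} (a<b : toℕ a ℕ.< toℕ b) (v∈a : v ∈ ptsOf full F a) (v∈b : v ∈ ptsOf full F b) where

  a≢b : a ≢ b
  a≢b e = ℕP.<-irrefl (cong toℕ e) a<b

  F′ : Family n
  F′ = exchange v a b F

  pa pb qa qb : Path
  pa = lookup (paths F) a
  pb = lookup (paths F) b
  qa = splice v (suc (toℕ a)) pa (suc (toℕ b)) pb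
  qb = splice v (suc (toℕ b)) pb (suc (toℕ a)) pa

  path-a : lookup (paths F′) a ≡ qa
  path-a = lookup-update₂ˡ a≢b (paths F)

  path-b : lookup (paths F′) b ≡ qb
  path-b = lookup-update₂ʳ a≢b (paths F)

  path-other : ∀ {i} → i ≢ a → i ≢ b → lookup (paths F′) i ≡ lookup (paths F) i
  path-other = lookup-update₂-other a≢b (paths F)

  meet-ab : Meet full v (suc (toℕ a)) pa (suc (toℕ b)) pb (low v)
  meet-ab = meet (adms I a) (adms I b) v∈a v∈b

  Sa : Spliced full v (suc (toℕ a)) pa (suc (toℕ b)) pb (lookup (ends F) b) qa
  Sa = spliced (adms I a) (adms I b) meet-ab

  Sb : Spliced full v (suc (toℕ b)) pb (suc (toℕ a)) pa (lookup (ends F) a) qb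
  Sb = spliced (adms I b) (adms I a) (Meet-sym meet-ab)

  exchange-InFam : InFam E F′
  exchange-InFam = record
    { perm = swap-injective a≢b {σ F} (perm I)
    ; end∈ = en
    ; starts≡ = st
    ; adms = ad }
    where
    en : ∀ i → lookup (ends F′) i ∈ E (lookup (σ F′) i)
    en i with position a b i
    ... | at-a rewrite lookup-update₂ˡ a≢b {lookup (ends F) b} {lookup (ends F) a} (ends F)
                     | lookup-update₂ˡ a≢b {lookup (σ F) b} {lookup (σ F) a} (σ F) = end∈ I b
    ... | at-b rewrite lookup-update₂ʳ a≢b {lookup (ends F) b} {lookup (ends F) a} (ends F)
                     | lookup-update₂ʳ a≢b {lookup (σ F) b} {lookup (σ F) a} (σ F) = end∈ I a
    ... | other p q rewrite lookup-update₂-other a≢b {lookup (ends F) b} {lookup (ends F) a} (ends F) p q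
                     | lookup-update₂-other a≢b {lookup (σ F) b} {lookup (σ F) a} (σ F) p q = end∈ I i
    st : ∀ i → start (lookup (paths F′) i) ≡ lookup (starts F) i
    st i with position a b i
    ... | at-a = ≡.trans (cong start path-a) (≡.trans (Spliced.same-type Sa) (starts≡ I a))
    ... | at-b = ≡.trans (cong start path-b) (≡.trans (Spliced.same-type Sb) (starts≡ I b))
    ... | other p q = ≡.trans (cong start (path-other p q)) (starts≡ I i)
    ad : ∀ i → Adm (suc (toℕ i)) (lookup (paths F′) i) (lookup (ends F′) i)
    ad i with position a b i
    ... | at-a = subst₂ (Adm (suc (toℕ a))) (≡.sym path-a) (≡.sym (lookup-update₂ˡ a≢b (ends F))) (Spliced.adm Sa)
    ... | at-b = subst₂ (Adm (suc (toℕ b))) (≡.sym path-b) (≡.sym (lookup-update₂ʳ a≢b (ends F))) (Spliced.adm Sb)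
    ... | other p q = subst₂ (Adm (suc (toℕ i))) (≡.sym (path-other p q)) (≡.sym (lookup-update₂-other a≢b (ends F) p q)) (adms I i)

  v∈a′ : v ∈ ptsOf full F′ a
  v∈a′ = subst (λ p → v ∈ pts full (suc (toℕ a)) p) (≡.sym path-a) (Spliced.through Sa)

  v∈b′ : v ∈ ptsOf full F′ b
  v∈b′ = subst (λ p → v ∈ pts full (suc (toℕ b)) p) (≡.sym path-b) (Spliced.through Sb)

  on-exchange : ∀ i → on full v F′ i ≡ on full v F i
  on-exchange i with position a b i
  ... | at-a = ≡.trans (does-true⁺ (v ∈? _) v∈a′) (≡.sym (does-true⁺ (v ∈? _) v∈a))
  ... | at-b = ≡.trans (does-true⁺ (v ∈? _) v∈b′) (≡.sym (does-true⁺ (v ∈? _) v∈b))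
  ... | other p q = cong (λ p → does (v ∈? pts full (suc (toℕ i)) p)) (path-other p q)

  -- The pair is found from the predicate `on full v` alone, and the exchange keeps that predicate
  -- at every index; a second exchange thus acts on the same pair.
  sharedPair-exchange : sharedPair full v F′ ≡ sharedPair full v F
  sharedPair-exchange = findPair-cong on-exchange (ordPairs n)

  exchange-involutive : exchange v a b F′ ≡ F
  exchange-involutive = cong-mkFam (swap-involutive a≢b (σ F)) (swap-involutive a≢b (ends F))
    (update₂-update₂ a≢b (paths F)
      (≡.trans (cong₂ (λ x y → splice v (suc (toℕ a)) x (suc (toℕ b)) y) path-a path-b) (spliceAt-involutive meet-ab))
      (≡.trans (cong₂ (λ x y → splice v (suc (toℕ b)) y (suc (toℕ a)) x) path-a path-b) (spliceAt-involutive (Meet-sym meet-ab))))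
    where
    cong-mkFam : ∀ {s s′ : Vec (Fin n) n} {es es′ : Vec Point n} {ps ps′ : Vec Path n} {ss} →
      s ≡ s′ → es ≡ es′ → ps ≡ ps′ → mkFam s ss es ps ≡ mkFam s′ ss es′ ps′
    cong-mkFam ≡.refl ≡.refl ≡.refl = ≡.refl

  exchange-≢ : F′ ≢ F
  exchange-≢ e = a≢b (≡.sym (perm I (≡.trans (≡.sym (lookup-update₂ˡ a≢b (σ F))) (cong (λ G → lookup (σ G) a) e))))

  -- Allows vertices to be removed one after another. If u lies on both new paths, then either its
  -- two origins are different old paths, which then share u, or it lies before and after v on one
  -- old path and so equals v.
  shared-exchange : ∀ u → shared full u F′ ≡ true → shared full u F ≡ true
  shared-exchange u h with shared⁻ {full = full} {u} {F′} h
  ... | i , j , _ , i<j , u∈i , u∈j = go (position a b i) (position a b j)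
    where
    i≢j : i ≢ j
    i≢j e = ℕP.<-irrefl (cong toℕ e) i<j
    from : ∀ {k} → u ∈ ptsOf full F′ k → k ≡ a ⊎ k ≡ b → u ∈ ptsOf full F a ⊎ u ∈ ptsOf full F b
    from u∈ (inj₁ ≡.refl) with Spliced.origin Sa (subst (λ p → u ∈ pts full (suc (toℕ a)) p) path-a u∈)
    ... | inj₁ (x , _) = inj₁ x
    ... | inj₂ (x , _) = inj₂ x
    from u∈ (inj₂ ≡.refl) with Spliced.origin Sb (subst (λ p → u ∈ pts full (suc (toℕ b)) p) path-b u∈)
    ... | inj₁ (x , _) = inj₂ x
    ... | inj₂ (x , _) = inj₁ x
    one-other : ∀ {k m} → k ≡ a ⊎ k ≡ b → m ≢ a → m ≢ b → u ∈ ptsOf full F′ k → u ∈ ptsOf full F′ m → shared full u F ≡ true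
    one-other {k} {m} k∈ m≢a m≢b u∈k u∈m with from u∈k k∈ | subst (λ p → u ∈ pts full (suc (toℕ m)) p) (path-other m≢a m≢b) u∈m
    ... | inj₁ x | y = shared⁺ {full = full} {F = F} (m≢a ∘ ≡.sym) x y
    ... | inj₂ x | y = shared⁺ {full = full} {F = F} (m≢b ∘ ≡.sym) x y
    ≼-antisym : ∀ s → u ≡ v ⊎ potential s u ℤ.< potential s v → u ≡ v ⊎ potential s v ℤ.< potential s u → u ≡ v
    ≼-antisym s (inj₁ e) _ = e
    ≼-antisym s _ (inj₁ e) = e
    ≼-antisym s (inj₂ x) (inj₂ y) = contradiction x (ℤP.<-asym y)
    both : u ∈ ptsOf full F′ a → u ∈ ptsOf full F′ b → shared full u F ≡ true
    both x y with Spliced.origin Sa (subst (λ p → u ∈ pts full (suc (toℕ a)) p) path-a x) | Spliced.origin Sb (subst (λ p → u ∈ pts full (suc (toℕ b)) p) path-b y)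
    ... | inj₁ (u∈ , _) | inj₁ (u∈′ , _) = shared⁺ {full = full} {F = F} a≢b u∈ u∈′
    ... | inj₂ (u∈ , _) | inj₂ (u∈′ , _) = shared⁺ {full = full} {F = F} a≢b u∈′ u∈
    ... | inj₁ (_ , p) | inj₂ (_ , q) rewrite ≼-antisym (start pa) p q = shared⁺ {full = full} {F = F} a≢b v∈a v∈b
    ... | inj₂ (_ , p) | inj₁ (_ , q) rewrite ≼-antisym (start pb) q p = shared⁺ {full = full} {F = F} a≢b v∈a v∈b
    go : Position a b i → Position a b j → shared full u F ≡ true
    go at-a at-a = contradiction ≡.refl i≢j
    go at-b at-b = contradiction ≡.refl i≢j
    go at-a at-b = both u∈i u∈j
    go at-b at-a = both u∈j u∈i
    go at-a (other p q) = one-other (inj₁ ≡.refl) p q u∈i u∈j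
    go at-b (other p q) = one-other (inj₂ ≡.refl) p q u∈i u∈j
    go (other p q) at-a = one-other (inj₁ ≡.refl) p q u∈j u∈i
    go (other p q) at-b = one-other (inj₂ ≡.refl) p q u∈j u∈i
    go (other p q) (other p′ q′) = shared⁺ {full = full} {F = F} i≢j (subst (λ z → u ∈ pts full (suc (toℕ i)) z) (path-other p q) u∈i) (subst (λ z → u ∈ pts full (suc (toℕ j)) z) (path-other p′ q′) u∈j)

-- Cancellation of intersecting families

or-false⁺ : {bs : List Bool} → (∀ {b} → b ∈ bs → b ≡ false) → or bs ≡ false
or-false⁺ {[]} h = ≡.refl
or-false⁺ {b ∷ bs} h rewrite h (here ≡.refl) = or-false⁺ (h ∘ there)

or-false⁻ : {bs : List Bool} → or bs ≡ false → ∀ {b} → b ∈ bs → b ≡ false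
or-false⁻ {false ∷ bs} h (here ≡.refl) = ≡.refl
or-false⁻ {false ∷ bs} h (there b∈) = or-false⁻ h b∈

≡true-or-false : ∀ b → b ≡ true ⊎ b ≡ false
≡true-or-false true = inj₁ ≡.refl
≡true-or-false false = inj₂ ≡.refl

not-true⁻ : ∀ {b} → not b ≡ true → b ≡ false
not-true⁻ {false} _ = ≡.refl

disjointᵇ⁺ : ∀ {xs ys} → (∀ {u} → u ∈ xs → ¬ u ∈ ys) → disjointᵇ xs ys ≡ true
disjointᵇ⁺ {xs} {ys} h = cong not (or-false⁺ all-false)
  where
  all-false : ∀ {b} → b ∈ concatMap (λ x → map (x ==ᵖ_) ys) xs → b ≡ false
  all-false {b} b∈ with ∈-concatMap-∃⁻ (λ x → map (x ==ᵖ_) ys) xs b∈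
  ... | x , x∈ , q with ∈-map⁻ (x ==ᵖ_) q
  ... | y , y∈ , ≡.refl with ≡true-or-false (x ==ᵖ y)
  ... | inj₂ e = e
  ... | inj₁ e = contradiction (subst (_∈ ys) (≡.sym (==ᵖ⁻ x y e)) y∈) (h x∈)

disjointᵇ⁻ : ∀ {xs ys} → disjointᵇ xs ys ≡ true → ∀ {u} → u ∈ xs → ¬ u ∈ ys
disjointᵇ⁻ {xs} {ys} h {u} u∈xs u∈ys =
  case ≡.trans (≡.sym (==ᵖ-refl u)) (or-false⁻ (not-true⁻ h) (∈-concatMap-∃⁺ (λ x → map (x ==ᵖ_) ys) u∈xs (∈-map⁺ (u ==ᵖ_) u∈ys))) of λ ()

disjointness : Bool → Restriction
disjointness true = disjointPaths
disjointness false = disjointInitial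

restrict-as-disjoint : ∀ full {n} (F : Family n) → restrictᵇ (disjointness full) F ≡
  and (map (λ p → disjointᵇ (ptsOf full F (proj₁ p)) (ptsOf full F (proj₂ p))) (ordPairs n))
restrict-as-disjoint true F = ≡.refl
restrict-as-disjoint false F = ≡.refl

restrict⁻ : ∀ full {n} {F : Family n} → restrictᵇ (disjointness full) F ≡ true →
  ∀ {i j} → toℕ i ℕ.< toℕ j → ∀ {u} → u ∈ ptsOf full F i → ¬ u ∈ ptsOf full F j
restrict⁻ full {n} {F} h i<j = disjointᵇ⁻ (and-map⁻ {xs = ordPairs n} (≡.trans (≡.sym (restrict-as-disjoint full F)) h) (∈-ordPairs⁺ i<j))

unshared : ∀ {n} → Bool → List Point → Family n → Bool
unshared full V F = and (map (λ v → not (shared full v F)) V)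

-- Turns disjointness into a conjunction over a finite list of vertices, the form in which bad
-- vertices can be eliminated one by one.
restrict-unshared : ∀ full {n} (F : Family n) (V : List Point) → (∀ i {u} → u ∈ ptsOf full F i → u ∈ V) →
  restrictᵇ (disjointness full) F ≡ unshared full V F
restrict-unshared full {n} F V covers with ≡true-or-false (restrictᵇ (disjointness full) F) | ≡true-or-false (unshared full V F)
... | inj₁ e | inj₁ e′ = ≡.trans e (≡.sym e′)
... | inj₂ e | inj₂ e′ = ≡.trans e (≡.sym e′)
... | inj₁ e | inj₂ e′ = ≡.trans e (≡.sym (and-map⁺ {xs = V} none))
  where
  none : ∀ {v} → v ∈ V → not (shared full v F) ≡ true
  none {v} _ with ≡true-or-false (shared full v F)
  ... | inj₂ f = cong not f
  ... | inj₁ t with shared⁻ {full = full} {v} {F} t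
  ... | a , b , _ , a<b , v∈a , v∈b = contradiction v∈b (restrict⁻ full {F = F} e a<b v∈a)
... | inj₂ e | inj₁ e′ = ≡.trans (≡.trans (restrict-as-disjoint full F) (and-map⁺ {xs = ordPairs n} λ {p} p∈ → disjointᵇ⁺ (λ {u} u∈ u∈′ →
    case ≡.trans (≡.sym (and-map⁻ {xs = V} e′ (covers (proj₁ p) u∈))) (cong not (shared⁺ {full = full} {u} {F} (λ q → ℕP.<-irrefl (cong toℕ q) (∈-ordPairs⁻ p∈)) u∈ u∈′)) of λ ()))) (≡.sym e′)

module LGV {c ℓ : Level} (R : CommutativeRing c ℓ) where
  open RingPart R
  open SumsAndDeterminants R
  open import Relation.Binary.Reasoning.Setoid setoid

  -- One vertex v is treated at a time: φ v cancels the elements that are bad at v among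
  -- those that are good at all vertices treated before.
  ΣL-eliminate : {A V : Set} {L : List A} {f : A → Carrier} (bad : V → A → Bool) (φ : V → A → A) → Unique L →
    (∀ {v a} → a ∈ L → bad v a ≡ true → φ v a ∈ L × bad v (φ v a) ≡ true × φ v (φ v a) ≡ a × φ v a ≢ a × f (φ v a) ≈ - f a) →
    (∀ {v a} u → a ∈ L → bad v a ≡ true → bad u (φ v a) ≡ true → bad u a ≡ true) →
    ∀ vs → ΣL (filter (≡true? (λ a → and (map (λ v → not (bad v a)) vs))) L) f ≈ ΣL L f
  ΣL-eliminate {L = L} {f} bad φ uL inv keep [] = ΣL-filter (≡true? (λ _ → true)) L f
  ΣL-eliminate {A} {V} {L} {f} bad φ uL inv keep (v ∷ vs) = begin
    ΣL (filter (≡true? (λ a → not (bad v a) ∧ ok a)) L) f ≈⟨ sym (+-identityʳ _) ⟩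
    ΣL (filter (≡true? (λ a → not (bad v a) ∧ ok a)) L) f + 0# ≈⟨ +-congˡ (sym cancel) ⟩
    ΣL (filter (≡true? (λ a → not (bad v a) ∧ ok a)) L) f + ΣL (filter (≡true? (λ a → bad v a ∧ ok a)) L) f
      ≈⟨ +-cong (ΣL-filter _ L f) (ΣL-filter _ L f) ⟩
    ΣL L (λ a → if does (≡true? (λ a → not (bad v a) ∧ ok a) a) then f a else 0#) + ΣL L (λ a → if does (≡true? (λ a → bad v a ∧ ok a) a) then f a else 0#)
      ≈⟨ sym (ΣL-+ L _ _) ⟩
    ΣL L (λ a → (if does (≡true? (λ a → not (bad v a) ∧ ok a) a) then f a else 0#) + (if does (≡true? (λ a → bad v a ∧ ok a) a) then f a else 0#))
      ≈⟨ ΣL-cong L (λ {a} _ → split a) ⟩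
    ΣL L (λ a → if does (≡true? ok a) then f a else 0#) ≈⟨ sym (ΣL-filter (≡true? ok) L f) ⟩
    ΣL (filter (≡true? ok) L) f ≈⟨ ΣL-eliminate bad φ uL inv keep vs ⟩
    ΣL L f ∎
    where
    ok : A → Bool
    ok a = and (map (λ v → not (bad v a)) vs)
    split : ∀ a → (if does (≡true? (λ a → not (bad v a) ∧ ok a) a) then f a else 0#) + (if does (≡true? (λ a → bad v a ∧ ok a) a) then f a else 0#)
      ≈ (if does (≡true? ok a) then f a else 0#)
    split a with bad v a | ok a
    ... | true | true = +-identityˡ _
    ... | true | false = +-identityˡ _
    ... | false | true = +-identityʳ _
    ... | false | false = +-identityˡ _
    L′ : List A
    L′ = filter (≡true? (λ a → bad v a ∧ ok a)) L
    L′⁻ : ∀ {a} → a ∈ L′ → a ∈ L × bad v a ≡ true × ok a ≡ true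
    L′⁻ {a} a∈ with ∈-filter⁻ (≡true? (λ a → bad v a ∧ ok a)) {xs = L} a∈
    ... | a∈L , t = a∈L , ∧-true⁻ {bad v a} t
    ok-φ : ∀ {a} → a ∈ L → bad v a ≡ true → ok a ≡ true → ok (φ v a) ≡ true
    ok-φ {a} a∈ b o = and-map⁺ {xs = vs} λ {u} u∈ → good u (not-true⁻ (and-map⁻ {xs = vs} o u∈))
      where
      good : ∀ u → bad u a ≡ false → not (bad u (φ v a)) ≡ true
      good u e with bad u (φ v a) in eq
      ... | false = ≡.refl
      ... | true = case ≡.trans (≡.sym (keep u a∈ b eq)) e of λ ()
    cancel : ΣL L′ f ≈ 0#
    cancel = ΣL-involution {φ = φ v} (Uniq.filter⁺ (≡true? (λ a → bad v a ∧ ok a)) uL) (record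
      { closed = λ {a} a∈ → let a∈L , b , o = L′⁻ a∈ ; φ∈ , b′ , _ = inv a∈L b in
          ∈-filter⁺ (≡true? (λ a → bad v a ∧ ok a)) φ∈ (cong₂ _∧_ b′ (ok-φ a∈L b o))
      ; involutive = λ a∈ → let a∈L , b , _ = L′⁻ a∈ in proj₁ (proj₂ (proj₂ (inv a∈L b)))
      ; fixfree = λ a∈ → let a∈L , b , _ = L′⁻ a∈ in proj₁ (proj₂ (proj₂ (proj₂ (inv a∈L b))))
      ; reversing = λ a∈ → let a∈L , b , _ = L′⁻ a∈ in proj₂ (proj₂ (proj₂ (proj₂ (inv a∈L b)))) })

  module _ {n : ℕ} (X Xinv : Fin n → Carrier) where
    initWeight-++ : ∀ s q as bs → initWeight X Xinv s q (as ++ bs) ≈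
      initWeight X Xinv s q as * initWeight X Xinv s (endOf (initStep s) q as) bs
    initWeight-++ s q [] bs = sym (*-identityˡ _)
    initWeight-++ s q (true ∷ as) bs = initWeight-++ s (q ⊕ initStep s true) as bs
    initWeight-++ s q (false ∷ as) bs = trans (*-congˡ (initWeight-++ s (q ⊕ initStep s false) as bs)) (sym (*-assoc _ _ _))

    module _ (full : Bool) (E : Fin n → List Point) (w : Carrier)
      (finWeight-1 : full ≡ true → ∀ {i p j e} → e ∈ E j → Adm (suc i) p e →
        finWeight w (suc (toℕ j)) (turnPt (suc i) p) (fin p) ≈ 1#) where

      weight : ℕ → Fin n → Path → Carrier
      weight i j p = pathWeight w X Xinv i (suc (toℕ j)) p

      -- Between initial segments, weights split multiplicatively at v and each final segment keeps
      -- its endpoint index. Between final segments, the part before v is weighed with a new index;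
      -- there `finWeight-1` makes all final weights equal to 1.
      weight-splice : ∀ {v i p j e i′ p′ j′ e′ b} → e ∈ E j → Adm (suc i) p e → e′ ∈ E j′ → Adm (suc i′) p′ e′ →
        Meet full v (suc i) p (suc i′) p′ b →
        weight (suc i) j′ (spliceAt b v (suc i) p (suc i′) p′) * weight (suc i′) j (spliceAt b v (suc i′) p′ (suc i) p)
          ≈ weight (suc i) j p * weight (suc i′) j′ p′
      weight-splice {v} {i} {mkPath s ini fn} {j} {e} {i′} {mkPath .s ini′ fn′} {j′} {e′} e∈ ad e∈′ ad′ (meetInit ≡.refl v∈ v∈′) = begin
        (iW st (h ++ t′) * fW j′ (endOf f st (h ++ t′)) fn′) * (iW st′ (h′ ++ t) * fW j (endOf f st′ (h′ ++ t)) fn)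
          ≈⟨ *-cong (*-cong (factor st v∈ t′) (reflexive (cong (λ z → fW j′ z fn′) (endOf-splice f ini ini′ v∈ v∈′))))
                    (*-cong (factor st′ v∈′ t) (reflexive (cong (λ z → fW j z fn) (endOf-splice f ini′ ini v∈′ v∈)))) ⟩
        (iW st h * iW v t′ * fW j′ T′ fn′) * (iW st′ h′ * iW v t * fW j T fn)
          ≈⟨ rearrange (iW st h) (iW v t′) (fW j′ T′ fn′) (iW st′ h′) (iW v t) (fW j T fn) ⟩
        (iW st h * iW v t * fW j T fn) * (iW st′ h′ * iW v t′ * fW j′ T′ fn′)
          ≈⟨ *-cong (*-congʳ (sym (whole st ini v∈))) (*-congʳ (sym (whole st′ ini′ v∈′))) ⟩
        (iW st ini * fW j T fn) * (iW st′ ini′ * fW j′ T′ fn′) ∎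
        where
        f : Bool → Point
        f = initStep s
        st st′ T T′ : Point
        st = startPt (suc i) s
        st′ = startPt (suc i′) s
        T = endOf f st ini
        T′ = endOf f st′ ini′
        h t h′ t′ : List Bool
        h = cutHead f st v ini
        t = cutTail f st v ini
        h′ = cutHead f st′ v ini′
        t′ = cutTail f st′ v ini′
        iW : Point → List Bool → Carrier
        iW = initWeight X Xinv s
        fW : Fin n → Point → List Bool → Carrier
        fW k = finWeight w (suc (toℕ k))
        factor : ∀ z {bs} → v ∈ walk f z bs → ∀ r → iW z (cutHead f z v bs ++ r) ≈ iW z (cutHead f z v bs) * iW v r
        factor z {bs} v∈ r = trans (initWeight-++ s z (cutHead f z v bs) r) (*-congˡ (reflexive (cong (λ y → iW y r) (cut-end f bs v∈))))
        whole : ∀ z bs → v ∈ walk f z bs → iW z bs ≈ iW z (cutHead f z v bs) * iW v (cutTail f z v bs)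
        whole z bs v∈ = trans (reflexive (cong (iW z) (≡.sym (cut-++ f z v bs)))) (factor z v∈ (cutTail f z v bs))
        rearrange : ∀ a b c d e f → (a * b * c) * (d * e * f) ≈ (a * e * f) * (d * b * c)
        rearrange a b c d e f = begin
          (a * b * c) * (d * e * f) ≈⟨ *-cong (*-assoc a b c) (*-assoc d e f) ⟩
          (a * (b * c)) * (d * (e * f)) ≈⟨ *-interchange a (b * c) d (e * f) ⟩
          (a * d) * ((b * c) * (e * f)) ≈⟨ *-congˡ (*-comm (b * c) (e * f)) ⟩
          (a * d) * ((e * f) * (b * c)) ≈⟨ *-interchange a d (e * f) (b * c) ⟩
          (a * (e * f)) * (d * (b * c)) ≈⟨ *-cong (sym (*-assoc a e f)) (sym (*-assoc d b c)) ⟩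
          (a * e * f) * (d * b * c) ∎
      weight-splice {v} {i} {p} {j} {e} {i′} {p′} {j′} {e′} e∈ ad e∈′ ad′ m@(meetFin full≡ v∈ v∈′) =
        *-cong (*-congˡ (trans (finWeight-1 full≡ e∈′ (Spliced.adm (spliced ad ad′ m))) (sym (finWeight-1 full≡ e∈ ad))))
               (*-congˡ (trans (finWeight-1 full≡ e∈ (Spliced.adm (spliced ad′ ad (Meet-sym m)))) (sym (finWeight-1 full≡ e∈′ ad′))))

      term : Family n → Carrier
      term F = negOnePow (signExp standardSign F) * famWeight w X Xinv F

      term-exchange : ∀ {v F} (I : InFam E F) {a b} → toℕ a ℕ.< toℕ b → v ∈ ptsOf full F a → v ∈ ptsOf full F b →
        term (exchange v a b F) ≈ - term F
      term-exchange {v} {F} I {a} {b} a<b v∈a v∈b = trans (*-cong sign weights) (sym (-‿distribˡ-* _ _))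
        where
        open Exchange {E = E} {full = full} {F = F} I a<b v∈a v∈b
        βs : ℕ
        βs = length (filter (λ i → isβ (lookup (starts F) i) Bool.≟ true) (allFin n))
        sign : negOnePow (inversions (σ F′) ℕ.+ βs) ≈ - negOnePow (inversions (σ F) ℕ.+ βs)
        sign = begin
          negOnePow (inversions (σ F′) ℕ.+ βs) ≈⟨ negOnePow-+ (inversions (σ F′)) βs ⟩
          negOnePow (inversions (σ F′)) * negOnePow βs ≈⟨ *-congʳ (negOnePow-flip {inversions (σ F′)} {inversions (σ F)} (odd-inversions-swap (σ F) a<b (perm I))) ⟩
          - negOnePow (inversions (σ F)) * negOnePow βs ≈⟨ sym (-‿distribˡ-* _ _) ⟩
          - (negOnePow (inversions (σ F)) * negOnePow βs) ≈⟨ -‿cong (sym (negOnePow-+ (inversions (σ F)) βs)) ⟩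
          - negOnePow (inversions (σ F) ℕ.+ βs) ∎
        weights : famWeight w X Xinv F′ ≈ famWeight w X Xinv F
        weights = ∏-exchange a≢b (λ i → weight (suc (toℕ i)) (lookup (σ F′) i) (lookup (paths F′) i)) (λ i → weight (suc (toℕ i)) (lookup (σ F) i) (lookup (paths F) i))
          (λ {i} p q → reflexive (cong₂ (weight (suc (toℕ i))) (lookup-update₂-other a≢b (σ F) p q) (path-other p q)))
          (trans (*-cong (reflexive (cong₂ (weight (suc (toℕ a))) (lookup-update₂ˡ a≢b (σ F)) path-a))
                         (reflexive (cong₂ (weight (suc (toℕ b))) (lookup-update₂ʳ a≢b (σ F)) path-b)))
            (weight-splice {j = lookup (σ F) a} {j′ = lookup (σ F) b} (end∈ I a) (adms I a) (end∈ I b) (adms I b) meet-ab))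

      private
        L : List (Family n)
        L = families n E

        φ : Point → Family n → Family n
        φ v F = maybe′ (λ p → exchange v (proj₁ p) (proj₂ p) F) F (sharedPair full v F)

        Laws : Point → Family n → Family n → Set _
        Laws v F G = G ∈ L × shared full v G ≡ true × φ v G ≡ F × G ≢ F × term G ≈ - term F × (∀ u → shared full u G ≡ true → shared full u F ≡ true)

        φ-laws : ∀ {v F} → F ∈ L → shared full v F ≡ true → Laws v F (φ v F)
        φ-laws {v} {F} F∈ h with shared⁻ {full = full} {v} {F} h
        ... | a , b , eq , a<b , v∈a , v∈b = subst (Laws v F) (≡.sym φF)
          ( ∈-families⁺ E {F′} exchange-InFam
          , ≡.trans (cong is-just sharedPair-exchange) h
          , ≡.trans (cong (maybe′ (λ p → exchange v (proj₁ p) (proj₂ p) F′) F′) (≡.trans sharedPair-exchange eq)) exchange-involutive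
          , exchange-≢ , term-exchange I a<b v∈a v∈b , shared-exchange )
          where
          I : InFam E F
          I = ∈-families⁻ E F∈
          open Exchange {E = E} {full = full} {F = F} I a<b v∈a v∈b
          φF : φ v F ≡ exchange v a b F
          φF = cong (maybe′ (λ p → exchange v (proj₁ p) (proj₂ p) F) F) eq

      famSum-disjoint : (∀ j → Unique (E j)) →
        famSum standardSign (disjointness full) E w X Xinv ≈ famSum standardSign allFamilies E w X Xinv
      famSum-disjoint uE = begin
        ΣL (filter (≡true? (restrictᵇ (disjointness full))) L) term ≈⟨ ΣL-filter (≡true? (restrictᵇ (disjointness full))) L term ⟩
        ΣL L (λ F → if does (≡true? (restrictᵇ (disjointness full)) F) then term F else 0#)
          ≈⟨ ΣL-cong L (λ {F} F∈ → reflexive (cong (λ t → if does (t Bool.≟ true) then term F else 0#)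
                (restrict-unshared full F V (λ i u∈ → ∈-concatMap-∃⁺ (λ G → concatMap (ptsOf full G) (allFin n)) F∈ (∈-concatMap-∃⁺ (ptsOf full F) (∈-allFin i) u∈))))) ⟩
        ΣL L (λ F → if does (≡true? (unshared full V) F) then term F else 0#) ≈⟨ sym (ΣL-filter (≡true? (unshared full V)) L term) ⟩
        ΣL (filter (≡true? (unshared full V)) L) term
          ≈⟨ ΣL-eliminate (shared full) φ (families-unique E uE)
               (λ F∈ h → let a , b , c , d , e , _ = φ-laws F∈ h in a , b , c , d , e)
               (λ u F∈ h → proj₂ (proj₂ (proj₂ (proj₂ (proj₂ (φ-laws F∈ h))))) u) V ⟩
        ΣL L term ≈⟨ sym (ΣL-filter (≡true? (λ _ → true)) L term) ⟩
        ΣL (filter (≡true? (λ _ → true)) L) term ∎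
        where
        V : List Point
        V = concatMap (λ G → concatMap (ptsOf full G) (allFin n)) L

-- Planarity of disjoint families

DisjointPts : List Point → List Point → Set
DisjointPts xs ys = ∀ {u} → u ∈ xs → ¬ u ∈ ys

pt-≡ : ∀ {p q} → diagSum p ≡ diagSum q → proj₁ p ≡ proj₁ q → p ≡ q
pt-≡ {x , y} {.x , y′} d ≡.refl = cong (x ,_) (∙-cancelˡ x y y′ d)

x-additive : Additive proj₁
x-additive = additive λ _ _ → ≡.refl

x-finStep : ∀ b → + 0 ℤ.≤ proj₁ (finStep b)
x-finStep true = ℤ.+≤+ ℕ.z≤n
x-finStep false = ℤ.+≤+ ℕ.z≤n

x-finStep-≤1 : ∀ b → proj₁ (finStep b) ℤ.≤ + 1
x-finStep-≤1 true = ℤP.≤-refl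
x-finStep-≤1 false = ℤ.+≤+ ℕ.z≤n

-- Both walks advance by one antidiagonal per step, so they can be compared step by step. Abscissae
-- are integers changing by 0 or 1, so the left walk can pass the right one only by meeting it. Once
-- the left walk has ended, the right one can only move further right.
fin-order : ∀ q′ q bs′ bs → diagSum q′ ≡ diagSum q → proj₁ q′ ℤ.< proj₁ q →
  DisjointPts (walk finStep q′ bs′) (walk finStep q bs) → length bs′ ℕ.≤ length bs →
  proj₁ (endOf finStep q′ bs′) ℤ.< proj₁ (endOf finStep q bs)
fin-order q′ q [] bs d x<x dis len = ℤP.<-≤-trans x<x (walk-≤ x-additive x-finStep q bs (last∈walk q bs))
fin-order q′ q (b′ ∷ bs′) (b ∷ bs) d x<x dis (ℕ.s≤s len) =
  fin-order (q′ ⊕ finStep b′) (q ⊕ finStep b) bs′ bs d′ (ℤP.≤∧≢⇒< x≤x x≢x) (λ u∈ u∈′ → dis (there u∈) (there u∈′)) len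
  where
  d′ : diagSum (q′ ⊕ finStep b′) ≡ diagSum (q ⊕ finStep b)
  d′ = ≡.trans (add diagSum-additive q′ (finStep b′)) (≡.trans (cong₂ ℤ._+_ d (≡.trans (diagSum-finStep b′) (≡.sym (diagSum-finStep b)))) (≡.sym (add diagSum-additive q (finStep b))))
  x≤x : proj₁ (q′ ⊕ finStep b′) ℤ.≤ proj₁ (q ⊕ finStep b)
  x≤x = ℤP.≤-trans (ℤP.+-monoʳ-≤ (proj₁ q′) (x-finStep-≤1 b′))
    (ℤP.≤-trans (ℤP.≤-reflexive (ℤP.+-comm (proj₁ q′) (+ 1))) (ℤP.≤-trans (ℤP.i<j⇒suc[i]≤j x<x) (step-≤ {f = finStep} x-additive x-finStep q b)))
  x≢x : proj₁ (q′ ⊕ finStep b′) ≢ proj₁ (q ⊕ finStep b)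
  x≢x e = dis (there (first∈walk {f = finStep} (q′ ⊕ finStep b′) bs′)) (subst (_∈ walk finStep q (b ∷ bs)) (≡.sym (pt-≡ d′ e)) (there (first∈walk {f = finStep} _ bs)))

double-injective : ∀ {x y : ℤ} → x ℤ.+ x ≡ y ℤ.+ y → x ≡ y
double-injective {x} {y} e = ℤP.*-cancelˡ-≡ (+ 2) x y (≡.trans (two x) (≡.trans e (≡.sym (two y))))
  where
  two : ∀ z → + 2 ℤ.* z ≡ z ℤ.+ z
  two z = solve 1 (λ z → con (+ 2) :* z := z :+ z) ≡.refl z
    where open +-*-Solver

pt-≡-aside : ∀ s {p q} → diagSum p ≡ diagSum q → aside s p ≡ aside s q → p ≡ q
pt-≡-aside s {p} {q} d a = pt-≡ d (x-eq s a)
  where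
  open +-*-Solver
  x-eq : ∀ s → aside s p ≡ aside s q → proj₁ p ≡ proj₁ q
  x-eq α a = double-injective (≡.trans (expand p) (≡.trans (cong₂ ℤ._-_ d a) (≡.sym (expand q))))
    where
    expand : ∀ p → proj₁ p ℤ.+ proj₁ p ≡ diagSum p ℤ.- aside α p
    expand (x , y) = solve 2 (λ x y → x :+ x := (x :+ y) :- (y :- x)) ≡.refl x y
  x-eq β a = double-injective (≡.trans (expand p) (≡.trans (cong₂ ℤ._+_ d a) (≡.sym (expand q))))
    where
    expand : ∀ p → proj₁ p ℤ.+ proj₁ p ≡ diagSum p ℤ.+ aside β p
    expand (x , y) = solve 2 (λ x y → x :+ x := (x :+ y) :+ (x :- y)) ≡.refl x y

diagSum-up : ∀ s q → diagSum (q ⊕ initStep s true) ≡ diagSum q ℤ.+ + 2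
diagSum-up α q = add diagSum-additive q (+ 1 , + 1)
diagSum-up β q = add diagSum-additive q (+ 1 , + 1)

diagSum-side : ∀ s q → diagSum (q ⊕ initStep s false) ≡ diagSum q
diagSum-side α q = ≡.trans (add diagSum-additive q _) (ℤP.+-identityʳ (diagSum q))
diagSum-side β q = ≡.trans (add diagSum-additive q _) (ℤP.+-identityʳ (diagSum q))

aside-up : ∀ s q → aside s (q ⊕ initStep s true) ≡ aside s q
aside-up α q = ≡.trans (add (aside-additive α) q _) (ℤP.+-identityʳ (aside α q))
aside-up β q = ≡.trans (add (aside-additive β) q _) (ℤP.+-identityʳ (aside β q))

aside-side : ∀ s q → aside s (q ⊕ initStep s false) ≡ aside s q ℤ.+ + 2
aside-side α q = add (aside-additive α) q _
aside-side β q = add (aside-additive β) q _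

twice : ℕ → ℤ
twice m = + 2 ℤ.* + m

twice-suc : ∀ m → twice (suc m) ≡ + 2 ℤ.+ twice m
twice-suc m = solve 1 (λ m → con (+ 2) :* (con (+ 1) :+ m) := con (+ 2) :+ con (+ 2) :* m) ≡.refl (+ m)
  where open +-*-Solver

cannot-exceed : ∀ s q bs → diagSum (endOf (initStep s) (q ⊕ initStep s true) bs) ≢ diagSum q
cannot-exceed s q bs e = ℤP.<-irrefl (≡.sym e) (ℤP.<-≤-trans
  (subst₂ ℤ._<_ (ℤP.+-identityʳ (diagSum q)) (≡.sym (diagSum-up s q)) (ℤP.+-monoʳ-< (diagSum q) (ℤ.+<+ {0} {2} ℕ.z<s)))
  (walk-≤ diagSum-additive (diagSum-initStep s) (q ⊕ initStep s true) bs (last∈walk _ bs)))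

-- q′ is m lines below q and k + 1 positions further out; the two walks keep their order
-- because on a common line they can only pass each other by meeting.
init-order : ∀ s m k q′ q bs′ bs → diagSum q ≡ diagSum q′ ℤ.+ twice m → aside s q′ ≡ aside s q ℤ.+ twice (suc k) →
  DisjointPts (walk (initStep s) q′ bs′) (walk (initStep s) q bs) →
  diagSum (endOf (initStep s) q′ bs′) ≡ + 0 → diagSum (endOf (initStep s) q bs) ≡ + 0 →
  ∃ λ k′ → aside s (endOf (initStep s) q′ bs′) ≡ aside s (endOf (initStep s) q bs) ℤ.+ twice (suc k′)
init-order s m k q′ q (false ∷ bs′) bs d a dis e′ e =
  init-order s m (suc k) (q′ ⊕ initStep s false) q bs′ bs (≡.trans d (cong (ℤ._+ twice m) (≡.sym (diagSum-side s q′))))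
    (≡.trans (aside-side s q′) (≡.trans (cong (ℤ._+ + 2) a)
      (≡.trans (solve 2 (λ a t → (a :+ t) :+ con (+ 2) := a :+ (con (+ 2) :+ t)) ≡.refl (aside s q) (twice (suc k))) (cong (λ z → aside s q ℤ.+ z) (≡.sym (twice-suc (suc k)))))))
    (λ u∈ → dis (there u∈)) e′ e
  where open +-*-Solver
init-order s (suc m) k q′ q (true ∷ bs′) bs d a dis e′ e =
  init-order s m k (q′ ⊕ initStep s true) q bs′ bs
    (≡.trans d (≡.trans (cong (λ z → diagSum q′ ℤ.+ z) (twice-suc m)) (≡.trans (≡.sym (ℤP.+-assoc (diagSum q′) (+ 2) (twice m))) (cong (ℤ._+ twice m) (≡.sym (diagSum-up s q′))))))
    (≡.trans (aside-up s q′) a) (λ u∈ → dis (there u∈)) e′ e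
init-order s zero k q′ q (true ∷ bs′) (true ∷ bs) d a dis e′ e =
  init-order s zero k (q′ ⊕ initStep s true) (q ⊕ initStep s true) bs′ bs
    (≡.trans (diagSum-up s q) (≡.trans (cong (ℤ._+ + 2) (≡.trans d (ℤP.+-identityʳ (diagSum q′)))) (≡.trans (≡.sym (diagSum-up s q′)) (≡.sym (ℤP.+-identityʳ _)))))
    (≡.trans (aside-up s q′) (≡.trans a (cong (ℤ._+ twice (suc k)) (≡.sym (aside-up s q))))) (λ u∈ u∈′ → dis (there u∈) (there u∈′)) e′ e
init-order s zero k q′ q (true ∷ bs′) [] d a dis e′ e =
  contradiction (≡.trans e′ (≡.trans (≡.sym e) (≡.trans d (ℤP.+-identityʳ (diagSum q′))))) (cannot-exceed s q′ bs′)
init-order s zero k q′ q [] [] d a dis e′ e = k , a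
init-order s zero k q′ q [] (true ∷ bs) d a dis e′ e =
  contradiction (≡.trans e (≡.trans (≡.sym e′) (≡.sym (≡.trans d (ℤP.+-identityʳ (diagSum q′)))))) (cannot-exceed s q bs)
-- At distance one, a side step of the inner walk lands on the current vertex of the outer walk,
-- which disjointness excludes.
init-order s zero zero q′ q bs′ (false ∷ bs) d a dis e′ e =
  contradiction (subst (_∈ walk (initStep s) q (false ∷ bs)) same (there (first∈walk {f = initStep s} _ bs))) (dis (first∈walk {f = initStep s} q′ bs′))
  where
  same : q ⊕ initStep s false ≡ q′
  same = pt-≡-aside s (≡.trans (diagSum-side s q) (≡.trans d (ℤP.+-identityʳ (diagSum q′)))) (≡.trans (aside-side s q) (≡.sym a))
init-order s zero (suc k) q′ q bs′ (false ∷ bs) d a dis e′ e =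
  init-order s zero k q′ (q ⊕ initStep s false) bs′ bs (≡.trans (diagSum-side s q) d)
    (≡.trans a (≡.trans (cong (λ z → aside s q ℤ.+ z) (twice-suc (suc k))) (≡.trans (≡.sym (ℤP.+-assoc (aside s q) (+ 2) (twice (suc k)))) (cong (ℤ._+ twice (suc k)) (≡.sym (aside-side s q))))))
    (λ u∈ u∈′ → dis u∈ (there u∈′)) e′ e
init-order s (suc m) k q′ q [] bs d a dis e′ e =
  contradiction lt (ℤP.<-irrefl ≡.refl)
  where
  lt : + 0 ℤ.< + 0
  lt = ℤP.<-≤-trans (subst₂ ℤ._<_ (ℤP.+-identityʳ (+ 0)) (≡.trans (cong (ℤ._+ twice (suc m)) (≡.sym e′)) (≡.sym d)) (ℤP.+-monoʳ-< (+ 0) (subst (+ 0 ℤ.<_) (≡.sym (twice-suc m)) (subst (+ 0 ℤ.<_) (cong (λ z → + 2 ℤ.+ z) (ℤP.pos-* 2 m)) (ℤ.+<+ ℕ.z<s)))))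
    (subst (diagSum q ℤ.≤_) e (walk-≤ diagSum-additive (diagSum-initStep s) q bs (last∈walk q bs)))

diagSum-startPt : ∀ i s → diagSum (startPt i s) ≡ + 2 ℤ.- (+ 4 ℤ.* + i)
diagSum-startPt i s = ≡.trans (lem s) (≡.trans (cong (λ z → + 2 ℤ.- (z ℤ.+ + i)) (ℤP.pos-* 3 i))
    (solve 1 (λ i → con (+ 2) :- (con (+ 3) :* i :+ i) := con (+ 2) :- con (+ 4) :* i) ≡.refl (+ i)))
  where
  open +-*-Solver
  lem : ∀ s → diagSum (startPt i s) ≡ + 2 ℤ.- (+ (3 ℕ.* i) ℤ.+ + i)
  lem α = solve 2 (λ i j → (con (+ 1) :- j) :+ (con (+ 1) :- i) := con (+ 2) :- (j :+ i)) ≡.refl (+ i) (+ (3 ℕ.* i))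
  lem β = solve 2 (λ i j → (con (+ 1) :- i) :+ (con (+ 1) :- j) := con (+ 2) :- (j :+ i)) ≡.refl (+ i) (+ (3 ℕ.* i))

init-turn-order : ∀ {i k s ini ini′ fn fn′ e e′} → let p = mkPath s ini fn ; p′ = mkPath s ini′ fn′ ; i′ = suc (i ℕ.+ k) in
  Adm i p e → Adm i′ p′ e′ → DisjointPts (initPts i′ p′) (initPts i p) →
  ∃ λ k′ → aside s (turnPt i′ p′) ≡ aside s (turnPt i p) ℤ.+ twice (suc k′)
init-turn-order {i} {k} {s} {ini} {ini′} ad ad′ dis =
  -- Between the starting points of indices i and i + k + 1, x + y falls by 4 (k + 1), which is 2 (k
  -- + 1) lines, and `aside` grows by 2 (k + 1), which is k + 1 side steps.
  init-order s (suc k ℕ.+ suc k) k (startPt i′ s) (startPt i s) ini′ ini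
    (≡.trans (diagSum-startPt i s) (≡.trans diag-shift (cong (ℤ._+ twice (suc k ℕ.+ suc k)) (≡.sym (diagSum-startPt i′ s)))))
    (≡.trans (aside-startPt i′ s) (≡.trans aside-shift (cong (ℤ._+ twice (suc k)) (≡.sym (aside-startPt i s)))))
    dis (turn-diag ad′) (turn-diag ad)
  where
  open +-*-Solver
  i′ : ℕ
  i′ = suc (i ℕ.+ k)
  diag-shift : + 2 ℤ.- (+ 4 ℤ.* + i) ≡ + 2 ℤ.- (+ 4 ℤ.* + i′) ℤ.+ twice (suc k ℕ.+ suc k)
  diag-shift = solve 2 (λ i k → con (+ 2) :- (con (+ 4) :* i) :=
      con (+ 2) :- (con (+ 4) :* (con (+ 1) :+ (i :+ k))) :+ con (+ 2) :* ((con (+ 1) :+ k) :+ (con (+ 1) :+ k))) ≡.refl (+ i) (+ k)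
  aside-shift : + (i′ ℕ.+ i′) ≡ + (i ℕ.+ i) ℤ.+ twice (suc k)
  aside-shift = solve 2 (λ i k → (con (+ 1) :+ (i :+ k)) :+ (con (+ 1) :+ (i :+ k)) :=
      (i :+ i) :+ con (+ 2) :* (con (+ 1) :+ k)) ≡.refl (+ i) (+ k)

leftOf : Start → Point → Point → Set
leftOf α p′ p = proj₁ p′ ℤ.< proj₁ p
leftOf β p′ p = proj₁ p ℤ.< proj₁ p′

<-from-double : ∀ {x y} → x ℤ.+ x ℤ.< y ℤ.+ y → x ℤ.< y
<-from-double {x} {y} h with x ℤ.<? y
... | yes p = p
... | no ¬p = contradiction h (ℤP.≤⇒≯ (ℤP.+-mono-≤ (ℤP.≮⇒≥ ¬p) (ℤP.≮⇒≥ ¬p)))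

aside⇒leftOf : ∀ s {p′ p} → diagSum p′ ≡ + 0 → diagSum p ≡ + 0 → aside s p ℤ.< aside s p′ → leftOf s p′ p
aside⇒leftOf α {p′} {p} d′ d h = <-from-double (subst₂ ℤ._<_ (expand p′ d′) (expand p d) (ℤP.neg-mono-< h))
  where
  expand : ∀ p → diagSum p ≡ + 0 → ℤ.- aside α p ≡ proj₁ p ℤ.+ proj₁ p
  expand (x , y) d = ≡.trans (solve 2 (λ x y → :- (y :- x) := (x :+ x) :- (x :+ y)) ≡.refl x y) (≡.trans (cong (λ z → (x ℤ.+ x) ℤ.- z) d) (ℤP.+-identityʳ _))
    where open +-*-Solver
aside⇒leftOf β {p′} {p} d′ d h = <-from-double (subst₂ ℤ._<_ (expand p d) (expand p′ d′) h)
  where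
  expand : ∀ p → diagSum p ≡ + 0 → aside β p ≡ proj₁ p ℤ.+ proj₁ p
  expand (x , y) d = ≡.trans (solve 2 (λ x y → x :- y := (x :+ x) :- (x :+ y)) ≡.refl x y) (≡.trans (cong (λ z → (x ℤ.+ x) ℤ.- z) d) (ℤP.+-identityʳ _))
    where open +-*-Solver

aside-flip : ∀ p → aside β p ≡ ℤ.- aside α p
aside-flip (x , y) = solve 2 (λ x y → x :- y := :- (y :- x)) ≡.refl x y
  where open +-*-Solver

-- A later path turns further out on its own side than every earlier path: for equal types by the
-- ordering of initial segments, for opposite types because the turning points lie on opposite sides
-- of the origin.
turn-order : ∀ {i i′ p p′ e e′} → i ℕ.< i′ → Adm (suc i) p e → Adm (suc i′) p′ e′ →
  DisjointPts (initPts (suc i′) p′) (initPts (suc i) p) → leftOf (start p′) (turnPt (suc i′) p′) (turnPt (suc i) p)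
turn-order {i} {i′} {mkPath s ini fn} {mkPath s′ ini′ fn′} {e} {e′} i<i′ ad ad′ dis =
  aside⇒leftOf s′ (turn-diag ad′) (turn-diag ad) (further s s′ ad ad′ dis)
  where
  turn-pos : ∀ {j s ini fn} → let p = mkPath s ini fn in + 0 ℤ.< aside s (turnPt (suc j) p)
  turn-pos {j} {s} {ini} {fn} = aside-pos {j} {mkPath s ini fn} (last∈walk _ ini)
  further : ∀ s s′ → Adm (suc i) (mkPath s ini fn) e → Adm (suc i′) (mkPath s′ ini′ fn′) e′ →
    DisjointPts (initPts (suc i′) (mkPath s′ ini′ fn′)) (initPts (suc i) (mkPath s ini fn)) →
    aside s′ (turnPt (suc i) (mkPath s ini fn)) ℤ.< aside s′ (turnPt (suc i′) (mkPath s′ ini′ fn′))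
  same : ∀ s → Adm (suc i) (mkPath s ini fn) e → Adm (suc i′) (mkPath s ini′ fn′) e′ →
    DisjointPts (initPts (suc i′) (mkPath s ini′ fn′)) (initPts (suc i) (mkPath s ini fn)) →
    aside s (turnPt (suc i) (mkPath s ini fn)) ℤ.< aside s (turnPt (suc i′) (mkPath s ini′ fn′))
  same s ad ad′ dis with ℕP.m≤n⇒∃[o]m+o≡n i<i′
  ... | k , ≡.refl with init-turn-order {suc i} {k} {s} {ini} {ini′} {fn} {fn′} ad ad′ dis
  ... | k′ , eq = subst₂ ℤ._<_ (ℤP.+-identityʳ _) (≡.sym eq)
        (ℤP.+-monoʳ-< (aside s (turnPt (suc i) (mkPath s ini fn))) (subst (+ 0 ℤ.<_) (ℤP.pos-* 2 (suc k′)) (ℤ.+<+ ℕ.z<s)))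
  further α α = same α
  further β β = same β
  further α β _ _ _ = ℤP.<-trans (subst (ℤ._< + 0) (≡.sym (aside-flip (turnPt (suc i) (mkPath α ini fn)))) (ℤP.neg-mono-< (turn-pos {i} {α} {ini} {fn}))) (turn-pos {i′} {β} {ini′} {fn′})
  further β α _ _ _ = ℤP.<-trans (subst (ℤ._< + 0) (≡.trans (cong ℤ.-_ (aside-flip (turnPt (suc i) (mkPath β ini fn)))) (ℤP.neg-involutive _)) (ℤP.neg-mono-< (turn-pos {i} {β} {ini} {fn}))) (turn-pos {i′} {α} {ini′} {fn′})

-- Contradicts the conclusion of `fin-order` when a path further left goes to the smaller index. The
-- comparison of abscissae is weak because neighbouring sets of `E-even` have a point in common.
OrderedEnds : ∀ {n} → (Fin n → List Point) → Set
OrderedEnds E = ∀ {j′ j e′ e} → toℕ j′ ℕ.< toℕ j → e′ ∈ E j′ → e ∈ E j → diagSum e′ ℤ.≤ diagSum e × proj₁ e ℤ.≤ proj₁ e′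

module Planarity {n : ℕ} {E : Fin n → List Point} (ordered : OrderedEnds E) {F : Family n} (I : InFam E F)
  (dis : restrictᵇ disjointPaths F ≡ true) where

  private
    path : Fin n → Path
    path i = lookup (paths F) i
    turn : Fin n → Point
    turn i = turnPt (suc (toℕ i)) (path i)

  apart : ∀ {i j} → i ≢ j → DisjointPts (ptsOf true F i) (ptsOf true F j)
  apart {i} {j} i≢j u∈i u∈j with ℕP.<-cmp (toℕ i) (toℕ j)
  ... | tri< i<j _ _ = restrict⁻ true {F = F} dis i<j u∈i u∈j
  ... | tri≈ _ e _ = i≢j (FinP.toℕ-injective e)
  ... | tri> _ _ j<i = restrict⁻ true {F = F} dis j<i u∈j u∈i

  left⇒larger : ∀ {i j} → proj₁ (turn i) ℤ.< proj₁ (turn j) → toℕ (lookup (σ F) j) ℕ.< toℕ (lookup (σ F) i)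
  left⇒larger {i} {j} x<x with ℕP.<-cmp (toℕ (lookup (σ F) j)) (toℕ (lookup (σ F) i))
  ... | tri< p _ _ = p
  ... | tri≈ _ e _ = contradiction (cong (proj₁ ∘ turn) (≡.sym (perm I (FinP.toℕ-injective e)))) (λ q → ℤP.<-irrefl q x<x)
  ... | tri> _ _ q with ordered q (end∈ I i) (end∈ I j)
  ... | d≤d , x≤x = contradiction
      (subst₂ ℤ._<_ (cong proj₁ (end-pt (adms I i))) (cong proj₁ (end-pt (adms I j)))
        (fin-order (turn i) (turn j) (fin (path i)) (fin (path j)) (≡.trans (turn-diag (adms I i)) (≡.sym (turn-diag (adms I j)))) x<x
          (λ u∈ u∈′ → apart (λ { ≡.refl → ℤP.<-irrefl ≡.refl x<x }) (finPts⊆pts ≡.refl {suc (toℕ i)} {path i} u∈) (finPts⊆pts ≡.refl {suc (toℕ j)} {path j} u∈′))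
          (ℤ.drop‿+≤+ (subst₂ ℤ._≤_ (fin-length (adms I i)) (fin-length (adms I j)) d≤d))))
      (ℤP.≤⇒≯ x≤x)

  inversion-iff-β : ∀ {i j} → toℕ i ℕ.< toℕ j →
    does (toℕ (lookup (σ F) j) ℕ.<? toℕ (lookup (σ F) i)) ≡ isβ (lookup (starts F) j)
  inversion-iff-β {i} {j} i<j = subst (λ s → does (toℕ (lookup (σ F) j) ℕ.<? toℕ (lookup (σ F) i)) ≡ isβ s) (starts≡ I j)
    (go (start (path j)) (turn-order i<j (adms I i) (adms I j)
      (λ u∈ u∈′ → apart (λ { ≡.refl → ℕP.<-irrefl ≡.refl i<j }) (initPts⊆pts true {suc (toℕ j)} {path j} u∈) (initPts⊆pts true {suc (toℕ i)} {path i} u∈′))))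
    where
    go : ∀ s → leftOf s (turn j) (turn i) → does (toℕ (lookup (σ F) j) ℕ.<? toℕ (lookup (σ F) i)) ≡ isβ s
    go α l = does-false⁺ (toℕ (lookup (σ F) j) ℕ.<? toℕ (lookup (σ F) i)) (ℕP.<-asym (left⇒larger l))
    go β l = does-true⁺ (toℕ (lookup (σ F) j) ℕ.<? toℕ (lookup (σ F) i)) (left⇒larger l)

-- Comparison of the two sign exponents.

sumFin : ∀ {n} → (Fin n → ℕ) → ℕ
sumFin {n} f = sum (map f (allFin n))

sumFin-suc : ∀ {n} (f : Fin (suc n) → ℕ) → sumFin f ≡ f Fin.zero ℕ.+ sumFin (f ∘ Fin.suc)
sumFin-suc {n} f = cong (λ l → f Fin.zero ℕ.+ sum l) (≡.trans (cong (map f) (≡.sym (map-tabulate id Fin.suc))) (≡.sym (map-∘ (allFin n))))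

sumFin-cong : ∀ {n} {f g : Fin n → ℕ} → (∀ i → f i ≡ g i) → sumFin f ≡ sumFin g
sumFin-cong {n} h = cong sum (map-cong h (allFin n))

sumFin-+ : ∀ {n} (f g : Fin n → ℕ) → sumFin (λ i → f i ℕ.+ g i) ≡ sumFin f ℕ.+ sumFin g
sumFin-+ {zero} f g = ≡.refl
sumFin-+ {suc n} f g rewrite sumFin-suc (λ i → f i ℕ.+ g i) | sumFin-suc f | sumFin-suc g | sumFin-+ (f ∘ Fin.suc) (g ∘ Fin.suc) =
  solve 4 (λ a b c d → (a :+ b) :+ (c :+ d) := (a :+ c) :+ (b :+ d)) ≡.refl (f Fin.zero) (g Fin.zero) (sumFin (f ∘ Fin.suc)) (sumFin (g ∘ Fin.suc))
  where open ℕSolver.+-*-Solver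

sumFin-1 : ∀ n → sumFin {n} (λ _ → 1) ≡ n
sumFin-1 zero = ≡.refl
sumFin-1 (suc n) = ≡.trans (sumFin-suc {n} (λ _ → 1)) (cong suc (sumFin-1 n))

binomial-suc : ∀ n → suc (suc n) C 2 ≡ suc n ℕ.+ (suc n C 2)
binomial-suc n = ≡.trans (≡.sym (nCk+nC[k+1]≡[n+1]C[k+1] (suc n) 1)) (cong (ℕ._+ (suc n C 2)) (nC1≡n (suc n)))

sumFin-suc∘toℕ : ∀ n → sumFin {n} (λ i → suc (toℕ i)) ≡ suc n C 2
sumFin-suc∘toℕ zero = ≡.refl
sumFin-suc∘toℕ (suc n) = begin
  sumFin {suc n} (λ i → suc (toℕ i)) ≡⟨ sumFin-suc {n} (λ i → suc (toℕ i)) ⟩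
  1 ℕ.+ sumFin {n} (λ i → 1 ℕ.+ suc (toℕ i)) ≡⟨ cong suc (sumFin-+ {n} (λ _ → 1) (λ i → suc (toℕ i))) ⟩
  1 ℕ.+ (sumFin {n} (λ _ → 1) ℕ.+ sumFin {n} (λ i → suc (toℕ i))) ≡⟨ cong₂ (λ a b → 1 ℕ.+ (a ℕ.+ b)) (sumFin-1 n) (sumFin-suc∘toℕ n) ⟩
  suc n ℕ.+ (suc n C 2) ≡⟨ ≡.sym (binomial-suc n) ⟩
  suc (suc n) C 2 ∎
  where open ≡.≡-Reasoning

length-filter-as-sum : {A : Set} {P : A → Set} (P? : ∀ a → Dec (P a)) (b : A → Bool) (xs : List A) →
  (∀ {x} → x ∈ xs → does (P? x) ≡ b x) → length (filter P? xs) ≡ sum (map (λ x → if b x then 1 else 0) xs)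
length-filter-as-sum P? b [] h = ≡.refl
length-filter-as-sum P? b (x ∷ xs) h with does (P? x) | b x | h (here ≡.refl)
... | true | true | _ = cong suc (length-filter-as-sum P? b xs (h ∘ there))
... | false | false | _ = length-filter-as-sum P? b xs (h ∘ there)

-- The index i is the larger member of exactly `toℕ i` ordered pairs.
sum-ordPairs : ∀ {n} (b : Fin n → Bool) →
  sum (map (λ p → if b (proj₂ p) then 1 else 0) (ordPairs n)) ≡ sumFin (λ i → if b i then toℕ i else 0)
sum-ordPairs {zero} b = ≡.refl
sum-ordPairs {suc n} b = begin
  sum (map g (ordPairs (suc n))) ≡⟨ cong (sum ∘ map g) (ordPairs-suc n) ⟩
  sum (map g (map h₀ (allFin n) ++ map h₁ (ordPairs n))) ≡⟨ cong sum (map-++ g (map h₀ (allFin n)) (map h₁ (ordPairs n))) ⟩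
  sum (map g (map h₀ (allFin n)) ++ map g (map h₁ (ordPairs n))) ≡⟨ sum-++ (map g (map h₀ (allFin n))) _ ⟩
  sum (map g (map h₀ (allFin n))) ℕ.+ sum (map g (map h₁ (ordPairs n)))
    ≡⟨ cong₂ (λ k l → sum k ℕ.+ sum l) (≡.sym (map-∘ (allFin n))) (≡.sym (map-∘ (ordPairs n))) ⟩
  sumFin (λ j → if b (Fin.suc j) then 1 else 0) ℕ.+ sum (map (g ∘ h₁) (ordPairs n))
    ≡⟨ cong (λ z → sumFin (λ j → if b (Fin.suc j) then 1 else 0) ℕ.+ z) (sum-ordPairs (b ∘ Fin.suc)) ⟩
  sumFin (λ j → if b (Fin.suc j) then 1 else 0) ℕ.+ sumFin (λ j → if b (Fin.suc j) then toℕ j else 0)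
    ≡⟨ ≡.sym (sumFin-+ (λ j → if b (Fin.suc j) then 1 else 0) (λ j → if b (Fin.suc j) then toℕ j else 0)) ⟩
  sumFin (λ j → (if b (Fin.suc j) then 1 else 0) ℕ.+ (if b (Fin.suc j) then toℕ j else 0))
    ≡⟨ sumFin-cong merge ⟩
  sumFin (λ j → if b (Fin.suc j) then suc (toℕ j) else 0) ≡⟨ cong (ℕ._+ sumFin (λ j → if b (Fin.suc j) then suc (toℕ j) else 0)) (≡.sym (zero-term (b Fin.zero))) ⟩
  (if b Fin.zero then 0 else 0) ℕ.+ sumFin (λ j → if b (Fin.suc j) then suc (toℕ j) else 0)
    ≡⟨ ≡.sym (sumFin-suc (λ i → if b i then toℕ i else 0)) ⟩
  sumFin (λ i → if b i then toℕ i else 0) ∎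
  where
  open ≡.≡-Reasoning
  g : Fin (suc n) × Fin (suc n) → ℕ
  g p = if b (proj₂ p) then 1 else 0
  h₀ : Fin n → Fin (suc n) × Fin (suc n)
  h₀ j = Fin.zero , Fin.suc j
  h₁ : Fin n × Fin n → Fin (suc n) × Fin (suc n)
  h₁ p = Fin.suc (proj₁ p) , Fin.suc (proj₂ p)
  zero-term : ∀ c → (if c then 0 else 0) ≡ 0
  zero-term true = ≡.refl
  zero-term false = ≡.refl
  merge : ∀ j → (if b (Fin.suc j) then 1 else 0) ℕ.+ (if b (Fin.suc j) then toℕ j else 0) ≡ (if b (Fin.suc j) then suc (toℕ j) else 0)
  merge j with b (Fin.suc j)
  ... | true = ≡.refl
  ... | false = ≡.refl

-- By planarity, a β at 1-based index i causes i - 1 inversions, one for each smaller index, and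
-- adds one β-sign: i in total. An α adds i to the other exponent. Together this is 1 + ... + n.
signExp-disjoint : ∀ {n} {E : Fin n → List Point} → OrderedEnds E → {F : Family n} → InFam E F →
  restrictᵇ disjointPaths F ≡ true → signExp standardSign F ℕ.+ signExp alphaSign F ≡ suc n C 2
signExp-disjoint {n} {E} ordered {F} I dis = begin
  inversions (σ F) ℕ.+ length (filter (λ i → b i Bool.≟ true) (allFin n)) ℕ.+ sumFin (λ i → if b i then 0 else suc (toℕ i))
    ≡⟨ cong₂ (λ x y → x ℕ.+ y ℕ.+ sumFin (λ i → if b i then 0 else suc (toℕ i)))
         (≡.trans (length-filter-as-sum _ (b ∘ proj₂) (ordPairs n) (λ p∈ → inversion-iff-β (∈-ordPairs⁻ p∈))) (sum-ordPairs b))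
         (length-filter-as-sum (λ i → b i Bool.≟ true) b (allFin n) (λ {i} _ → does-≟true (b i))) ⟩
  sumFin (λ i → if b i then toℕ i else 0) ℕ.+ sumFin (λ i → if b i then 1 else 0) ℕ.+ sumFin (λ i → if b i then 0 else suc (toℕ i))
    ≡⟨ cong (ℕ._+ sumFin (λ i → if b i then 0 else suc (toℕ i))) (≡.sym (sumFin-+ (λ i → if b i then toℕ i else 0) (λ i → if b i then 1 else 0))) ⟩
  sumFin (λ i → (if b i then toℕ i else 0) ℕ.+ (if b i then 1 else 0)) ℕ.+ sumFin (λ i → if b i then 0 else suc (toℕ i))
    ≡⟨ ≡.sym (sumFin-+ (λ i → (if b i then toℕ i else 0) ℕ.+ (if b i then 1 else 0)) (λ i → if b i then 0 else suc (toℕ i))) ⟩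
  sumFin (λ i → (if b i then toℕ i else 0) ℕ.+ (if b i then 1 else 0) ℕ.+ (if b i then 0 else suc (toℕ i)))
    ≡⟨ sumFin-cong merge ⟩
  sumFin (λ (i : Fin n) → suc (toℕ i)) ≡⟨ sumFin-suc∘toℕ n ⟩
  suc n C 2 ∎
  where
  open ≡.≡-Reasoning
  open Planarity {E = E} ordered {F} I dis
  b : Fin n → Bool
  b i = isβ (lookup (starts F) i)
  does-≟true : ∀ c → does (c Bool.≟ true) ≡ c
  does-≟true true = ≡.refl
  does-≟true false = ≡.refl
  merge : ∀ i → (if b i then toℕ i else 0) ℕ.+ (if b i then 1 else 0) ℕ.+ (if b i then 0 else suc (toℕ i)) ≡ suc (toℕ i)
  merge i with b i
  ... | true = ≡.trans (ℕP.+-identityʳ _) (ℕP.+-comm (toℕ i) 1)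
  ... | false = ≡.refl

-- Linear recurrences and Newton interpolation

-- Unlike `i + i`, it unfolds by two successors, so functions defined by recursion on a line number
-- reduce at `double (suc i)`.
double : ℕ → ℕ
double zero = zero
double (suc i) = suc (suc (double i))

next prev : ℤ → ℤ
next (+ m) = + suc m
next -[1+ zero ] = + 0
next -[1+ suc m ] = -[1+ m ]
prev (+ zero) = -[1+ 0 ]
prev (+ suc m) = + m
prev -[1+ m ] = -[1+ suc m ]

next-prev : ∀ k → next (prev k) ≡ k
next-prev (+ zero) = ≡.refl
next-prev (+ suc m) = ≡.refl
next-prev -[1+ m ] = ≡.refl

prev-next : ∀ k → prev (next k) ≡ k
prev-next (+ m) = ≡.refl
prev-next -[1+ zero ] = ≡.refl
prev-next -[1+ suc m ] = ≡.refl

next-⊖ : ∀ h c → next (h ℤ.⊖ suc c) ≡ h ℤ.⊖ c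
next-⊖ zero zero = ≡.refl
next-⊖ zero (suc c) = ≡.refl
next-⊖ (suc h) zero = ≡.refl
next-⊖ (suc h) (suc c) = ≡.trans (cong next (ℤP.[1+m]⊖[1+n]≡m⊖n h (suc c))) (≡.trans (next-⊖ h c) (≡.sym (ℤP.[1+m]⊖[1+n]≡m⊖n h c)))

module Sequences {c ℓ : Level} (R : CommutativeRing c ℓ) where
  open RingPart R hiding (zero)
  open SumsAndDeterminants R
  open import Relation.Binary.Reasoning.Setoid setoid
  open import Algebra.Solver.Ring.NaturalCoefficients.Default commutativeSemiring using (solve; _:=_; _:+_; _:*_; con)

  Recurrent : Carrier → (ℤ → Carrier) → Set ℓ
  Recurrent t f = ∀ k → f (next k) + f (prev k) ≈ t * f k

  +-cancelʳ : ∀ {x y} z → x + z ≈ y + z → x ≈ y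
  +-cancelʳ {x} {y} z e = begin
    x ≈⟨ sym (+-identityʳ x) ⟩
    x + 0# ≈⟨ +-congˡ (sym (-‿inverseʳ z)) ⟩
    x + (z - z) ≈⟨ sym (+-assoc x z (- z)) ⟩
    (x + z) - z ≈⟨ +-congʳ e ⟩
    (y + z) - z ≈⟨ +-assoc y z (- z) ⟩
    y + (z - z) ≈⟨ +-congˡ (-‿inverseʳ z) ⟩
    y + 0# ≈⟨ +-identityʳ y ⟩
    y ∎

  Recurrent-unique : ∀ {t f g} → Recurrent t f → Recurrent t g → f (+ 0) ≈ g (+ 0) → f -[1+ 0 ] ≈ g -[1+ 0 ] → ∀ k → f k ≈ g k
  Recurrent-unique {t} {f} {g} rf rg e₀ e₋ = λ { (+ m) → proj₁ (up m) ; -[1+ m ] → proj₂ (down m) }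
    where
    forward : ∀ k → f k ≈ g k → f (prev k) ≈ g (prev k) → f (next k) ≈ g (next k)
    forward k e e′ = +-cancelʳ (g (prev k)) (trans (+-congˡ (sym e′)) (trans (rf k) (trans (*-congˡ e) (sym (rg k)))))
    backward : ∀ k → f k ≈ g k → f (next k) ≈ g (next k) → f (prev k) ≈ g (prev k)
    backward k e e′ = +-cancelʳ (g (next k)) (trans (+-congˡ (sym e′)) (trans (+-comm _ _) (trans (rf k) (trans (*-congˡ e) (trans (sym (rg k)) (+-comm _ _))))))
    up : ∀ m → f (+ m) ≈ g (+ m) × f (prev (+ m)) ≈ g (prev (+ m))
    up zero = e₀ , e₋
    up (suc m) = let e , e′ = up m in forward (+ m) e e′ , e
    down : ∀ m → f (next -[1+ m ]) ≈ g (next -[1+ m ]) × f -[1+ m ] ≈ g -[1+ m ]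
    down zero = e₀ , e₋
    down (suc m) = let e , e′ = down m in e′ , backward -[1+ m ] e′ e

  zpow : Carrier → Carrier → ℤ → Carrier
  zpow x y (+ m) = pow x m
  zpow x y -[1+ m ] = pow y (suc m)

  module _ {x y : Carrier} (xy : x * y ≈ 1#) where
    cancel-pair : ∀ z → x * (y * z) ≈ z
    cancel-pair z = trans (sym (*-assoc x y z)) (trans (*-congʳ xy) (*-identityˡ z))

    cancel-pair′ : ∀ z → y * (x * z) ≈ z
    cancel-pair′ z = trans (*-x∙yz≈y∙xz y x z) (cancel-pair z)

    zpow-next : ∀ k → zpow x y (next k) ≈ x * zpow x y k
    zpow-next (+ m) = refl
    zpow-next -[1+ zero ] = sym (cancel-pair 1#)
    zpow-next -[1+ suc m ] = sym (cancel-pair _)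

    zpow-prev : ∀ k → zpow x y (prev k) ≈ y * zpow x y k
    zpow-prev (+ zero) = refl
    zpow-prev (+ suc m) = sym (cancel-pair′ _)
    zpow-prev -[1+ m ] = refl

    zpow-recurrent : ∀ a → Recurrent (x + y) (λ k → a * zpow x y k)
    zpow-recurrent a k = begin
      a * zpow x y (next k) + a * zpow x y (prev k) ≈⟨ +-cong (*-congˡ (zpow-next k)) (*-congˡ (zpow-prev k)) ⟩
      a * (x * zpow x y k) + a * (y * zpow x y k)
        ≈⟨ solve 4 (λ a x y z → a :* (x :* z) :+ a :* (y :* z) := (x :+ y) :* (a :* z)) refl a x y (zpow x y k) ⟩
      (x + y) * (a * zpow x y k) ∎

    zpow-⊖ : ∀ h c → zpow x y (h ℤ.⊖ c) ≈ pow x h * pow y c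
    zpow-⊖ h zero = sym (*-identityʳ _)
    zpow-⊖ zero (suc c) = sym (*-identityˡ _)
    zpow-⊖ (suc h) (suc c) = begin
      zpow x y (suc h ℤ.⊖ suc c) ≈⟨ reflexive (cong (zpow x y) (ℤP.[1+m]⊖[1+n]≡m⊖n h c)) ⟩
      zpow x y (h ℤ.⊖ c) ≈⟨ zpow-⊖ h c ⟩
      pow x h * pow y c ≈⟨ sym (cancel-pair _) ⟩
      x * (y * (pow x h * pow y c)) ≈⟨ solve 4 (λ x y p q → x :* (y :* (p :* q)) := (x :* p) :* (y :* q)) refl x y (pow x h) (pow y c) ⟩
      pow x (suc h) * pow y (suc c) ∎

  Recurrent-+ : ∀ {t f g} → Recurrent t f → Recurrent t g → Recurrent t (λ k → f k + g k)
  Recurrent-+ {t} {f} {g} rf rg k = trans (+-interchange _ _ _ _) (trans (+-cong (rf k) (rg k)) (sym (distribˡ t (f k) (g k))))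

  Recurrent-* : ∀ {t f} a → Recurrent t f → Recurrent t (λ k → a * f k)
  Recurrent-* {t} {f} a rf k = trans (sym (distribˡ a _ _)) (trans (*-congˡ (rf k)) (*-x∙yz≈y∙xz a t (f k)))

  Recurrent-next : ∀ {t f} → Recurrent t f → Recurrent t (λ k → f (next k))
  Recurrent-next {t} {f} rf k = trans (+-congˡ (reflexive (cong f (≡.trans (next-prev k) (≡.sym (prev-next k)))))) (rf (next k))

  -- Functions on ℕ stand for power series in z by their coefficients; `shift` is multiplication by
  -- z.
  shift : (ℕ → Carrier) → ℕ → Carrier
  shift f zero = 0#
  shift f (suc m) = f m

  shifts : ℕ → (ℕ → Carrier) → ℕ → Carrier
  shifts zero f = f
  shifts (suc i) f = shift (shifts i f)

  newtonPoly : (ℕ → Carrier) → Carrier → ℕ → Carrier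
  newtonPoly v t zero = 1#
  newtonPoly v t (suc k) = newtonPoly v t k * (t - v k)

  newtonPoly-first : ∀ v t k → newtonPoly v t (suc k) ≈ (t - v 0) * newtonPoly (v ∘ suc) t k
  newtonPoly-first v t zero = *-comm _ _
  newtonPoly-first v t (suc k) = trans (*-congʳ (newtonPoly-first v t k)) (*-assoc _ _ _)

  newtonPoly-root : ∀ v {t i} k → t ≈ v i → i ℕ.< k → newtonPoly v t k ≈ 0#
  newtonPoly-root v {t} {i} (suc k) e (ℕ.s≤s i≤k) with ℕP.m≤n⇒m<n∨m≡n i≤k
  ... | inj₁ i<k = trans (*-congʳ (newtonPoly-root v k e i<k)) (zeroˡ _)
  ... | inj₂ ≡.refl = trans (*-congˡ (trans (+-congʳ e) (-‿inverseʳ _))) (zeroʳ _)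

  ∏<-suc : {n : ℕ} (f : Fin (suc n) → Fin (suc n) → Carrier) →
    ∏< f ≈ ∏ (λ j → f Fin.zero (Fin.suc j)) * ∏< (λ i j → f (Fin.suc i) (Fin.suc j))
  ∏<-suc {n} f = trans (reflexive (cong (λ l → ΠL l (λ p → f (proj₁ p) (proj₂ p))) (ordPairs-suc n)))
    (trans (ΠL-++ (List.map (λ j → Fin.zero , Fin.suc j) (allFin n)) _ _) (*-cong (ΠL-map _ (allFin n) _) (ΠL-map _ (ordPairs n) _)))

  -- `newtonPoly-first` takes the factor with `v 0` out of each later polynomial; together these
  -- factors are the pairs with first index 0.
  ∏-newtonPoly : ∀ n v → ∏ {n} (λ i → newtonPoly v (v (toℕ i)) (toℕ i)) ≈ ∏< {n} (λ i j → v (toℕ j) - v (toℕ i))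
  ∏-newtonPoly zero v = refl
  ∏-newtonPoly (suc n) v = begin
    ∏ (λ (i : Fin (suc n)) → newtonPoly v (v (toℕ i)) (toℕ i)) ≈⟨ ∏-suc (λ (i : Fin (suc n)) → newtonPoly v (v (toℕ i)) (toℕ i)) ⟩
    1# * ∏ (λ (i : Fin n) → newtonPoly v (v (suc (toℕ i))) (suc (toℕ i))) ≈⟨ *-identityˡ _ ⟩
    ∏ (λ (i : Fin n) → newtonPoly v (v (suc (toℕ i))) (suc (toℕ i))) ≈⟨ ∏-cong (λ (i : Fin n) → newtonPoly-first v (v (suc (toℕ i))) (toℕ i)) ⟩
    ∏ (λ (i : Fin n) → (v (suc (toℕ i)) - v 0) * newtonPoly (v ∘ suc) (v (suc (toℕ i))) (toℕ i)) ≈⟨ ∏-* (λ (i : Fin n) → v (suc (toℕ i)) - v 0) _ ⟩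
    ∏ (λ (i : Fin n) → v (suc (toℕ i)) - v 0) * ∏ (λ (i : Fin n) → newtonPoly (v ∘ suc) (v (suc (toℕ i))) (toℕ i)) ≈⟨ *-congˡ (∏-newtonPoly n (v ∘ suc)) ⟩
    ∏ (λ (i : Fin n) → v (suc (toℕ i)) - v 0) * ∏< (λ (i j : Fin n) → v (suc (toℕ j)) - v (suc (toℕ i))) ≈⟨ sym (∏<-suc (λ (i j : Fin (suc n)) → v (toℕ j) - v (toℕ i))) ⟩
    ∏< (λ (i j : Fin (suc n)) → v (toℕ j) - v (toℕ i)) ∎

  module SideWeights (x : ℕ → Carrier) where
    -- complete homogeneous polynomial of degree r in x 0, …, x d
    h : ℕ → ℕ → Carrier
    h zero zero = 1#
    h zero (suc r) = x 0 * h 0 r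
    h (suc d) zero = h d 0
    h (suc d) (suc r) = h d (suc r) + x (suc d) * h (suc d) r

    h-degree-0 : ∀ d → h d 0 ≈ 1#
    h-degree-0 zero = refl
    h-degree-0 (suc d) = h-degree-0 d

    -- h before the variables x (2i), x (2i+1) are added
    hBefore : ℕ → ℕ → Carrier
    hBefore zero zero = 1#
    hBefore zero (suc r) = 0#
    hBefore (suc i) r = h (suc (double i)) r

    h-even : ∀ i r → h (double i) r ≈ hBefore i r + x (double i) * shift (h (double i)) r
    h-even zero zero = sym (trans (+-congˡ (zeroʳ _)) (+-identityʳ _))
    h-even zero (suc r) = sym (+-identityˡ _)
    h-even (suc i) zero = sym (trans (+-congˡ (zeroʳ _)) (+-identityʳ _))
    h-even (suc i) (suc r) = refl

    h-odd : ∀ d r → h (suc d) r ≈ h d r + x (suc d) * shift (h (suc d)) r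
    h-odd d zero = sym (trans (+-congˡ (zeroʳ _)) (+-identityʳ _))
    h-odd d (suc r) = refl

    module _ (i : ℕ) (inverse : x (double i) * x (suc (double i)) ≈ 1#) where
      private
        A : ℕ → Carrier
        A = h (suc (double i))
        X Y : Carrier
        X = x (double i)
        Y = x (suc (double i))

      -- Coefficient form of (1 - X z) (1 - Y z) A = B with X Y = 1, where A and B are the series of
      -- `h` with and without the two variables X and Y.
      h-quadratic : ∀ r → A r + shift (shift A) r ≈ (X + Y) * shift A r + hBefore i r
      h-quadratic r = begin
        A r + shift (shift A) r ≈⟨ +-congʳ (trans (h-odd (double i) r) (+-congʳ (h-even i r))) ⟩
        hBefore i r + X * shift (h (double i)) r + Y * shift A r + shift (shift A) r ≈⟨ +-congˡ (sym XY) ⟩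
        hBefore i r + X * shift (h (double i)) r + Y * shift A r + X * (Y * shift (shift A) r)
          ≈⟨ solve 6 (λ b X Y p q s → ((b :+ X :* p) :+ Y :* q) :+ X :* (Y :* s) := X :* (p :+ Y :* s) :+ (Y :* q :+ b)) refl
               (hBefore i r) X Y (shift (h (double i)) r) (shift A r) (shift (shift A) r) ⟩
        X * (shift (h (double i)) r + Y * shift (shift A) r) + (Y * shift A r + hBefore i r) ≈⟨ +-congʳ (*-congˡ (sym (shifted r))) ⟩
        X * shift A r + (Y * shift A r + hBefore i r)
          ≈⟨ solve 4 (λ X Y a b → X :* a :+ (Y :* a :+ b) := (X :+ Y) :* a :+ b) refl X Y (shift A r) (hBefore i r) ⟩
        (X + Y) * shift A r + hBefore i r ∎
        where
        XY : X * (Y * shift (shift A) r) ≈ shift (shift A) r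
        XY = cancel-pair inverse _
        shifted : ∀ r → shift A r ≈ shift (h (double i)) r + Y * shift (shift A) r
        shifted zero = sym (trans (+-identityˡ _) (zeroʳ _))
        shifted (suc r) = h-odd (double i) r

      h-quadratic-shifts : ∀ k r → shifts k A r + shift (shift (shifts k A)) r ≈ (X + Y) * shift (shifts k A) r + shifts k (hBefore i) r
      h-quadratic-shifts zero r = h-quadratic r
      h-quadratic-shifts (suc k) zero = trans (+-identityˡ _) (sym (trans (+-identityʳ _) (zeroʳ _)))
      h-quadratic-shifts (suc k) (suc r) = h-quadratic-shifts k r

    -- The coefficient of z^m in S_i, for which 2 i variables enter `h`. The value 0 for i = 0 makes
    -- the recurrence true already for S_1.
    H : ℕ → ℕ → Carrier
    H zero m = 0#
    H (suc i) m = shifts (suc i) (h (suc (double i))) m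

    H-0 : ∀ k → H k 0 ≈ 0#
    H-0 zero = refl
    H-0 (suc k) = refl

    H-1-1 : H 1 1 ≈ 1#
    H-1-1 = h-degree-0 1

    -- S_(i+1) carries one power of z more than S_i, so the coefficient m + 2 on the left meets the
    -- coefficient m + 1 of S_i.
    H-recurrence : ∀ i → x (double i) * x (suc (double i)) ≈ 1# → ∀ m →
      H (suc i) (suc (suc m)) + H (suc i) m ≈ (x (double i) + x (suc (double i))) * H (suc i) (suc m) + H i (suc m)
    H-recurrence zero inv m = h-quadratic-shifts zero inv zero (suc m)
    H-recurrence (suc i) inv m = h-quadratic-shifts (suc i) inv (suc i) (suc m)

    signed : ℕ → ℤ → Carrier
    signed k (+ m) = H k m
    signed k -[1+ m ] = - H k (suc m)

    -- The odd extension makes the relation hold on all of ℤ: at k = 0 the left side cancels by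
    -- oddness, and k < 0 mirrors k > 0.
    signed-recurrence : ∀ i → x (double i) * x (suc (double i)) ≈ 1# → ∀ k →
      signed (suc i) (next k) + signed (suc i) (prev k) ≈ (x (double i) + x (suc (double i))) * signed (suc i) k + signed i k
    signed-recurrence i inv (+ zero) = trans (-‿inverseʳ _) (sym (trans (+-cong (zeroʳ _) (H-0 i)) (+-identityʳ _)))
    signed-recurrence i inv (+ suc m) = H-recurrence i inv m
    signed-recurrence i inv -[1+ m ] = begin
      signed (suc i) (next -[1+ m ]) + - H (suc i) (suc (suc m)) ≈⟨ +-congʳ (lower m) ⟩
      - H (suc i) m + - H (suc i) (suc (suc m)) ≈⟨ trans (-‿+-comm _ _) (-‿cong (+-comm _ _)) ⟩
      - (H (suc i) (suc (suc m)) + H (suc i) m) ≈⟨ -‿cong (H-recurrence i inv m) ⟩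
      - ((x (double i) + x (suc (double i))) * H (suc i) (suc m) + H i (suc m)) ≈⟨ sym (-‿+-comm _ _) ⟩
      - ((x (double i) + x (suc (double i))) * H (suc i) (suc m)) + - H i (suc m) ≈⟨ +-congʳ (-‿distribʳ-* _ _) ⟩
      (x (double i) + x (suc (double i))) * - H (suc i) (suc m) + - H i (suc m) ∎
      where
      lower : ∀ m → signed (suc i) (next -[1+ m ]) ≈ - H (suc i) m
      lower zero = sym -0#≈0#
      lower (suc m) = refl

    module Newton {n : ℕ} (inverse : ∀ (p : Fin n) → x (double (toℕ p)) * x (suc (double (toℕ p))) ≈ 1#) (t : Carrier) where
      u : ℕ → Carrier
      u i = x (double i) + x (suc (double i))

      newton : ℕ → Carrier
      newton = newtonPoly u t

      G : ℤ → Carrier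
      G k = ΣL (allFin n) (λ p → newton (toℕ p) * signed (suc (toℕ p)) k)

      telescope : ∀ {m} (a : ℕ → Carrier) → ΣL (allFin m) (λ p → a (suc (toℕ p))) + a 0 ≈ ΣL (allFin m) (λ p → a (toℕ p)) + a m
      telescope {zero} a = refl
      telescope {suc m} a = begin
        ΣL (allFin (suc m)) (λ p → a (suc (toℕ p))) + a 0 ≈⟨ +-congʳ (Σ-suc (λ (p : Fin (suc m)) → a (suc (toℕ p)))) ⟩
        a 1 + ΣL (allFin m) (λ p → a (suc (suc (toℕ p)))) + a 0 ≈⟨ +-congʳ (trans (+-comm _ _) (telescope {m} (a ∘ suc))) ⟩
        ΣL (allFin m) (λ p → a (suc (toℕ p))) + a (suc m) + a 0
          ≈⟨ solve 3 (λ p q r → (p :+ q) :+ r := (r :+ p) :+ q) refl (ΣL (allFin m) (λ p → a (suc (toℕ p)))) (a (suc m)) (a 0) ⟩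
        a 0 + ΣL (allFin m) (λ p → a (suc (toℕ p))) + a (suc m) ≈⟨ +-congʳ (sym (Σ-suc (λ (p : Fin (suc m)) → a (toℕ p)))) ⟩
        ΣL (allFin (suc m)) (λ p → a (toℕ p)) + a (suc m) ∎

      -- With a j = newton j S_j(k), adding a (p + 1) = newton p (t - u_p) S_(p+1)(k) to the p-th
      -- summand replaces u_p by t and leaves a p. The sums of a (p + 1) and of a p agree, since a 0
      -- = 0 and, t being a root, a n = 0.
      G-recurrent : newton n ≈ 0# → Recurrent t G
      G-recurrent root k = +-cancelʳ (ΣL (allFin n) (λ p → a (suc (toℕ p)))) (begin
        G (next k) + G (prev k) + Σa⁺ ≈⟨ +-congʳ (sym (ΣL-+ (allFin n) _ _)) ⟩
        ΣL (allFin n) (λ p → newton (toℕ p) * signed (suc (toℕ p)) (next k) + newton (toℕ p) * signed (suc (toℕ p)) (prev k)) + Σa⁺ ≈⟨ sym (ΣL-+ (allFin n) _ _) ⟩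
        ΣL (allFin n) (λ p → newton (toℕ p) * signed (suc (toℕ p)) (next k) + newton (toℕ p) * signed (suc (toℕ p)) (prev k) + a (suc (toℕ p)))
          ≈⟨ ΣL-cong (allFin n) (λ {p} _ → step p) ⟩
        ΣL (allFin n) (λ p → t * (newton (toℕ p) * signed (suc (toℕ p)) k) + a (toℕ p)) ≈⟨ ΣL-+ (allFin n) _ _ ⟩
        ΣL (allFin n) (λ p → t * (newton (toℕ p) * signed (suc (toℕ p)) k)) + ΣL (allFin n) (λ p → a (toℕ p)) ≈⟨ +-cong (ΣL-*ˡ (allFin n) t _) flat ⟩
        t * G k + Σa⁺ ∎)
        where
        a : ℕ → Carrier
        a j = newton j * signed j k
        Σa⁺ : Carrier
        Σa⁺ = ΣL (allFin n) (λ p → a (suc (toℕ p)))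
        a-0 : a 0 ≈ 0#
        a-0 = trans (*-identityˡ _) (signed-0 k)
          where
          signed-0 : ∀ k → signed 0 k ≈ 0#
          signed-0 (+ m) = refl
          signed-0 -[1+ m ] = -0#≈0#
        flat : ΣL (allFin n) (λ p → a (toℕ p)) ≈ Σa⁺
        flat = trans (sym (+-identityʳ _)) (trans (+-congˡ (sym (trans (*-congʳ root) (zeroˡ _)))) (trans (sym (telescope {n} a)) (trans (+-congˡ a-0) (+-identityʳ _))))
        step : ∀ p → newton (toℕ p) * signed (suc (toℕ p)) (next k) + newton (toℕ p) * signed (suc (toℕ p)) (prev k) + a (suc (toℕ p))
          ≈ t * (newton (toℕ p) * signed (suc (toℕ p)) k) + a (toℕ p)
        step p = begin
          N * S (next k) + N * S (prev k) + N * (t - U) * S k ≈⟨ +-congʳ (trans (sym (distribˡ N _ _)) (*-congˡ (signed-recurrence i (inverse p) k))) ⟩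
          N * (U * S k + signed i k) + N * (t - U) * S k
            ≈⟨ solve 5 (λ N U s z d → N :* (U :* s :+ z) :+ (N :* d) :* s := (d :+ U) :* (N :* s) :+ N :* z) refl N U (S k) (signed i k) (t - U) ⟩
          ((t - U) + U) * (N * S k) + N * signed i k ≈⟨ +-congʳ (*-congʳ (trans (+-assoc t (- U) U) (trans (+-congˡ (-‿inverseˡ U)) (+-identityʳ t)))) ⟩
          t * (N * S k) + N * signed i k ∎
          where
          i : ℕ
          i = toℕ p
          N U : Carrier
          N = newton i
          U = u i
          S : ℤ → Carrier
          S = signed (suc i)

      private
        only-first : ∀ k → (∀ i → signed (suc (suc i)) k ≈ 0#) → 1 ℕ.≤ n → G k ≈ signed 1 k
        only-first k z 1≤n = first n 1≤n
          where
          first : ∀ m → 1 ℕ.≤ m → ΣL (allFin m) (λ p → newton (toℕ p) * signed (suc (toℕ p)) k) ≈ signed 1 k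
          first (suc m) _ = trans (Σ-suc (λ (p : Fin (suc m)) → newton (toℕ p) * signed (suc (toℕ p)) k))
            (trans (+-cong (*-identityˡ _) (ΣL-zero (allFin m) (λ {p} _ → trans (*-congˡ (z (toℕ p))) (zeroʳ _)))) (+-identityʳ _))

      G-0 : 1 ℕ.≤ n → G (+ 0) ≈ 0#
      G-0 = only-first (+ 0) (λ _ → refl)

      G-1 : 1 ℕ.≤ n → G (+ 1) ≈ 1#
      G-1 1≤n = trans (only-first (+ 1) (λ _ → refl) 1≤n) H-1-1

      G-−1 : 1 ℕ.≤ n → G -[1+ 0 ] ≈ - 1#
      G-−1 1≤n = trans (only-first -[1+ 0 ] (λ _ → -0#≈0#) 1≤n) (-‿cong H-1-1)

      module _ {X Y : Carrier} (XY : X * Y ≈ 1#) (t≈ : t ≈ X + Y) (root : newton n ≈ 0#) (1≤n : 1 ℕ.≤ n) where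
        private
          G-rec : Recurrent (X + Y) G
          G-rec k = trans (G-recurrent root k) (*-congʳ t≈)
          YX : Y * X ≈ 1#
          YX = trans (*-comm Y X) XY
          Recurrent-sym : ∀ {f} → Recurrent (Y + X) f → Recurrent (X + Y) f
          Recurrent-sym r k = trans (r k) (*-congʳ (+-comm Y X))

          powers-recurrent : ∀ b → Recurrent (X + Y) (λ k → 1# * zpow X Y k + b * zpow Y X k)
          powers-recurrent b = Recurrent-+ (zpow-recurrent XY 1#) (Recurrent-sym (zpow-recurrent YX b))

        -- Both sides satisfy the same second-order recurrence, so the values at 0 and -1 decide.
        -- The right side is kept in the form 1 X^k + b Y^k, with b = -1 here and b = -Y in
        -- `G-even`, so that one computation with powers serves both.
        G-odd : ∀ k → (X - Y) * G k ≈ 1# * zpow X Y k + - 1# * zpow Y X k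
        G-odd = Recurrent-unique (Recurrent-* (X - Y) G-rec) (powers-recurrent (- 1#)) at-0 at-−1
          where
          at-0 : (X - Y) * G (+ 0) ≈ 1# * 1# + - 1# * 1#
          at-0 = begin
            (X - Y) * G (+ 0) ≈⟨ *-congˡ (G-0 1≤n) ⟩
            (X - Y) * 0# ≈⟨ zeroʳ _ ⟩
            0# ≈⟨ sym (-‿inverseʳ 1#) ⟩
            1# - 1# ≈⟨ sym (+-cong (*-identityʳ _) (*-identityʳ _)) ⟩
            1# * 1# + - 1# * 1# ∎
          at-−1 : (X - Y) * G -[1+ 0 ] ≈ 1# * (Y * 1#) + - 1# * (X * 1#)
          at-−1 = begin
            (X - Y) * G -[1+ 0 ] ≈⟨ *-congˡ (G-−1 1≤n) ⟩
            (X - Y) * - 1# ≈⟨ trans (*-comm _ _) (-1*x≈-x _) ⟩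
            - (X - Y) ≈⟨ sym (-‿+-comm X (- Y)) ⟩
            - X + - - Y ≈⟨ trans (+-comm _ _) (+-congʳ (-‿involutive Y)) ⟩
            Y - X ≈⟨ +-cong (sym (trans (*-identityˡ _) (*-identityʳ Y))) (sym (trans (-1*x≈-x _) (-‿cong (*-identityʳ X)))) ⟩
            1# * (Y * 1#) + - 1# * (X * 1#) ∎

        G-even : ∀ k → (1# - Y) * (G k + G (next k)) ≈ 1# * zpow X Y k + - Y * zpow Y X k
        G-even = Recurrent-unique (Recurrent-* (1# - Y) (Recurrent-+ G-rec (Recurrent-next G-rec))) (powers-recurrent (- Y)) at-0 at-−1
          where
          at-0 : (1# - Y) * (G (+ 0) + G (+ 1)) ≈ 1# * 1# + - Y * 1#
          at-0 = begin
            (1# - Y) * (G (+ 0) + G (+ 1)) ≈⟨ *-congˡ (trans (+-cong (G-0 1≤n) (G-1 1≤n)) (+-identityˡ 1#)) ⟩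
            (1# - Y) * 1# ≈⟨ distribʳ 1# 1# (- Y) ⟩
            1# * 1# + - Y * 1# ∎
          at-−1 : (1# - Y) * (G -[1+ 0 ] + G (+ 0)) ≈ 1# * (Y * 1#) + - Y * (X * 1#)
          at-−1 = begin
            (1# - Y) * (G -[1+ 0 ] + G (+ 0)) ≈⟨ *-congˡ (trans (+-cong (G-−1 1≤n) (G-0 1≤n)) (+-identityʳ _)) ⟩
            (1# - Y) * - 1# ≈⟨ trans (*-comm _ _) (-1*x≈-x _) ⟩
            - (1# - Y) ≈⟨ sym (-‿+-comm 1# (- Y)) ⟩
            - 1# + - - Y ≈⟨ trans (+-comm _ _) (+-congʳ (-‿involutive Y)) ⟩
            Y - 1# ≈⟨ +-cong (sym (trans (*-identityˡ _) (*-identityʳ Y))) (-‿cong (sym (trans (*-congˡ (*-identityʳ X)) YX))) ⟩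
            1# * (Y * 1#) + - (Y * (X * 1#)) ≈⟨ +-congˡ (-‿distribˡ-* _ _) ⟩
            1# * (Y * 1#) + - Y * (X * 1#) ∎

-- Sums over admissible paths

ups sides : List Bool → ℕ
ups [] = 0
ups (true ∷ bs) = suc (ups bs)
ups (false ∷ bs) = ups bs
sides [] = 0
sides (true ∷ bs) = sides bs
sides (false ∷ bs) = suc (sides bs)

ups+sides : ∀ bs → ups bs ℕ.+ sides bs ≡ length bs
ups+sides [] = ≡.refl
ups+sides (true ∷ bs) = cong suc (ups+sides bs)
ups+sides (false ∷ bs) = ≡.trans (ℕP.+-suc (ups bs) (sides bs)) (cong suc (ups+sides bs))

-- Provides one segment with prescribed counts; `init-length`, applied to it, yields the bound under
-- which the enumeration contains all segments with these counts.
with-counts : ∀ d r → ∃ λ bs → ups bs ≡ d × sides bs ≡ r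
with-counts zero zero = [] , ≡.refl , ≡.refl
with-counts zero (suc r) = let bs , u , s = with-counts zero r in false ∷ bs , u , cong suc s
with-counts (suc d) r = let bs , u , s = with-counts d r in true ∷ bs , cong suc u , s

endOf-counts : ∀ {g} → Additive g → ∀ f q bs →
  g (endOf f q bs) ≡ g q ℤ.+ + ups bs ℤ.* g (f true) ℤ.+ + sides bs ℤ.* g (f false)
endOf-counts {g} ag f q [] = solve 3 (λ q t s → q := (q :+ con (+ 0) :* t) :+ con (+ 0) :* s) ≡.refl (g q) (g (f true)) (g (f false))
  where open +-*-Solver
endOf-counts {g} ag f q (true ∷ bs) = ≡.trans (endOf-counts ag f (q ⊕ f true) bs)
  (≡.trans (cong (λ z → z ℤ.+ + ups bs ℤ.* g (f true) ℤ.+ + sides bs ℤ.* g (f false)) (add ag q (f true)))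
    (solve 5 (λ q t s u v → ((q :+ t) :+ u :* t) :+ v :* s := (q :+ (con (+ 1) :+ u) :* t) :+ v :* s) ≡.refl (g q) (g (f true)) (g (f false)) (+ ups bs) (+ sides bs)))
  where open +-*-Solver
endOf-counts {g} ag f q (false ∷ bs) = ≡.trans (endOf-counts ag f (q ⊕ f false) bs)
  (≡.trans (cong (λ z → z ℤ.+ + ups bs ℤ.* g (f true) ℤ.+ + sides bs ℤ.* g (f false)) (add ag q (f false)))
    (solve 5 (λ q t s u v → ((q :+ s) :+ u :* t) :+ v :* s := (q :+ u :* t) :+ (con (+ 1) :+ v) :* s) ≡.refl (g q) (g (f true)) (g (f false)) (+ ups bs) (+ sides bs)))
  where open +-*-Solver

double≡+ : ∀ i → double i ≡ i ℕ.+ i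
double≡+ zero = ≡.refl
double≡+ (suc i) = cong suc (≡.trans (cong suc (double≡+ i)) (≡.sym (ℕP.+-suc i i)))

double/2 : ∀ i → double i ℕ./ 2 ≡ i
double/2 i = ≡.trans (cong (ℕ._/ 2) (≡.trans (double≡+ i) (≡.trans (cong (i ℕ.+_) (≡.sym (ℕP.+-identityʳ i))) (ℕP.*-comm 2 i)))) (DM.m*n/n≡m i 2)

turn-diag-counts : ∀ i s ini fn → diagSum (turnPt (suc i) (mkPath s ini fn)) ≡ (+ ups ini ℤ.+ + ups ini) ℤ.- (+ suc (double i) ℤ.+ + suc (double i))
turn-diag-counts i s ini fn = ≡.trans (endOf-counts diagSum-additive (initStep s) (startPt (suc i) s) ini) (≡.trans (steps s)
    (≡.trans (cong (λ z → z ℤ.+ + ups ini ℤ.* + 2) (diagSum-startPt (suc i) s))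
      (≡.trans (solve 2 (λ i u → (con (+ 2) :- con (+ 4) :* (con (+ 1) :+ i)) :+ u :* con (+ 2) := (u :+ u) :- ((con (+ 1) :+ (i :+ i)) :+ (con (+ 1) :+ (i :+ i)))) ≡.refl (+ i) (+ ups ini))
        (cong (λ z → (+ ups ini ℤ.+ + ups ini) ℤ.- (+ suc z ℤ.+ + suc z)) (≡.sym (double≡+ i))))))
  where
  open +-*-Solver
  steps : ∀ s → diagSum (startPt (suc i) s) ℤ.+ + ups ini ℤ.* diagSum (initStep s true) ℤ.+ + sides ini ℤ.* diagSum (initStep s false)
    ≡ diagSum (startPt (suc i) s) ℤ.+ + ups ini ℤ.* + 2
  steps α = solve 3 (λ d u v → (d :+ u :* con (+ 2)) :+ v :* con (+ 0) := d :+ u :* con (+ 2)) ≡.refl (diagSum (startPt (suc i) α)) (+ ups ini) (+ sides ini)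
  steps β = solve 3 (λ d u v → (d :+ u :* con (+ 2)) :+ v :* con (+ 0) := d :+ u :* con (+ 2)) ≡.refl (diagSum (startPt (suc i) β)) (+ ups ini) (+ sides ini)

-- The turning point (∓m, ±m) from which h horizontal steps lead to abscissa x has m = offset s h x.
offset : Start → ℕ → ℤ → ℤ
offset α h x = + h ℤ.- x
offset β h x = x ℤ.- + h

offset-counts : ∀ i s ini fn → ups ini ≡ suc (double i) →
  offset s (ups fn) (proj₁ (endOf finStep (turnPt (suc i) (mkPath s ini fn)) fn)) ≡ + (suc i ℕ.+ sides ini)
offset-counts i s ini fn u = ≡.trans (cong (offset s (ups fn)) x-end) (final s)
  where
  open +-*-Solver
  x-turn : ℤ
  x-turn = proj₁ (turnPt (suc i) (mkPath s ini fn))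
  x-end : proj₁ (endOf finStep (turnPt (suc i) (mkPath s ini fn)) fn) ≡
    proj₁ (startPt (suc i) s) ℤ.+ + suc (i ℕ.+ i) ℤ.* proj₁ (initStep s true) ℤ.+ + sides ini ℤ.* proj₁ (initStep s false) ℤ.+ + ups fn
  x-end = ≡.trans (endOf-counts x-additive finStep (turnPt (suc i) (mkPath s ini fn)) fn)
    (≡.trans (solve 3 (λ x u v → (x :+ u :* con (+ 1)) :+ v :* con (+ 0) := x :+ u) ≡.refl x-turn (+ ups fn) (+ sides fn))
      (cong (ℤ._+ + ups fn) (≡.trans (endOf-counts x-additive (initStep s) (startPt (suc i) s) ini)
        (cong (λ k → proj₁ (startPt (suc i) s) ℤ.+ + k ℤ.* proj₁ (initStep s true) ℤ.+ + sides ini ℤ.* proj₁ (initStep s false)) (≡.trans u (cong suc (double≡+ i)))))))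
  final : ∀ s → offset s (ups fn) (proj₁ (startPt (suc i) s) ℤ.+ + suc (i ℕ.+ i) ℤ.* proj₁ (initStep s true) ℤ.+ + sides ini ℤ.* proj₁ (initStep s false) ℤ.+ + ups fn)
    ≡ + (suc i ℕ.+ sides ini)
  final α = ≡.trans (cong (λ z → + ups fn ℤ.- (+ 1 ℤ.- z ℤ.+ + suc (i ℕ.+ i) ℤ.* + 1 ℤ.+ + sides ini ℤ.* (ℤ.- + 1) ℤ.+ + ups fn)) (ℤP.pos-* 3 (suc i)))
    (solve 3 (λ i r h → h :- ((((con (+ 1) :- con (+ 3) :* (con (+ 1) :+ i)) :+ (con (+ 1) :+ (i :+ i)) :* con (+ 1)) :+ r :* (:- con (+ 1))) :+ h) := (con (+ 1) :+ i) :+ r) ≡.refl (+ i) (+ sides ini) (+ ups fn))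
  final β = solve 3 (λ i r h → ((((con (+ 1) :- (con (+ 1) :+ i)) :+ (con (+ 1) :+ (i :+ i)) :* con (+ 1)) :+ r :* con (+ 1)) :+ h) :- h := (con (+ 1) :+ i) :+ r) ≡.refl (+ i) (+ sides ini) (+ ups fn)

offset-injective : ∀ s h {x y} → offset s h x ≡ offset s h y → x ≡ y
offset-injective s h {x} {y} e = ≡.trans (recover s x) (≡.trans (cong (unoffset s) e) (≡.sym (recover s y)))
  where
  open +-*-Solver
  unoffset : Start → ℤ → ℤ
  unoffset α z = + h ℤ.- z
  unoffset β z = z ℤ.+ + h
  recover : ∀ s x → x ≡ unoffset s (offset s h x)
  recover α x = solve 2 (λ h x → x := h :- (h :- x)) ≡.refl (+ h) x
  recover β x = solve 2 (λ h x → x := (x :- h) :+ h) ≡.refl (+ h) x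

-- The start with 0-based index i has x + y = -2 (2 i + 1), so 2 i + 1 diagonal steps lead to the
-- line x + y = 0, and r side steps lead to a turning point with coordinates of size i + 1 + r.
-- Admissibility thus becomes a condition on step counts.
adm-counts⁻ : ∀ {i s ini fn e} → Adm (suc i) (mkPath s ini fn) e →
  ups ini ≡ suc (double i) × offset s (ups fn) (proj₁ e) ≡ + (suc i ℕ.+ sides ini)
adm-counts⁻ {i} {s} {ini} {fn} {e} ad = u , ≡.trans (cong (offset s (ups fn) ∘ proj₁) (≡.sym (end-pt ad))) (offset-counts i s ini fn u)
  where
  u : ups ini ≡ suc (double i)
  u = ℤP.+-injective (double-injective (ℤP.i-j≡0⇒i≡j (+ ups ini ℤ.+ + ups ini) (+ suc (double i) ℤ.+ + suc (double i)) (≡.trans (≡.sym (turn-diag-counts i s ini fn)) (turn-diag ad))))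

adm-counts⁺ : ∀ {i s ini fn e} → diagSum e ≡ + length fn → ups ini ≡ suc (double i) →
  offset s (ups fn) (proj₁ e) ≡ + (suc i ℕ.+ sides ini) → Adm (suc i) (mkPath s ini fn) e
adm-counts⁺ {i} {s} {ini} {fn} {e} d u o = mkAdm diag-0 (pt-≡ diag-end (offset-injective s (ups fn) (≡.trans (offset-counts i s ini fn u) (≡.sym o))))
  where
  diag-0 : diagSum (turnPt (suc i) (mkPath s ini fn)) ≡ + 0
  diag-0 = ≡.trans (turn-diag-counts i s ini fn) (≡.trans (cong (λ k → (+ k ℤ.+ + k) ℤ.- (+ suc (double i) ℤ.+ + suc (double i))) u) (ℤP.+-inverseʳ (+ suc (double i) ℤ.+ + suc (double i))))
  diag-end : diagSum (endOf finStep (turnPt (suc i) (mkPath s ini fn)) fn) ≡ diagSum e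
  diag-end = ≡.trans (endOf-unit-steps diagSum-additive diagSum-finStep (turnPt (suc i) (mkPath s ini fn)) fn)
    (≡.trans (cong (ℤ._+ + length fn) diag-0) (≡.trans (ℤP.+-identityˡ _) (≡.sym d)))

bool-iff : ∀ {a b : Bool} → (a ≡ true → b ≡ true) → (b ≡ true → a ≡ true) → a ≡ b
bool-iff {true} {true} f g = ≡.refl
bool-iff {true} {false} f g = ≡.sym (f ≡.refl)
bool-iff {false} {true} f g = g ≡.refl
bool-iff {false} {false} f g = ≡.refl

≡ᵇ-true⁺ : ∀ {m n} → m ≡ n → (m ℕ.≡ᵇ n) ≡ true
≡ᵇ-true⁺ {m} {n} e with m ℕ.≡ᵇ n | ℕP.≡⇒≡ᵇ m n e
... | true | _ = ≡.refl

≡ᵇ-true⁻ : ∀ {m n} → (m ℕ.≡ᵇ n) ≡ true → m ≡ n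
≡ᵇ-true⁻ {m} {n} e = ℕP.≡ᵇ⇒≡ m n (subst Bool.T (≡.sym e) _)

module PathSums {c ℓ : Level} (R : CommutativeRing c ℓ) {n : ℕ} (X Xinv : Fin n → RingPart.Carrier R) where
  open RingPart R hiding (zero)
  open SumsAndDeterminants R
  open Sequences R
  open import Relation.Binary.Reasoning.Setoid setoid

  -- The variable attached to the line x + y = -2d. The lines d = 2q and d = 2q + 1 carry mutually
  -- inverse variables, the pair by which consecutive S_i differ.
  lineWeight : ℕ → Carrier
  lineWeight d = if odd d then pick Xinv 1# (d ℕ./ 2) else pick X 1# (d ℕ./ 2)

  open SideWeights lineWeight public

  sideWeight-line : ∀ d q → diagSum q ≡ ℤ.- + double d → sideWeight X Xinv q ≡ lineWeight d
  sideWeight-line d q e = cong lineWeight (≡.trans (cong (λ z → ℤ.∣ z ∣ ℕ./ 2) e) (≡.trans (cong (ℕ._/ 2) (ℤP.∣-i∣≡∣i∣ (+ double d))) (double/2 d)))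

  countedWeight : Start → Point → ℕ → ℕ → List Bool → Carrier
  countedWeight s q d r bs = if (ups bs ℕ.≡ᵇ d) ∧ (sides bs ℕ.≡ᵇ r) then initWeight X Xinv s q bs else 0#

  ΣL-listsOfLen-suc : ∀ k (f : List Bool → Carrier) → ΣL (listsOfLen (suc k)) f ≈ ΣL (listsOfLen k) (f ∘ (true ∷_)) + ΣL (listsOfLen k) (f ∘ (false ∷_))
  ΣL-listsOfLen-suc k f = trans (ΣL-concatMap (λ bs → (true ∷ bs) ∷ (false ∷ bs) ∷ []) (listsOfLen k) f)
    (trans (ΣL-cong (listsOfLen k) (λ _ → +-congˡ (+-identityʳ _))) (ΣL-+ (listsOfLen k) _ _))

  private
    upPart sidePart : ℕ → ℕ → ℕ → Carrier
    upPart k zero r = 0#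
    upPart k (suc d) r = if k ℕ.≡ᵇ d ℕ.+ r then h d r else 0#
    sidePart k d zero = 0#
    sidePart k d (suc r) = lineWeight d * (if k ℕ.≡ᵇ d ℕ.+ r then h d r else 0#)

    if-*ˡ : ∀ b y z → (if b then y * z else 0#) ≈ y * (if b then z else 0#)
    if-*ˡ true y z = refl
    if-*ˡ false y z = sym (zeroʳ y)

    if-∧-false : ∀ b z → (if b ∧ false then z else 0#) ≈ 0#
    if-∧-false true z = refl
    if-∧-false false z = refl

    combine : ∀ k d r → upPart k d r + sidePart k d r ≈ (if suc k ℕ.≡ᵇ d ℕ.+ r then h d r else 0#)
    combine k zero zero = +-identityʳ _
    combine k zero (suc r) = trans (+-identityˡ _) (sym (if-*ˡ (k ℕ.≡ᵇ r) _ _))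
    combine k (suc d) zero = +-identityʳ _
    combine k (suc d) (suc r) rewrite ℕP.+-suc d r with k ℕ.≡ᵇ suc (d ℕ.+ r)
    ... | true = refl
    ... | false = trans (+-identityˡ _) (zeroʳ _)

  -- From line number d the r side steps are spread over the d + 1 lines d, ..., 0, which gives a
  -- complete homogeneous polynomial. A first step upwards or sideways corresponds to the two terms
  -- in the recursion of `h`.
  initSum-length : ∀ s k d r q → diagSum q ≡ ℤ.- + double d →
    ΣL (listsOfLen k) (countedWeight s q d r) ≈ (if k ℕ.≡ᵇ d ℕ.+ r then h d r else 0#)
  initSum-length s zero zero zero q e = +-identityʳ _
  initSum-length s zero zero (suc r) q e = +-identityʳ _
  initSum-length s zero (suc d) r q e = +-identityʳ _
  initSum-length s (suc k) d r q e = trans (ΣL-listsOfLen-suc k (countedWeight s q d r)) (trans (+-cong (first-up d e) (first-side r)) (combine k d r))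
    where
    first-up : ∀ d → diagSum q ≡ ℤ.- + double d → ΣL (listsOfLen k) (countedWeight s q d r ∘ (true ∷_)) ≈ upPart k d r
    first-up zero e = ΣL-zero (listsOfLen k) (λ _ → refl)
    first-up (suc d) e = initSum-length s k d r (q ⊕ initStep s true) (≡.trans (diagSum-up s q) (≡.trans (cong (ℤ._+ + 2) e)
      (solve 1 (λ d → (:- (con (+ 2) :+ d)) :+ con (+ 2) := :- d) ≡.refl (+ double d))))
      where open +-*-Solver
    first-side : ∀ r → ΣL (listsOfLen k) (countedWeight s q d r ∘ (false ∷_)) ≈ sidePart k d r
    first-side zero = ΣL-zero (listsOfLen k) (λ {bs} _ → if-∧-false (ups bs ℕ.≡ᵇ d) _)
    first-side (suc r) = begin
      ΣL (listsOfLen k) (countedWeight s q d (suc r) ∘ (false ∷_))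
        ≈⟨ ΣL-cong (listsOfLen k) (λ {bs} _ → trans (if-*ˡ ((ups bs ℕ.≡ᵇ d) ∧ (sides bs ℕ.≡ᵇ r)) (sideWeight X Xinv q) _) (*-congʳ (reflexive (sideWeight-line d q e)))) ⟩
      ΣL (listsOfLen k) (λ bs → lineWeight d * countedWeight s (q ⊕ initStep s false) d r bs) ≈⟨ ΣL-*ˡ (listsOfLen k) (lineWeight d) _ ⟩
      lineWeight d * ΣL (listsOfLen k) (countedWeight s (q ⊕ initStep s false) d r)
        ≈⟨ *-congˡ (initSum-length s k d r (q ⊕ initStep s false) (≡.trans (diagSum-side s q) e)) ⟩
      lineWeight d * (if k ℕ.≡ᵇ d ℕ.+ r then h d r else 0#) ∎

  initSum : ∀ s N d r q → diagSum q ≡ ℤ.- + double d → d ℕ.+ r ℕ.≤ N →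
    ΣL (listsUpTo N) (countedWeight s q d r) ≈ h d r
  initSum s N d r q e d+r≤N = begin
    ΣL (listsUpTo N) (countedWeight s q d r) ≈⟨ ΣL-concatMap listsOfLen (upTo (suc N)) _ ⟩
    ΣL (upTo (suc N)) (λ k → ΣL (listsOfLen k) (countedWeight s q d r)) ≈⟨ ΣL-cong (upTo (suc N)) (λ {k} _ → initSum-length s k d r q e) ⟩
    ΣL (upTo (suc N)) (λ k → if k ℕ.≡ᵇ d ℕ.+ r then h d r else 0#)
      ≈⟨ ΣL-single (Uniq.upTo⁺ (suc N)) (∈-upTo⁺ (ℕ.s≤s d+r≤N)) _ (λ {k} _ k≢ → reflexive (cong (λ b → if b then h d r else 0#) (≢⇒≡ᵇ-false k≢))) ⟩
    (if d ℕ.+ r ℕ.≡ᵇ d ℕ.+ r then h d r else 0#) ≈⟨ reflexive (cong (λ b → if b then h d r else 0#) (≡ᵇ-true⁺ {d ℕ.+ r} ≡.refl)) ⟩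
    h d r ∎
    where
    ≢⇒≡ᵇ-false : ∀ {m n} → m ≢ n → (m ℕ.≡ᵇ n) ≡ false
    ≢⇒≡ᵇ-false {m} {n} m≢n with m ℕ.≡ᵇ n in eq
    ... | true = contradiction (≡ᵇ-true⁻ eq) m≢n
    ... | false = ≡.refl

  positivePart : ℕ → ℤ → Carrier
  positivePart k (+ m) = H k m
  positivePart k -[1+ m ] = 0#

  -- Paths from α contribute where k > 0 and, with sign -1, paths from β where k < 0; together they
  -- give the odd function.
  signed-split : ∀ i k → positivePart (suc i) k + - 1# * positivePart (suc i) (ℤ.- k) ≈ signed (suc i) k
  signed-split i (+ zero) = trans (+-identityˡ _) (zeroʳ _)
  signed-split i (+ suc m) = trans (+-congˡ (zeroʳ _)) (+-identityʳ _)
  signed-split i -[1+ m ] = trans (+-identityˡ _) (-1*x≈-x _)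

  shifts-+ : ∀ k f r → shifts k f (k ℕ.+ r) ≡ f r
  shifts-+ zero f r = ≡.refl
  shifts-+ (suc k) f r = shifts-+ k f r

  shifts-< : ∀ k f {m} → m ℕ.< k → shifts k f m ≡ 0#
  shifts-< (suc k) f {zero} _ = ≡.refl
  shifts-< (suc k) f {suc m} (ℕ.s≤s m<k) = shifts-< k f m<k

  diagSum-startPt-line : ∀ i s → diagSum (startPt (suc i) s) ≡ ℤ.- + double (suc (double i))
  diagSum-startPt-line i s = ≡.trans (diagSum-startPt (suc i) s) (≡.sym (≡.trans (cong (λ z → ℤ.- + suc (suc z)) (≡.trans (double≡+ (double i)) (cong₂ ℕ._+_ (double≡+ i) (double≡+ i))))
    (solve 1 (λ i → :- (con (+ 1) :+ (con (+ 1) :+ ((i :+ i) :+ (i :+ i)))) := con (+ 2) :- con (+ 4) :* (con (+ 1) :+ i)) ≡.refl (+ i))))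
    where open +-*-Solver

  module _ (i : ℕ) (s : Start) (e : Point) (fn : List Bool) (diag-e : diagSum e ≡ + length fn) where
    private
      q : Point
      q = startPt (suc i) s
      inits : List (List Bool)
      inits = listsUpTo (initBound (suc i) s e)
      admWeight : List Bool → Carrier
      admWeight ini = if admissibleᵇ (suc i) (mkPath s ini fn) e then initWeight X Xinv s q ini else 0#

      inadmissible : ∀ {ini} → ¬ Adm (suc i) (mkPath s ini fn) e → admWeight ini ≈ 0#
      inadmissible {ini} ¬ad with admissibleᵇ (suc i) (mkPath s ini fn) e in eq
      ... | true = contradiction (admissible⁻ eq) ¬ad
      ... | false = refl

      for-offset : ∀ k → offset s (ups fn) (proj₁ e) ≡ k → ΣL inits admWeight ≈ positivePart (suc i) k
      for-offset -[1+ m ] o = ΣL-zero inits (λ {ini} _ → inadmissible {ini} (λ ad → case ≡.trans (≡.sym o) (proj₂ (adm-counts⁻ ad)) of λ ()))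
      for-offset (+ m) o with suc i ℕ.≤? m
      ... | no i≰m = trans (ΣL-zero inits (λ {ini} _ → inadmissible {ini} (λ ad → i≰m (subst (suc i ℕ.≤_) (≡.sym (ℤP.+-injective (≡.trans (≡.sym o) (proj₂ (adm-counts⁻ ad))))) (ℕP.m≤m+n (suc i) (sides ini))))))
              (reflexive (≡.sym (shifts-< (suc i) (h (suc (double i))) (ℕP.≰⇒> i≰m))))
      ... | yes i≤m with ℕP.m≤n⇒∃[o]m+o≡n i≤m
      ... | r , ≡.refl = begin
        ΣL inits admWeight ≈⟨ ΣL-cong inits (λ {ini} _ → reflexive (cong (λ b → if b then initWeight X Xinv s q ini else 0#) (same ini))) ⟩
        ΣL inits (countedWeight s q (suc (double i)) r) ≈⟨ initSum s _ (suc (double i)) r q (diagSum-startPt-line i s) bound ⟩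
        h (suc (double i)) r ≈⟨ reflexive (≡.sym (shifts-+ (suc i) (h (suc (double i))) r)) ⟩
        H (suc i) (suc i ℕ.+ r) ∎
        where
        same : ∀ ini → admissibleᵇ (suc i) (mkPath s ini fn) e ≡ (ups ini ℕ.≡ᵇ suc (double i)) ∧ (sides ini ℕ.≡ᵇ r)
        same ini = bool-iff
          (λ t → let u , v = adm-counts⁻ (admissible⁻ {suc i} {mkPath s ini fn} {e} t) in
            cong₂ _∧_ (≡ᵇ-true⁺ {ups ini} u) (≡ᵇ-true⁺ {sides ini} (ℕP.+-cancelˡ-≡ (suc i) (sides ini) r (ℤP.+-injective (≡.trans (≡.sym v) o)))))
          (λ t → let u , v = ∧-true⁻ {ups ini ℕ.≡ᵇ suc (double i)} t in
            admissible⁺ (adm-counts⁺ {i} {s} {ini} {fn} {e} diag-e (≡ᵇ-true⁻ {ups ini} u) (≡.trans o (cong (λ z → + (suc i ℕ.+ z)) (≡.sym (≡ᵇ-true⁻ {sides ini} v))))))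
        bound : suc (double i) ℕ.+ r ℕ.≤ initBound (suc i) s e
        bound with with-counts (suc (double i)) r
        ... | ini , u , v = subst (ℕ._≤ initBound (suc i) s e) (≡.trans (≡.sym (ups+sides ini)) (cong₂ ℕ._+_ u v))
          (init-length (adm-counts⁺ {i} {s} {ini} {fn} {e} diag-e u (≡.trans o (cong (λ z → + (suc i ℕ.+ z)) (≡.sym v)))))

    -- Endpoint and final segment determine the size m of the coordinates of the turning point. The
    -- initial segment then has m - (i + 1) side steps, a shift that the factor z^(i+1) of S_(i+1)
    -- absorbs; for smaller m no segment exists and `positivePart` is 0.
    admInitSum : ΣL inits admWeight ≈ positivePart (suc i) (offset s (ups fn) (proj₁ e))
    admInitSum = for-offset _ ≡.refl

  -- A final weight depends on the first vertex only through x + y, which is 0 at every turning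
  -- point; final segments can therefore be weighed from the origin before the turning point is
  -- known.
  finWeight-diag : ∀ w j {q q′} bs → diagSum q ≡ diagSum q′ → finWeight w j q bs ≡ finWeight w j q′ bs
  finWeight-diag w j [] e = ≡.refl
  finWeight-diag w j {q} {q′} (true ∷ bs) e = cong₂ _*_ (cong (λ z → if + j ℤ.- + 1 ℤ.≤ᵇ z then w else 1#) e)
    (finWeight-diag w j bs (≡.trans (add diagSum-additive q _) (≡.trans (cong (ℤ._+ + 1) e) (≡.sym (add diagSum-additive q′ _)))))
  finWeight-diag w j {q} {q′} (false ∷ bs) e =
    finWeight-diag w j bs (≡.trans (add diagSum-additive q _) (≡.trans (cong (ℤ._+ + 1) e) (≡.sym (add diagSum-additive q′ _))))

  origin : Point
  origin = + 0 , + 0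

  pathSum : ∀ w i s e j M → diagSum e ≡ + M →
    ΣL (admPaths (suc i) s e) (pathWeight w X Xinv (suc i) j) ≈
    ΣL (listsOfLen M) (λ fn → finWeight w j origin fn * positivePart (suc i) (offset s (ups fn) (proj₁ e)))
  pathSum w i s e j M diag-e = begin
    ΣL (admPaths (suc i) s e) pw ≈⟨ ΣL-filter (≡true? (λ p → admissibleᵇ (suc i) p e)) (rawPaths (suc i) s e) pw ⟩
    ΣL (rawPaths (suc i) s e) restricted ≈⟨ ΣL-concatMap (pathsWithInit s e) inits restricted ⟩
    ΣL inits (λ ini → ΣL (pathsWithInit s e ini) restricted)
      ≈⟨ ΣL-cong inits (λ {ini} _ → trans (ΣL-map (mkPath s ini) (listsOfLen ℤ.∣ diagSum e ∣) restricted) (reflexive (cong (λ z → ΣL (listsOfLen ℤ.∣ z ∣) (restricted ∘ mkPath s ini)) diag-e))) ⟩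
    ΣL inits (λ ini → ΣL (listsOfLen M) (λ fn → restricted (mkPath s ini fn))) ≈⟨ ΣL-comm inits (listsOfLen M) _ ⟩
    ΣL (listsOfLen M) (λ fn → ΣL inits (λ ini → restricted (mkPath s ini fn)))
      ≈⟨ ΣL-cong (listsOfLen M) (λ {fn} fn∈ → begin
          ΣL inits (λ ini → restricted (mkPath s ini fn)) ≈⟨ ΣL-cong inits (λ {ini} _ → separate ini fn) ⟩
          ΣL inits (λ ini → finWeight w j origin fn * (if admissibleᵇ (suc i) (mkPath s ini fn) e then initWeight X Xinv s (startPt (suc i) s) ini else 0#))
            ≈⟨ ΣL-*ˡ inits _ _ ⟩
          finWeight w j origin fn * ΣL inits (λ ini → if admissibleᵇ (suc i) (mkPath s ini fn) e then initWeight X Xinv s (startPt (suc i) s) ini else 0#)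
            ≈⟨ *-congˡ (admInitSum i s e fn (≡.trans diag-e (cong +_ (≡.sym (listsOfLen-length M fn∈))))) ⟩
          finWeight w j origin fn * positivePart (suc i) (offset s (ups fn) (proj₁ e)) ∎) ⟩
    ΣL (listsOfLen M) (λ fn → finWeight w j origin fn * positivePart (suc i) (offset s (ups fn) (proj₁ e))) ∎
    where
    pw : Path → Carrier
    pw = pathWeight w X Xinv (suc i) j
    restricted : Path → Carrier
    restricted p = if does (≡true? (λ p → admissibleᵇ (suc i) p e) p) then pw p else 0#
    inits : List (List Bool)
    inits = listsUpTo (initBound (suc i) s e)
    separate : ∀ ini fn → restricted (mkPath s ini fn) ≈
      finWeight w j origin fn * (if admissibleᵇ (suc i) (mkPath s ini fn) e then initWeight X Xinv s (startPt (suc i) s) ini else 0#)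
    separate ini fn with admissibleᵇ (suc i) (mkPath s ini fn) e in eq
    ... | false = sym (zeroʳ _)
    ... | true = trans (*-comm _ _) (*-congʳ (reflexive (finWeight-diag w j fn (turn-diag (admissible⁻ {suc i} {mkPath s ini fn} {e} eq)))))

  signOf : Start → Carrier
  signOf s = if isβ s then - 1# else 1#

  offset-flip : ∀ k x → offset β k x ≡ ℤ.- offset α k x
  offset-flip k x = solve 2 (λ k x → x :- k := :- (k :- x)) ≡.refl (+ k) x
    where open +-*-Solver

  signedPathSum : ∀ w i e j M → diagSum e ≡ + M →
    ΣL (α ∷ β ∷ []) (λ s → ΣL (admPaths (suc i) s e) (λ p → signOf s * pathWeight w X Xinv (suc i) j p)) ≈
    ΣL (listsOfLen M) (λ fn → finWeight w j origin fn * signed (suc i) (+ ups fn ℤ.- proj₁ e))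
  signedPathSum w i e j M diag-e = begin
    ΣL (admPaths (suc i) α e) (λ p → 1# * pw p) + (ΣL (admPaths (suc i) β e) (λ p → - 1# * pw p) + 0#)
      ≈⟨ +-cong (trans (ΣL-*ˡ (admPaths (suc i) α e) _ _) (trans (*-identityˡ _) (pathSum w i α e j M diag-e)))
           (trans (+-identityʳ _) (trans (ΣL-*ˡ (admPaths (suc i) β e) _ _) (trans (*-congˡ (pathSum w i β e j M diag-e)) (sym (ΣL-*ˡ (listsOfLen M) _ _))))) ⟩
    ΣL (listsOfLen M) (λ fn → fW fn * positivePart (suc i) (offset α (ups fn) (proj₁ e)))
      + ΣL (listsOfLen M) (λ fn → - 1# * (fW fn * positivePart (suc i) (offset β (ups fn) (proj₁ e)))) ≈⟨ sym (ΣL-+ (listsOfLen M) _ _) ⟩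
    ΣL (listsOfLen M) (λ fn → fW fn * positivePart (suc i) (offset α (ups fn) (proj₁ e)) + - 1# * (fW fn * positivePart (suc i) (offset β (ups fn) (proj₁ e))))
      ≈⟨ ΣL-cong (listsOfLen M) (λ {fn} _ → trans (+-congˡ (*-x∙yz≈y∙xz _ _ _)) (trans (sym (distribˡ _ _ _))
           (*-congˡ (trans (+-congˡ (*-congˡ (reflexive (cong (positivePart (suc i)) (offset-flip (ups fn) (proj₁ e)))))) (signed-split i (offset α (ups fn) (proj₁ e))))))) ⟩
    ΣL (listsOfLen M) (λ fn → fW fn * signed (suc i) (+ ups fn ℤ.- proj₁ e)) ∎
    where
    pw : Path → Carrier
    pw = pathWeight w X Xinv (suc i) j
    fW : List Bool → Carrier
    fW = finWeight w j origin

  negOnePow-count : {A : Set} (b : A → Bool) (xs : List A) → negOnePow (length (filter (≡true? b) xs)) ≈ ΠL xs (λ a → if b a then - 1# else 1#)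
  negOnePow-count b [] = refl
  negOnePow-count b (x ∷ xs) with b x
  ... | true = trans (negOnePow-suc (length (filter (≡true? b) xs))) (trans (-‿cong (negOnePow-count b xs)) (sym (-1*x≈-x _)))
  ... | false = trans (negOnePow-count b xs) (sym (*-identityˡ _))

  pathMatrix : Carrier → (Fin n → List Point) → Fin n → Fin n → Carrier
  pathMatrix w E i j = ΣL (α ∷ β ∷ []) (λ s → ΣL (E j) (λ e → ΣL (admPaths (suc (toℕ i)) s e) (λ p → signOf s * pathWeight w X Xinv (suc (toℕ i)) (suc (toℕ j)) p)))

  -- Once σ is fixed, the choices at different indices are independent, so paths, endpoints and
  -- starts are summed out in turn, and the sign of the β-starts is distributed over the factors.
  famSum-det : ∀ w E → famSum standardSign allFamilies E w X Xinv ≈ det (pathMatrix w E)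
  famSum-det w E = begin
    ΣL (filter (≡true? (λ _ → true)) (families n E)) term ≈⟨ ΣL-filter (≡true? (λ _ → true)) (families n E) term ⟩
    ΣL (families n E) term ≈⟨ ΣL-concatMap withPerm (perms n) term ⟩
    ΣL (perms n) (λ v → ΣL (withPerm v) term)
      ≈⟨ ΣL-cong (perms n) (λ {v} _ → per-perm v) ⟩
    det (pathMatrix w E) ∎
    where
    term : Family n → Carrier
    term F = negOnePow (signExp standardSign F) * famWeight w X Xinv F
    startChoices : List (Vec Start n)
    startChoices = allVecs (λ _ → α ∷ β ∷ [])
    endChoices : Vec (Fin n) n → List (Vec Point n)
    endChoices v = allVecs (λ i → E (lookup v i))
    choices : Vec Start n → Vec Point n → List (Vec Path n)
    choices ss es = allVecs (λ i → admPaths (suc (toℕ i)) (lookup ss i) (lookup es i))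
    withEnds : Vec (Fin n) n → Vec Start n → Vec Point n → List (Family n)
    withEnds v ss es = map (mkFam v ss es) (choices ss es)
    withStarts : Vec (Fin n) n → Vec Start n → List (Family n)
    withStarts v ss = concatMap (withEnds v ss) (endChoices v)
    withPerm : Vec (Fin n) n → List (Family n)
    withPerm v = concatMap (withStarts v) startChoices
    per-perm : ∀ v → ΣL (withPerm v) term
      ≈ negOnePow (inversions v) * ∏ (λ i → pathMatrix w E i (lookup v i))
    per-perm v = begin
      ΣL (withPerm v) term
        ≈⟨ ΣL-concatMap (withStarts v) startChoices term ⟩
      ΣL startChoices (λ ss → ΣL (withStarts v ss) term)
        ≈⟨ ΣL-cong startChoices (λ {ss} _ → begin
            ΣL (withStarts v ss) term ≈⟨ ΣL-concatMap (withEnds v ss) (endChoices v) term ⟩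
            ΣL (endChoices v) (λ es → ΣL (map (mkFam v ss es) (choices ss es)) term)
              ≈⟨ ΣL-cong (endChoices v) (λ {es} _ → begin
                  ΣL (map (mkFam v ss es) (choices ss es)) term ≈⟨ ΣL-map (mkFam v ss es) (choices ss es) term ⟩
                  ΣL (choices ss es) (term ∘ mkFam v ss es) ≈⟨ ΣL-cong (choices ss es) (λ {ps} _ → factor ss es ps) ⟩
                  ΣL (choices ss es) (λ ps → negOnePow (inversions v) * ∏ (λ i → g v i (lookup ss i) (lookup ps i))) ≈⟨ ΣL-*ˡ (choices ss es) _ _ ⟩
                  negOnePow (inversions v) * ΣL (choices ss es) (λ ps → ∏ (λ i → g v i (lookup ss i) (lookup ps i)))
                    ≈⟨ *-congˡ (∏-allVecs (λ i → admPaths (suc (toℕ i)) (lookup ss i) (lookup es i)) (λ i p → g v i (lookup ss i) p)) ⟩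
                  negOnePow (inversions v) * ∏ (λ i → g₁ v i (lookup ss i) (lookup es i)) ∎) ⟩
            ΣL (endChoices v) (λ es → negOnePow (inversions v) * ∏ (λ i → g₁ v i (lookup ss i) (lookup es i))) ≈⟨ ΣL-*ˡ (endChoices v) _ _ ⟩
            negOnePow (inversions v) * ΣL (endChoices v) (λ es → ∏ (λ i → g₁ v i (lookup ss i) (lookup es i)))
              ≈⟨ *-congˡ (∏-allVecs (λ i → E (lookup v i)) (λ i e → g₁ v i (lookup ss i) e)) ⟩
            negOnePow (inversions v) * ∏ (λ i → g₂ v i (lookup ss i)) ∎) ⟩
      ΣL startChoices (λ ss → negOnePow (inversions v) * ∏ (λ i → g₂ v i (lookup ss i))) ≈⟨ ΣL-*ˡ startChoices _ _ ⟩
      negOnePow (inversions v) * ΣL startChoices (λ ss → ∏ (λ i → g₂ v i (lookup ss i))) ≈⟨ *-congˡ (∏-allVecs {n = n} (λ _ → α ∷ β ∷ []) (g₂ v)) ⟩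
      negOnePow (inversions v) * ∏ (λ i → pathMatrix w E i (lookup v i)) ∎
      where
      g : Vec (Fin n) n → Fin n → Start → Path → Carrier
      g v i s p = signOf s * pathWeight w X Xinv (suc (toℕ i)) (suc (toℕ (lookup v i))) p
      g₁ : Vec (Fin n) n → Fin n → Start → Point → Carrier
      g₁ v i s e = ΣL (admPaths (suc (toℕ i)) s e) (g v i s)
      g₂ : Vec (Fin n) n → Fin n → Start → Carrier
      g₂ v i s = ΣL (E (lookup v i)) (g₁ v i s)
      factor : ∀ ss es ps → term (mkFam v ss es ps) ≈ negOnePow (inversions v) * ∏ (λ i → g v i (lookup ss i) (lookup ps i))
      factor ss es ps = begin
        negOnePow (inversions v ℕ.+ βs) * W ≈⟨ *-congʳ (negOnePow-+ (inversions v) βs) ⟩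
        negOnePow (inversions v) * negOnePow βs * W ≈⟨ *-assoc _ _ _ ⟩
        negOnePow (inversions v) * (negOnePow βs * W) ≈⟨ *-congˡ (*-congʳ (negOnePow-count (λ i → isβ (lookup ss i)) (allFin n))) ⟩
        negOnePow (inversions v) * (∏ (λ i → signOf (lookup ss i)) * W) ≈⟨ *-congˡ (sym (∏-* (λ i → signOf (lookup ss i)) _)) ⟩
        negOnePow (inversions v) * ∏ (λ i → g v i (lookup ss i) (lookup ps i)) ∎
        where
        βs : ℕ
        βs = length (filter (≡true? (λ i → isβ (lookup ss i))) (allFin n))
        W : Carrier
        W = ∏ (λ i → pathWeight w X Xinv (suc (toℕ i)) (suc (toℕ (lookup v i))) (lookup ps i))

-- The Vandermonde-type denominator

module Products {c ℓ : Level} (R : CommutativeRing c ℓ) where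
  open RingPart R hiding (zero)
  open SumsAndDeterminants R
  open Sequences R
  open import Relation.Binary.Reasoning.Setoid setoid
  open import Algebra.Solver.Ring.NaturalCoefficients.Default commutativeSemiring using (solve; _:=_; _:+_; _:*_; con)

  pow-+ : ∀ x a b → pow x (a ℕ.+ b) ≈ pow x a * pow x b
  pow-+ x zero b = sym (*-identityˡ _)
  pow-+ x (suc a) b = trans (*-congˡ (pow-+ x a b)) (sym (*-assoc _ _ _))

  pow-inverse : ∀ {x y} → x * y ≈ 1# → ∀ k → pow x k * pow y k ≈ 1#
  pow-inverse xy zero = *-identityˡ 1#
  pow-inverse xy (suc k) = trans (*-interchange _ _ _ _) (trans (*-cong xy (pow-inverse xy k)) (*-identityˡ 1#))

  pow-1 : ∀ {x} → x ≈ 1# → ∀ k → pow x k ≈ 1#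
  pow-1 e zero = refl
  pow-1 e (suc k) = trans (*-cong e (pow-1 e k)) (*-identityˡ 1#)

  ∏-const : ∀ n x → ∏ {n} (λ _ → x) ≈ pow x n
  ∏-const zero x = refl
  ∏-const (suc n) x = trans (∏-suc {n} (λ _ → x)) (*-congˡ (∏-const n x))

  ∏-neg : ∀ {n} (f : Fin n → Carrier) → ∏ (λ i → - f i) ≈ negOnePow n * ∏ f
  ∏-neg {zero} f = sym (*-identityˡ _)
  ∏-neg {suc n} f = begin
    ∏ (λ i → - f i) ≈⟨ ∏-suc (λ i → - f i) ⟩
    - f Fin.zero * ∏ (λ i → - f (Fin.suc i)) ≈⟨ *-cong (sym (-1*x≈-x _)) (∏-neg (f ∘ Fin.suc)) ⟩
    - 1# * f Fin.zero * (negOnePow n * ∏ (f ∘ Fin.suc)) ≈⟨ *-interchange _ _ _ _ ⟩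
    - 1# * negOnePow n * (f Fin.zero * ∏ (f ∘ Fin.suc)) ≈⟨ *-cong (trans (-1*x≈-x _) (sym (negOnePow-suc n))) (sym (∏-suc f)) ⟩
    negOnePow (suc n) * ∏ f ∎

  *-difference : ∀ p q r → (1# - p) * (q - r) ≈ (q + p * r) - (r + p * q)
  *-difference p q r = begin
    (1# - p) * (q - r) ≈⟨ solve 3 (λ np q nr → (con 1 :+ np) :* (q :+ nr) := (q :+ np :* nr) :+ (nr :+ np :* q)) refl (- p) q (- r) ⟩
    (q + - p * - r) + (- r + - p * q) ≈⟨ +-cong (+-congˡ neg-neg) (trans (+-congˡ (sym (-‿distribˡ-* p q))) (-‿+-comm r (p * q))) ⟩
    (q + p * r) - (r + p * q) ∎
    where
    neg-neg : - p * - r ≈ p * r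
    neg-neg = trans (sym (-‿distribˡ-* p (- r))) (trans (-‿cong (sym (-‿distribʳ-* p r))) (-‿involutive _))

  -‿flip : ∀ x y → x - y ≈ - (y - x)
  -‿flip x y = sym (trans (sym (-‿+-comm y (- x))) (trans (+-congˡ (-‿involutive x)) (+-comm _ _)))

  -- u' - u = (X' - X) (1 - 1/(X X')), multiplied by X X' to remove the inverses.
  root-difference : ∀ {X Y X′ Y′} → X * Y ≈ 1# → X′ * Y′ ≈ 1# →
    X * (X′ * ((X′ + Y′) - (X + Y))) ≈ - ((1# - X * X′) * (X′ - X))
  root-difference {X} {Y} {X′} {Y′} e e′ = begin
    X * (X′ * ((X′ + Y′) - (X + Y))) ≈⟨ solve 4 (λ X X′ a b → X :* (X′ :* (a :+ b)) := (X :* X′) :* a :+ (X :* X′) :* b) refl X X′ (X′ + Y′) (- (X + Y)) ⟩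
    X * X′ * (X′ + Y′) + X * X′ * - (X + Y) ≈⟨ +-congˡ (sym (-‿distribʳ-* _ _)) ⟩
    X * X′ * (X′ + Y′) - X * X′ * (X + Y) ≈⟨ +-cong first (-‿cong second) ⟩
    (X + X * X′ * X′) - (X′ + X * X′ * X) ≈⟨ -‿flip _ _ ⟩
    - ((X′ + X * X′ * X) - (X + X * X′ * X′)) ≈⟨ -‿cong (sym (*-difference (X * X′) X′ X)) ⟩
    - ((1# - X * X′) * (X′ - X)) ∎
    where
    first : X * X′ * (X′ + Y′) ≈ X + X * X′ * X′
    first = trans (solve 3 (λ X X′ Y′ → (X :* X′) :* (X′ :+ Y′) := X :* (X′ :* Y′) :+ (X :* X′) :* X′) refl X X′ Y′)
      (+-congʳ (trans (*-congˡ e′) (*-identityʳ X)))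
    second : X * X′ * (X + Y) ≈ X′ + X * X′ * X
    second = trans (solve 3 (λ X X′ Y → (X :* X′) :* (X :+ Y) := X′ :* (X :* Y) :+ (X :* X′) :* X) refl X X′ Y)
      (+-congʳ (trans (*-congˡ e) (*-identityʳ X′)))

  -- The determinant of the triangular change of basis, up to the monomial clearing its denominators.
  vandermonde-product : ∀ n (X Y a b : Fin n → Carrier) → (∀ i → X i * Y i ≈ 1#) → (∀ i → X i * a i ≈ - b i) →
    ∏ (λ i → pow (X i) n * a i) * ∏< (λ i j → (X j + Y j) - (X i + Y i)) ≈
    negOnePow (suc n C 2) * (∏ b * ∏< (λ i j → (1# - X i * X j) * (X j - X i)))
  vandermonde-product zero X Y a b inv ab = trans (*-identityˡ _) (sym (trans (*-identityˡ _) (*-identityˡ _)))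
  vandermonde-product (suc n) X Y a b inv ab = begin
    ∏ (λ i → pow (X i) (suc n) * a i) * ∏< (λ i j → (X j + Y j) - (X i + Y i))
      ≈⟨ *-cong (trans (∏-suc (λ i → pow (X i) (suc n) * a i))
                  (*-congˡ (trans (∏-cong (λ i → *-assoc (X⁺ i) (pow (X⁺ i) n) (a⁺ i))) (∏-* X⁺ (λ i → pow (X⁺ i) n * a⁺ i)))))
                (∏<-suc (λ i j → (X j + Y j) - (X i + Y i))) ⟩
    -- One power of X₀ clears a₀, and n powers clear the differences with the later roots, each of
    -- which also takes one power of its own X_j. The n + 1 minus signs produced here raise the
    -- exponent from `suc n C 2` to `suc (suc n) C 2`.
    (X₀ * pow X₀ n * a₀ * (∏ X⁺ * P)) * (∏ d * Q)
      ≈⟨ solve 7 (λ x p a xs P d Q → ((x :* p) :* a :* (xs :* P)) :* (d :* Q) := ((x :* a) :* (p :* (xs :* d))) :* (P :* Q)) refl X₀ (pow X₀ n) a₀ (∏ X⁺) P (∏ d) Q ⟩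
    ((X₀ * a₀) * (pow X₀ n * (∏ X⁺ * ∏ d))) * (P * Q)
      ≈⟨ *-cong (*-cong (ab Fin.zero) pairs) (vandermonde-product n X⁺ Y⁺ a⁺ (b ∘ Fin.suc) (inv ∘ Fin.suc) (ab ∘ Fin.suc)) ⟩
    (- b Fin.zero * (negOnePow n * ∏ k)) * (negOnePow (suc n C 2) * (∏ (b ∘ Fin.suc) * K)) ≈⟨ *-congʳ (*-congʳ (sym (-1*x≈-x _))) ⟩
    ((- 1# * b Fin.zero) * (negOnePow n * ∏ k)) * (negOnePow (suc n C 2) * (∏ (b ∘ Fin.suc) * K))
      ≈⟨ solve 7 (λ m b s k t bs K → ((m :* b) :* (s :* k)) :* (t :* (bs :* K)) := ((m :* s) :* t) :* ((b :* bs) :* (k :* K))) refl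
           (- 1#) (b Fin.zero) (negOnePow n) (∏ k) (negOnePow (suc n C 2)) (∏ (b ∘ Fin.suc)) K ⟩
    - 1# * negOnePow n * negOnePow (suc n C 2) * ((b Fin.zero * ∏ (b ∘ Fin.suc)) * (∏ k * K))
      ≈⟨ *-cong sign (*-cong (sym (∏-suc b)) (sym (∏<-suc (λ i j → (1# - X i * X j) * (X j - X i))))) ⟩
    negOnePow (suc (suc n) C 2) * (∏ b * ∏< (λ i j → (1# - X i * X j) * (X j - X i))) ∎
    where
    X₀ a₀ P Q K : Carrier
    X⁺ Y⁺ a⁺ d k : Fin n → Carrier
    X₀ = X Fin.zero
    a₀ = a Fin.zero
    X⁺ = X ∘ Fin.suc
    Y⁺ = Y ∘ Fin.suc
    a⁺ = a ∘ Fin.suc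
    P = ∏ (λ i → pow (X⁺ i) n * a⁺ i)
    d j = (X⁺ j + Y⁺ j) - (X₀ + Y Fin.zero)
    Q = ∏< (λ i j → (X⁺ j + Y⁺ j) - (X⁺ i + Y⁺ i))
    k j = (1# - X₀ * X⁺ j) * (X⁺ j - X₀)
    K = ∏< (λ i j → (1# - X⁺ i * X⁺ j) * (X⁺ j - X⁺ i))
    pairs : pow X₀ n * (∏ X⁺ * ∏ d) ≈ negOnePow n * ∏ k
    pairs = begin
      pow X₀ n * (∏ X⁺ * ∏ d) ≈⟨ *-cong (sym (∏-const n X₀)) (sym (∏-* X⁺ d)) ⟩
      ∏ {n} (λ _ → X₀) * ∏ (λ j → X⁺ j * d j) ≈⟨ sym (∏-* (λ _ → X₀) (λ j → X⁺ j * d j)) ⟩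
      ∏ (λ j → X₀ * (X⁺ j * d j)) ≈⟨ ∏-cong (λ j → root-difference (inv Fin.zero) (inv (Fin.suc j))) ⟩
      ∏ (λ j → - k j) ≈⟨ ∏-neg k ⟩
      negOnePow n * ∏ k ∎
    sign : - 1# * negOnePow n * negOnePow (suc n C 2) ≈ negOnePow (suc (suc n) C 2)
    sign = begin
      - 1# * negOnePow n * negOnePow (suc n C 2) ≈⟨ *-congʳ (trans (-1*x≈-x _) (sym (negOnePow-suc n))) ⟩
      negOnePow (suc n) * negOnePow (suc n C 2) ≈⟨ sym (negOnePow-+ (suc n) (suc n C 2)) ⟩
      negOnePow (suc n ℕ.+ (suc n C 2)) ≈⟨ reflexive (cong negOnePow (≡.sym (binomial-suc n))) ⟩
      negOnePow (suc (suc n) C 2) ∎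

-- Evaluation of R_m

rest : ∀ {n} → Fin n → ℕ
rest {n} j = n ℕ.∸ suc (toℕ j)

rest-+ : ∀ {n} (j : Fin n) → n ≡ suc (toℕ j ℕ.+ rest j)
rest-+ j = ≡.sym (ℕP.m+[n∸m]≡n (FinP.toℕ<n j))

module _ (j r l : ℕ) where
  private
    n : ℕ
    n = suc (j ℕ.+ r)
  open +-*-Solver

  -- Writing n as `suc (j + r)` replaces the truncated subtraction in `rest` by the variable r, so
  -- that the coordinates become polynomial identities.
  Ept-x : proj₁ (Ept n l (suc j)) ≡ + suc (r ℕ.+ l)
  Ept-x = solve 3 (λ j r l → ((con (+ 1) :+ (j :+ r)) :- (con (+ 1) :+ j) :+ l) :+ con (+ 1) := con (+ 1) :+ (r :+ l)) ≡.refl (+ j) (+ r) (+ l)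

  Ept₂-x : proj₁ (Ept₂ n l (suc j)) ≡ + (r ℕ.+ l)
  Ept₂-x = solve 3 (λ j r l → (con (+ 1) :+ (j :+ r)) :- (con (+ 1) :+ j) :+ l := r :+ l) ≡.refl (+ j) (+ r) (+ l)

  Ept-diag : diagSum (Ept n l (suc j)) ≡ + (j ℕ.+ r)
  Ept-diag = solve 3 (λ j r l → (((con (+ 1) :+ (j :+ r)) :- (con (+ 1) :+ j) :+ l) :+ con (+ 1)) :+ (((con (+ 1) :+ j) :- l) :- con (+ 2)) := j :+ r) ≡.refl (+ j) (+ r) (+ l)

  Ept₂-diag : diagSum (Ept₂ n l (suc j)) ≡ + (j ℕ.+ r)
  Ept₂-diag = solve 3 (λ j r l → ((con (+ 1) :+ (j :+ r)) :- (con (+ 1) :+ j) :+ l) :+ (((con (+ 1) :+ j) :- l) :- con (+ 1)) := j :+ r) ≡.refl (+ j) (+ r) (+ l)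

  Ept'-diag : diagSum (Ept' n l (suc j)) ≡ + j
  Ept'-diag = ≡.trans (cong (λ z → proj₁ (Ept' n l (suc j)) ℤ.+ (z ℤ.- + n ℤ.- + l ℤ.- + 2)) (ℤP.pos-* 2 (suc j)))
    (solve 3 (λ j r l → (((con (+ 1) :+ (j :+ r)) :- (con (+ 1) :+ j) :+ l) :+ con (+ 1)) :+ (((con (+ 2) :* (con (+ 1) :+ j) :- (con (+ 1) :+ (j :+ r))) :- l) :- con (+ 2)) := j) ≡.refl (+ j) (+ r) (+ l))

  Ept₂'-diag : diagSum (Ept₂' n l (suc j)) ≡ + j
  Ept₂'-diag = ≡.trans (cong (λ z → proj₁ (Ept₂' n l (suc j)) ℤ.+ (z ℤ.- + n ℤ.- + l ℤ.- + 1)) (ℤP.pos-* 2 (suc j)))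
    (solve 3 (λ j r l → ((con (+ 1) :+ (j :+ r)) :- (con (+ 1) :+ j) :+ l) :+ (((con (+ 2) :* (con (+ 1) :+ j) :- (con (+ 1) :+ (j :+ r))) :- l) :- con (+ 1)) := j) ≡.refl (+ j) (+ r) (+ l))

-- Records what the evaluation uses of the endpoints: abscissae and the antidiagonal `M j`. The sets
-- with and without prime have the same abscissae and differ only in `M`.
OneEnd TwoEnds : ∀ {n} → ℕ → (Fin n → ℕ) → (Fin n → List Point) → Set
OneEnd l M E = ∀ j → ∃ λ e → E j ≡ e ∷ [] × diagSum e ≡ + M j × proj₁ e ≡ + suc (rest j ℕ.+ l)
TwoEnds l M E = ∀ j → ∃₂ λ e e₂ → E j ≡ e ∷ e₂ ∷ [] × diagSum e ≡ + M j × diagSum e₂ ≡ + M j ×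
  proj₁ e ≡ + suc (rest j ℕ.+ l) × proj₁ e₂ ≡ + (rest j ℕ.+ l)

module _ (n l : ℕ) where
  fullLength shortLength : Fin n → ℕ
  fullLength j = toℕ j ℕ.+ rest j
  shortLength j = toℕ j

  private
    at-n : (P : ℕ → Set) (j : Fin n) → P (suc (toℕ j ℕ.+ rest j)) → P n
    at-n P j = subst P (≡.sym (rest-+ j))

    first-x : ∀ j → proj₁ (Ept n l (suc (toℕ j))) ≡ + suc (rest j ℕ.+ l)
    first-x j = at-n (λ m → proj₁ (Ept m l (suc (toℕ j))) ≡ + suc (rest j ℕ.+ l)) j (Ept-x (toℕ j) (rest j) l)

    second-x : ∀ j → proj₁ (Ept₂ n l (suc (toℕ j))) ≡ + (rest j ℕ.+ l)
    second-x j = at-n (λ m → proj₁ (Ept₂ m l (suc (toℕ j))) ≡ + (rest j ℕ.+ l)) j (Ept₂-x (toℕ j) (rest j) l)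

  E-odd-shape : OneEnd l fullLength (E-odd n l)
  E-odd-shape j = _ , ≡.refl ,
    at-n (λ m → diagSum (Ept m l (suc (toℕ j))) ≡ + fullLength j) j (Ept-diag (toℕ j) (rest j) l) , first-x j

  E-odd'-shape : OneEnd l shortLength (E-odd' n l)
  E-odd'-shape j = _ , ≡.refl ,
    at-n (λ m → diagSum (Ept' m l (suc (toℕ j))) ≡ + toℕ j) j (Ept'-diag (toℕ j) (rest j) l) , first-x j

  E-even-shape : TwoEnds l fullLength (E-even n l)
  E-even-shape j = _ , _ , ≡.refl , proj₁ (proj₂ (proj₂ (E-odd-shape j))) ,
    at-n (λ m → diagSum (Ept₂ m l (suc (toℕ j))) ≡ + fullLength j) j (Ept₂-diag (toℕ j) (rest j) l) , first-x j , second-x j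

  E-even'-shape : TwoEnds l shortLength (E-even' n l)
  E-even'-shape j = _ , _ , ≡.refl , proj₁ (proj₂ (proj₂ (E-odd'-shape j))) ,
    at-n (λ m → diagSum (Ept₂' m l (suc (toℕ j))) ≡ + toℕ j) j (Ept₂'-diag (toℕ j) (rest j) l) , first-x j , second-x j

  fullLength-mono : ∀ {i j : Fin n} → toℕ i ℕ.< toℕ j → fullLength i ℕ.≤ fullLength j
  fullLength-mono {i} {j} _ = ℕP.≤-reflexive (ℕP.suc-injective (≡.trans (≡.sym (rest-+ i)) (rest-+ j)))

  shortLength-mono : ∀ {i j : Fin n} → toℕ i ℕ.< toℕ j → shortLength i ℕ.≤ shortLength j
  shortLength-mono = ℕP.<⇒≤

EndsNear : ∀ {n} → ℕ → (Fin n → ℕ) → (Fin n → List Point) → Set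
EndsNear l M E = ∀ {j e} → e ∈ E j → diagSum e ≡ + M j × + (rest j ℕ.+ l) ℤ.≤ proj₁ e × proj₁ e ℤ.≤ + suc (rest j ℕ.+ l)

OneEnd⇒near : ∀ {n l M} {E : Fin n → List Point} → OneEnd l M E → EndsNear l M E
OneEnd⇒near sh {j} e∈ with sh j
... | e , E≡ , d , x with subst (_ ∈_) E≡ e∈
... | here ≡.refl = d , ℤP.≤-trans (ℤ.+≤+ (ℕP.n≤1+n _)) (ℤP.≤-reflexive (≡.sym x)) , ℤP.≤-reflexive x

TwoEnds⇒near : ∀ {n l M} {E : Fin n → List Point} → TwoEnds l M E → EndsNear l M E
TwoEnds⇒near sh {j} e∈ with sh j
... | e , e₂ , E≡ , d , d₂ , x , x₂ with subst (_ ∈_) E≡ e∈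
... | here ≡.refl = d , ℤP.≤-trans (ℤ.+≤+ (ℕP.n≤1+n _)) (ℤP.≤-reflexive (≡.sym x)) , ℤP.≤-reflexive x
... | there (here ≡.refl) = d₂ , ℤP.≤-reflexive (≡.sym x₂) , ℤP.≤-trans (ℤP.≤-reflexive x₂) (ℤ.+≤+ (ℕP.n≤1+n _))

OneEnd⇒unique : ∀ {n l M} {E : Fin n → List Point} → OneEnd l M E → ∀ j → Unique (E j)
OneEnd⇒unique sh j with sh j
... | e , E≡ , _ = subst Unique (≡.sym E≡) ([] ∷ [])

TwoEnds⇒unique : ∀ {n l M} {E : Fin n → List Point} → TwoEnds l M E → ∀ j → Unique (E j)
TwoEnds⇒unique sh j with sh j
... | e , e₂ , E≡ , _ , _ , x , x₂ = subst Unique (≡.sym E≡)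
  (((λ e≡ → ℕP.1+n≢n (ℤP.+-injective (≡.trans (≡.sym x) (≡.trans (cong proj₁ e≡) x₂)))) ∷ []) ∷ [] ∷ [])

-- The abscissae at an index lie in an interval of length one that moves left by at least one when
-- the index grows.
near⇒ordered : ∀ {n l M} {E : Fin n → List Point} → (∀ {i j : Fin n} → toℕ i ℕ.< toℕ j → M i ℕ.≤ M j) → EndsNear l M E → OrderedEnds E
near⇒ordered {l = l} mono near {j′} {j} {e′} {e} j′<j e′∈ e∈ with near e′∈ | near e∈
... | d′ , lo′ , _ | d , _ , hi =
  subst₂ ℤ._≤_ (≡.sym d′) (≡.sym d) (ℤ.+≤+ (mono j′<j)) ,
  ℤP.≤-trans hi (ℤP.≤-trans (ℤ.+≤+ (ℕP.+-monoˡ-≤ l (ℕP.∸-monoʳ-< (ℕ.s≤s j′<j) (FinP.toℕ<n j)))) lo′)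

suc-double/2 : ∀ i → suc (double i) ℕ./ 2 ≡ i
suc-double/2 zero = ≡.refl
suc-double/2 (suc i) = ≡.trans (DM.m/n≡1+[m∸n]/n {suc (double (suc i))} {2} (ℕ.s≤s (ℕ.s≤s ℕ.z≤n))) (cong suc (suc-double/2 i))

odd-double : ∀ i → odd (double i) ≡ false
odd-double zero = ≡.refl
odd-double (suc i) = cong (λ b → not (not b)) (odd-double i)

-- Row sums, clearing of powers and the passage to disjoint families.

module Evaluation {c ℓ : Level} (R : CommutativeRing c ℓ) {n : ℕ} (X Xinv : Fin n → RingPart.Carrier R)
  (inv : ∀ i → CommutativeRing._≈_ R (CommutativeRing._*_ R (X i) (Xinv i)) (CommutativeRing.1# R)) where
  open RingPart R hiding (zero)
  open SumsAndDeterminants R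
  open LGV R
  open Sequences R
  open Products R
  open PathSums R X Xinv
  open import Relation.Binary.Reasoning.Setoid setoid
  open import Algebra.Solver.Ring.NaturalCoefficients.Default commutativeSemiring using (solve; _:=_; _:+_; _:*_; con)

  pick-toℕ : ∀ {m} (f : Fin m → Carrier) z i → pick f z (toℕ i) ≡ f i
  pick-toℕ f z Fin.zero = ≡.refl
  pick-toℕ f z (Fin.suc i) = pick-toℕ (f ∘ Fin.suc) z i

  lineWeight-even : ∀ i → lineWeight (double (toℕ i)) ≡ X i
  lineWeight-even i rewrite odd-double (toℕ i) = ≡.trans (cong (pick X 1#) (double/2 (toℕ i))) (pick-toℕ X 1# i)

  lineWeight-odd : ∀ i → lineWeight (suc (double (toℕ i))) ≡ Xinv i
  lineWeight-odd i rewrite odd-double (toℕ i) = ≡.trans (cong (pick Xinv 1#) (suc-double/2 (toℕ i))) (pick-toℕ Xinv 1# i)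

  lineWeight-inverse : ∀ (i : Fin n) → lineWeight (double (toℕ i)) * lineWeight (suc (double (toℕ i))) ≈ 1#
  lineWeight-inverse i = trans (*-cong (reflexive (lineWeight-even i)) (reflexive (lineWeight-odd i))) (inv i)

  root : Fin n → Carrier
  root i = X i + Xinv i

  module N (i : Fin n) = Newton {n} lineWeight-inverse (root i)

  rootℕ : ℕ → Carrier
  rootℕ k = lineWeight (double k) + lineWeight (suc (double k))

  rootℕ-toℕ : ∀ i → rootℕ (toℕ i) ≈ root i
  rootℕ-toℕ i = +-cong (reflexive (lineWeight-even i)) (reflexive (lineWeight-odd i))

  L : Fin n → Fin n → Carrier
  L i p = newtonPoly rootℕ (root i) (toℕ p)

  L-lower : ∀ {i p} → toℕ i ℕ.< toℕ p → L i p ≈ 0#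
  L-lower {i} {p} i<p = newtonPoly-root rootℕ (toℕ p) (sym (rootℕ-toℕ i)) i<p

  newtonPoly-cong : ∀ {t t′} → t ≈ t′ → ∀ k → newtonPoly rootℕ t k ≈ newtonPoly rootℕ t′ k
  newtonPoly-cong e zero = refl
  newtonPoly-cong e (suc k) = *-cong (newtonPoly-cong e k) (+-congʳ e)

  L-diagonal : ∏ (λ i → L i i) ≈ ∏< (λ i j → root j - root i)
  L-diagonal = trans (∏-cong (λ i → newtonPoly-cong (sym (rootℕ-toℕ i)) (toℕ i))) (trans (∏-newtonPoly n rootℕ)
    (ΠL-cong (ordPairs n) (λ p → +-cong (rootℕ-toℕ (proj₂ p)) (-‿cong (rootℕ-toℕ (proj₁ p))))))

  module _ (w : Carrier) (j : ℕ) (x : Carrier) where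
    private
      factor : ℕ → Carrier
      factor t = if j ℕ.≤ᵇ t then w else 1#

    stepProduct : ℕ → ℕ → Carrier
    stepProduct t zero = 1#
    stepProduct t (suc k) = (1# + factor t * x) * stepProduct (suc t) k

    -- Each step starts on an antidiagonal known from its position in the list, so whether it may
    -- earn w does not depend on the other steps. The sum factors into one binomial per step: 1 for
    -- vertical, x or w x for horizontal.
    finSum : ∀ k t q → diagSum q ≡ + t →
      ΣL (listsOfLen k) (λ fn → finWeight w (suc j) q fn * pow x (ups fn)) ≈ stepProduct t k
    finSum zero t q e = trans (+-identityʳ _) (*-identityˡ _)
    finSum (suc k) t q e = begin
      ΣL (listsOfLen (suc k)) (λ fn → finWeight w (suc j) q fn * pow x (ups fn)) ≈⟨ ΣL-listsOfLen-suc k _ ⟩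
      ΣL (listsOfLen k) (λ fn → ((if + j ℤ.≤ᵇ diagSum q then w else 1#) * fW true fn) * (x * pow x (ups fn))) + ΣL (listsOfLen k) (λ fn → fW false fn * pow x (ups fn))
        ≈⟨ +-congʳ (ΣL-cong (listsOfLen k) (λ {fn} _ → trans (*-congʳ (*-congʳ (reflexive (cong (λ z → if + j ℤ.≤ᵇ z then w else 1#) e)))) (*-interchange _ _ _ _))) ⟩
      ΣL (listsOfLen k) (λ fn → (factor t * x) * (fW true fn * pow x (ups fn))) + ΣL (listsOfLen k) (λ fn → fW false fn * pow x (ups fn))
        ≈⟨ +-cong (trans (ΣL-*ˡ (listsOfLen k) _ _) (*-congˡ (finSum k (suc t) _ (moved true)))) (finSum k (suc t) _ (moved false)) ⟩
      factor t * x * stepProduct (suc t) k + stepProduct (suc t) k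
        ≈⟨ solve 2 (λ a s → a :* s :+ s := (con 1 :+ a) :* s) refl (factor t * x) (stepProduct (suc t) k) ⟩
      (1# + factor t * x) * stepProduct (suc t) k ∎
      where
      fW : Bool → List Bool → Carrier
      fW b = finWeight w (suc j) (q ⊕ finStep b)
      moved : ∀ b → diagSum (q ⊕ finStep b) ≡ + suc t
      moved b = ≡.trans (add diagSum-additive q (finStep b)) (≡.trans (cong₂ ℤ._+_ e (diagSum-finStep b)) (cong +_ (ℕP.+-comm t 1)))

    stepProduct-late : ∀ t k → j ℕ.≤ t → stepProduct t k ≈ pow (1# + w * x) k
    stepProduct-late t zero j≤t = refl
    stepProduct-late t (suc k) j≤t = *-cong (+-congˡ (*-congʳ (reflexive (cong (λ b → if b then w else 1#) (≤ᵇ-true {+ j} {+ t} (ℤ.+≤+ j≤t)))))) (stepProduct-late (suc t) k (ℕP.m≤n⇒m≤1+n j≤t))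

    stepProduct-early : ∀ t a k → t ℕ.+ a ≡ j → stepProduct t (a ℕ.+ k) ≈ pow (1# + x) a * pow (1# + w * x) k
    stepProduct-early t zero k e = trans (stepProduct-late t k (ℕP.≤-reflexive (≡.sym (≡.trans (≡.sym (ℕP.+-identityʳ t)) e)))) (sym (*-identityˡ _))
    stepProduct-early t (suc a) k e = trans (*-cong (+-congˡ (trans (*-congʳ (reflexive (cong (λ b → if b then w else 1#) before))) (*-identityˡ x)))
        (stepProduct-early (suc t) a k (≡.trans (≡.sym (ℕP.+-suc t a)) e))) (sym (*-assoc _ _ _))
      where
      before : (j ℕ.≤ᵇ t) ≡ false
      before with j ℕ.≤ᵇ t in eq
      ... | false = ≡.refl
      ... | true = contradiction (ℕP.≤ᵇ⇒≤ j t (subst Bool.T (≡.sym eq) _)) (ℕP.<⇒≱ (ℕP.≤-trans (ℕP.m<m+n t ℕ.z<s) (ℕP.≤-reflexive e)))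

  GeneratingFunction : Carrier → (Fin n → ℕ) → Set _
  GeneratingFunction w M = ∀ j x → ΣL (listsOfLen (M j)) (λ fn → finWeight w (suc (toℕ j)) origin fn * pow x (ups fn)) ≈ pow (1# + x) (toℕ j) * pow (1# + w * x) (rest j)

  fullLength-gf : ∀ l w → GeneratingFunction w (fullLength n l)
  fullLength-gf l w j x = trans (finSum w (toℕ j) x (toℕ j ℕ.+ rest j) 0 origin ≡.refl) (stepProduct-early w (toℕ j) x 0 (toℕ j) (rest j) ≡.refl)

  -- For w = 0 the last `rest j` binomials are 1, so shortening the final segments by these steps
  -- keeps the generating function. This explains the primed endpoints.
  shortLength-gf : ∀ l → GeneratingFunction 0# (shortLength n l)
  shortLength-gf l j x = begin
    ΣL (listsOfLen (toℕ j)) (λ fn → finWeight 0# (suc (toℕ j)) origin fn * pow x (ups fn)) ≈⟨ finSum 0# (toℕ j) x (toℕ j) 0 origin ≡.refl ⟩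
    stepProduct 0# (toℕ j) x 0 (toℕ j) ≈⟨ reflexive (cong (stepProduct 0# (toℕ j) x 0) (≡.sym (ℕP.+-identityʳ (toℕ j)))) ⟩
    stepProduct 0# (toℕ j) x 0 (toℕ j ℕ.+ 0) ≈⟨ stepProduct-early 0# (toℕ j) x 0 (toℕ j) 0 ≡.refl ⟩
    pow (1# + x) (toℕ j) * 1# ≈⟨ *-congˡ (sym (pow-1 (trans (+-congˡ (zeroˡ x)) (+-identityʳ 1#)) (rest j))) ⟩
    pow (1# + x) (toℕ j) * pow (1# + 0# * x) (rest j) ∎

  module Entries (l : ℕ) (w : Carrier) (M : Fin n → ℕ) (gf : GeneratingFunction w M) (E : Fin n → List Point) where

    fW : Fin n → List Bool → Carrier
    fW j = finWeight w (suc (toℕ j)) origin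

    endSum : Fin n → Point → (ℤ → Carrier) → Carrier
    endSum j e f = ΣL (listsOfLen (M j)) (λ fn → fW j fn * f (+ ups fn ℤ.- proj₁ e))

    pathMatrix-ends : (∀ {j e} → e ∈ E j → diagSum e ≡ + M j) → ∀ p j → pathMatrix w E p j ≈ ΣL (E j) (λ e → endSum j e (signed (suc (toℕ p))))
    pathMatrix-ends diag p j = trans (ΣL-comm (α ∷ β ∷ []) (E j) (λ s e → ΣL (admPaths (suc (toℕ p)) s e) (λ q → signOf s * pathWeight w X Xinv (suc (toℕ p)) (suc (toℕ j)) q))) (ΣL-cong (E j) (λ {e} e∈ → signedPathSum w (toℕ p) e (suc (toℕ j)) (M j) (diag e∈)))

    combination : ∀ i j e → ΣL (allFin n) (λ p → L i p * endSum j e (signed (suc (toℕ p)))) ≈ endSum j e (N.G i)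
    combination i j e = begin
      ΣL (allFin n) (λ p → L i p * endSum j e (signed (suc (toℕ p)))) ≈⟨ ΣL-cong (allFin n) (λ _ → sym (ΣL-*ˡ (listsOfLen (M j)) _ _)) ⟩
      ΣL (allFin n) (λ p → ΣL (listsOfLen (M j)) (λ fn → L i p * (fW j fn * signed (suc (toℕ p)) (+ ups fn ℤ.- proj₁ e)))) ≈⟨ ΣL-comm (allFin n) (listsOfLen (M j)) _ ⟩
      ΣL (listsOfLen (M j)) (λ fn → ΣL (allFin n) (λ p → L i p * (fW j fn * signed (suc (toℕ p)) (+ ups fn ℤ.- proj₁ e))))
        ≈⟨ ΣL-cong (listsOfLen (M j)) (λ _ → trans (ΣL-cong (allFin n) (λ _ → *-x∙yz≈y∙xz _ _ _)) (ΣL-*ˡ (allFin n) _ _)) ⟩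
      endSum j e (N.G i) ∎

    row : Fin n → Fin n → Carrier
    row i j = ΣL (allFin n) (λ p → L i p * pathMatrix w E p j)

    γ : Fin n → Carrier → Carrier
    γ j x = pow (1# + x) (toℕ j) * pow (1# + w * x) (rest j)

    rowSum : (∀ {j e} → e ∈ E j → diagSum e ≡ + M j) → ∀ i j → row i j ≈ ΣL (E j) (λ e → endSum j e (N.G i))
    rowSum diag i j = begin
      row i j ≈⟨ ΣL-cong (allFin n) (λ {p} _ → trans (*-congˡ (pathMatrix-ends diag p j)) (sym (ΣL-*ˡ (E j) _ _))) ⟩
      ΣL (allFin n) (λ p → ΣL (E j) (λ e → L i p * endSum j e (signed (suc (toℕ p))))) ≈⟨ ΣL-comm (allFin n) (E j) _ ⟩
      ΣL (E j) (λ e → ΣL (allFin n) (λ p → L i p * endSum j e (signed (suc (toℕ p))))) ≈⟨ ΣL-cong (E j) (λ {e} _ → combination i j e) ⟩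
      ΣL (E j) (λ e → endSum j e (N.G i)) ∎

    root-of-newton : ∀ i → N.newton i n ≈ 0#
    root-of-newton i = newtonPoly-root rootℕ n (sym (rootℕ-toℕ i)) (FinP.toℕ<n i)

    ⊖-at : ∀ {e : Point} {c : ℕ} u → proj₁ e ≡ + c → + u ℤ.- proj₁ e ≡ u ℤ.⊖ c
    ⊖-at {c = c} u x = ≡.trans (cong (λ z → + u ℤ.- z) x) (ℤP.m-n≡m⊖n u c)

    powers : ∀ i j c b →
      ΣL (listsOfLen (M j)) (λ fn → fW j fn * (1# * zpow (X i) (Xinv i) (ups fn ℤ.⊖ c) + - b * zpow (Xinv i) (X i) (ups fn ℤ.⊖ c))) ≈
      pow (Xinv i) c * γ j (X i) - b * pow (X i) c * γ j (Xinv i)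
    powers i j c b = begin
      ΣL (listsOfLen (M j)) (λ fn → fW j fn * (1# * zpow (X i) (Xinv i) (ups fn ℤ.⊖ c) + - b * zpow (Xinv i) (X i) (ups fn ℤ.⊖ c)))
        ≈⟨ ΣL-cong (listsOfLen (M j)) (λ {fn} _ → begin
            fW j fn * (1# * zpow (X i) (Xinv i) (ups fn ℤ.⊖ c) + - b * zpow (Xinv i) (X i) (ups fn ℤ.⊖ c))
              ≈⟨ *-congˡ (+-cong (trans (*-identityˡ _) (zpow-⊖ (inv i) (ups fn) c)) (*-congˡ (zpow-⊖ (trans (*-comm _ _) (inv i)) (ups fn) c))) ⟩
            fW j fn * (pow (X i) (ups fn) * pow (Xinv i) c + - b * (pow (Xinv i) (ups fn) * pow (X i) c))
              ≈⟨ solve 6 (λ f xu yc nb yu xc → f :* (xu :* yc :+ nb :* (yu :* xc)) := yc :* (f :* xu) :+ (nb :* xc) :* (f :* yu)) refl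
                   (fW j fn) (pow (X i) (ups fn)) (pow (Xinv i) c) (- b) (pow (Xinv i) (ups fn)) (pow (X i) c) ⟩
            pow (Xinv i) c * (fW j fn * pow (X i) (ups fn)) + - b * pow (X i) c * (fW j fn * pow (Xinv i) (ups fn)) ∎) ⟩
      ΣL (listsOfLen (M j)) (λ fn → pow (Xinv i) c * (fW j fn * pow (X i) (ups fn)) + - b * pow (X i) c * (fW j fn * pow (Xinv i) (ups fn))) ≈⟨ ΣL-+ (listsOfLen (M j)) _ _ ⟩
      ΣL (listsOfLen (M j)) (λ fn → pow (Xinv i) c * (fW j fn * pow (X i) (ups fn))) + ΣL (listsOfLen (M j)) (λ fn → - b * pow (X i) c * (fW j fn * pow (Xinv i) (ups fn)))
        ≈⟨ +-cong (trans (ΣL-*ˡ (listsOfLen (M j)) _ _) (*-congˡ (gf j (X i)))) (trans (ΣL-*ˡ (listsOfLen (M j)) _ _) (*-congˡ (gf j (Xinv i)))) ⟩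
      pow (Xinv i) c * γ j (X i) + - b * pow (X i) c * γ j (Xinv i)
        ≈⟨ +-congˡ (trans (*-congʳ (sym (-‿distribˡ-* _ _))) (sym (-‿distribˡ-* _ _))) ⟩
      pow (Xinv i) c * γ j (X i) - b * pow (X i) c * γ j (Xinv i) ∎

    1≤n : Fin n → 1 ℕ.≤ n
    1≤n i = ℕP.≤-trans (ℕ.s≤s ℕ.z≤n) (FinP.toℕ<n i)

    rowSum-one : OneEnd l M E → ∀ i j → let c = suc (rest j ℕ.+ l) in
      (X i - Xinv i) * row i j ≈
      pow (Xinv i) c * γ j (X i) - 1# * pow (X i) c * γ j (Xinv i)
    rowSum-one sh i j with sh j
    ... | e , E≡ , d , x = begin
      (X i - Xinv i) * row i j ≈⟨ *-congˡ (rowSum (proj₁ ∘ OneEnd⇒near sh) i j) ⟩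
      (X i - Xinv i) * ΣL (E j) (λ e → endSum j e (N.G i)) ≈⟨ *-congˡ (trans (reflexive (cong (λ z → ΣL z (λ e → endSum j e (N.G i))) E≡)) (+-identityʳ _)) ⟩
      (X i - Xinv i) * endSum j e (N.G i) ≈⟨ sym (ΣL-*ˡ (listsOfLen (M j)) _ _) ⟩
      ΣL (listsOfLen (M j)) (λ fn → (X i - Xinv i) * (fW j fn * N.G i (+ ups fn ℤ.- proj₁ e)))
        ≈⟨ ΣL-cong (listsOfLen (M j)) (λ {fn} _ → trans (*-x∙yz≈y∙xz _ _ _) (*-congˡ (trans (*-congˡ (reflexive (cong (N.G i) (⊖-at {e} (ups fn) x)))) (N.G-odd i (inv i) refl (root-of-newton i) (1≤n i) (ups fn ℤ.⊖ suc (rest j ℕ.+ l)))))) ⟩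
      ΣL (listsOfLen (M j)) (λ fn → fW j fn * (1# * zpow (X i) (Xinv i) (ups fn ℤ.⊖ suc (rest j ℕ.+ l)) + - 1# * zpow (Xinv i) (X i) (ups fn ℤ.⊖ suc (rest j ℕ.+ l)))) ≈⟨ powers i j (suc (rest j ℕ.+ l)) 1# ⟩
      _ ∎

    -- For one list of final steps, the abscissae c and c - 1 of the two endpoints give the
    -- arguments k and k + 1 of G, whose sum occurs in `G-even`. This is why even m calls for pairs
    -- of endpoints.
    rowSum-two : TwoEnds l M E → ∀ i j → let c = suc (rest j ℕ.+ l) in
      (1# - Xinv i) * row i j ≈
      pow (Xinv i) c * γ j (X i) - Xinv i * pow (X i) c * γ j (Xinv i)
    rowSum-two sh i j with sh j
    ... | e , e₂ , E≡ , d , d₂ , x , x₂ = begin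
      (1# - Xinv i) * row i j ≈⟨ *-congˡ (rowSum (proj₁ ∘ TwoEnds⇒near sh) i j) ⟩
      (1# - Xinv i) * ΣL (E j) (λ e → endSum j e (N.G i)) ≈⟨ *-congˡ (trans (reflexive (cong (λ z → ΣL z (λ e → endSum j e (N.G i))) E≡)) (+-congˡ (+-identityʳ _))) ⟩
      (1# - Xinv i) * (endSum j e (N.G i) + endSum j e₂ (N.G i)) ≈⟨ *-congˡ (sym (ΣL-+ (listsOfLen (M j)) _ _)) ⟩
      (1# - Xinv i) * ΣL (listsOfLen (M j)) (λ fn → fW j fn * N.G i (+ ups fn ℤ.- proj₁ e) + fW j fn * N.G i (+ ups fn ℤ.- proj₁ e₂)) ≈⟨ sym (ΣL-*ˡ (listsOfLen (M j)) _ _) ⟩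
      ΣL (listsOfLen (M j)) (λ fn → (1# - Xinv i) * (fW j fn * N.G i (+ ups fn ℤ.- proj₁ e) + fW j fn * N.G i (+ ups fn ℤ.- proj₁ e₂)))
        ≈⟨ ΣL-cong (listsOfLen (M j)) (λ {fn} _ → trans (*-congˡ (sym (distribˡ _ _ _))) (trans (*-x∙yz≈y∙xz _ _ _) (*-congˡ (trans
             (*-congˡ (+-cong (reflexive (cong (N.G i) (⊖-at {e} (ups fn) x))) (reflexive (cong (N.G i) (≡.trans (⊖-at {e₂} (ups fn) x₂) (≡.sym (next-⊖ (ups fn) (rest j ℕ.+ l))))))))
             (N.G-even i (inv i) refl (root-of-newton i) (1≤n i) (ups fn ℤ.⊖ suc (rest j ℕ.+ l))))))) ⟩
      ΣL (listsOfLen (M j)) (λ fn → fW j fn * (1# * zpow (X i) (Xinv i) (ups fn ℤ.⊖ suc (rest j ℕ.+ l)) + - Xinv i * zpow (Xinv i) (X i) (ups fn ℤ.⊖ suc (rest j ℕ.+ l)))) ≈⟨ powers i j (suc (rest j ℕ.+ l)) (Xinv i) ⟩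
      _ ∎

  entry : ℕ → Carrier → Fin n → Fin n → Carrier
  entry m w i j =
    pow (X i) (toℕ j) * pow (1# + X i) (toℕ j) * pow (1# + w * X i) (n ℕ.∸ suc (toℕ j))
    - pow (X i) (m ℕ.+ 2 ℕ.* n ℕ.∸ suc (toℕ j)) * pow (1# + Xinv i) (toℕ j) * pow (1# + w * Xinv i) (n ℕ.∸ suc (toℕ j))

  -- With c the larger abscissa at the 0-based index j, the row factor X_i^(l+n) turns the exponents
  -- -c and c into j and m + 2n - (j + 1) for odd m; for even m the extra factor 1/X_i accounts for
  -- m being smaller by one.
  exponent-low : ∀ l j r n → n ≡ suc (j ℕ.+ r) → l ℕ.+ n ≡ suc (r ℕ.+ l) ℕ.+ j
  exponent-low l j r n ≡.refl = S.solve 3 (λ l j r → l S.:+ (S.con 1 S.:+ (j S.:+ r)) S.:= (S.con 1 S.:+ (r S.:+ l)) S.:+ j) ≡.refl l j r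
    where module S = ℕSolver.+-*-Solver

  exponent-odd : ∀ l j r n → n ≡ suc (j ℕ.+ r) → 2 ℕ.* l ℕ.+ 1 ℕ.+ 2 ℕ.* n ℕ.∸ suc j ≡ (l ℕ.+ n) ℕ.+ suc (r ℕ.+ l)
  exponent-odd l j r n ≡.refl = ≡.trans (cong (ℕ._∸ suc j)
    (S.solve 3 (λ l j r → (S.con 2 S.:* l S.:+ S.con 1) S.:+ S.con 2 S.:* (S.con 1 S.:+ (j S.:+ r)) S.:= ((l S.:+ (S.con 1 S.:+ (j S.:+ r))) S.:+ (S.con 1 S.:+ (r S.:+ l))) S.:+ (S.con 1 S.:+ j)) ≡.refl l j r))
    (ℕP.m+n∸n≡m _ (suc j))
    where module S = ℕSolver.+-*-Solver

  exponent-even : ∀ l j r n → n ≡ suc (j ℕ.+ r) → 2 ℕ.* l ℕ.+ 2 ℕ.* n ℕ.∸ suc j ≡ (l ℕ.+ n) ℕ.+ (r ℕ.+ l)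
  exponent-even l j r n ≡.refl = ≡.trans (cong (ℕ._∸ suc j)
    (S.solve 3 (λ l j r → S.con 2 S.:* l S.:+ S.con 2 S.:* (S.con 1 S.:+ (j S.:+ r)) S.:= ((l S.:+ (S.con 1 S.:+ (j S.:+ r))) S.:+ (r S.:+ l)) S.:+ (S.con 1 S.:+ j)) ≡.refl l j r))
    (ℕP.m+n∸n≡m _ (suc j))
    where module S = ℕSolver.+-*-Solver

  clear-powers : ∀ {x y} → x * y ≈ 1# → ∀ k {c j b e A B} → k ≡ c ℕ.+ j → pow x k * (b * pow x c) ≈ e → ∀ {A′ B′} →
    pow x k * (pow y c * (A * B) - b * pow x c * (A′ * B′)) ≈ pow x j * A * B - e * A′ * B′
  clear-powers {x} {y} xy k {c} {j} {b} {e} {A} {B} k≡ top {A′} {B′} = begin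
    pow x k * (pow y c * (A * B) - b * pow x c * (A′ * B′)) ≈⟨ distribˡ _ _ _ ⟩
    pow x k * (pow y c * (A * B)) + pow x k * - (b * pow x c * (A′ * B′)) ≈⟨ +-cong low-part (trans (sym (-‿distribʳ-* _ _)) (-‿cong (trans (sym (*-assoc _ _ _)) (trans (*-congʳ top) (sym (*-assoc _ _ _)))))) ⟩
    pow x j * A * B - e * A′ * B′ ∎
    where
    low-part : pow x k * (pow y c * (A * B)) ≈ pow x j * A * B
    low-part = begin
      pow x k * (pow y c * (A * B)) ≈⟨ *-congʳ (trans (reflexive (cong (pow x) k≡)) (pow-+ x c j)) ⟩
      pow x c * pow x j * (pow y c * (A * B)) ≈⟨ *-interchange _ _ _ _ ⟩
      pow x c * pow y c * (pow x j * (A * B)) ≈⟨ trans (*-congʳ (pow-inverse xy c)) (*-identityˡ _) ⟩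
      pow x j * (A * B) ≈⟨ sym (*-assoc _ _ _) ⟩
      pow x j * A * B ∎

  -- a = X - 1/X, b = (1 - X)(1 + X) for odd m, and a = 1 - 1/X, b = 1 - X for even m.
  R-as-famSum : ∀ l m w E (a b f : Fin n → Carrier) → (∀ i → X i * a i ≈ - b i) → (∀ i → b i ≈ (1# - X i) * f i) →
    (∀ i j → entry m w i j ≈ pow (X i) (l ℕ.+ n) * (a i * ΣL (allFin n) (λ p → L i p * pathMatrix w E p j))) →
    RmIs n m w X Xinv (negOnePow (suc n C 2) * ∏ (λ i → pow (X i) l * (Xinv i + 1# + w + X i) * f i) * famSum standardSign allFamilies E w X Xinv)
  R-as-famSum l m w E a b f ab bf entries = begin
    ∏ F * det (entry m w) ≈⟨ *-congˡ (det-cong (λ i j → trans (entries i j) (sym (*-assoc _ _ _)))) ⟩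
    ∏ F * det (λ i j → pow (X i) (l ℕ.+ n) * a i * ΣL (allFin n) (λ p → L i p * B p j)) ≈⟨ *-congˡ (det-scale-rows (λ i → pow (X i) (l ℕ.+ n) * a i) (λ i j → ΣL (allFin n) (λ p → L i p * B p j))) ⟩
    ∏ F * (∏ (λ i → pow (X i) (l ℕ.+ n) * a i) * det (λ i j → ΣL (allFin n) (λ p → L i p * B p j))) ≈⟨ *-congˡ (*-congˡ (trans (det-lower-triangular L B L-lower) (*-congʳ L-diagonal))) ⟩
    ∏ F * (∏ (λ i → pow (X i) (l ℕ.+ n) * a i) * (∏< (λ i j → root j - root i) * det B))
      ≈⟨ *-congˡ (*-congʳ (trans (∏-cong (λ i → trans (*-congʳ (pow-+ (X i) l n)) (*-assoc _ _ _))) (∏-* (λ i → pow (X i) l) (λ i → pow (X i) n * a i)))) ⟩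
    ∏ F * ((Xl * ∏ (λ i → pow (X i) n * a i)) * (∏< (λ i j → root j - root i) * det B))
      ≈⟨ solve 5 (λ F xl p q d → F :* ((xl :* p) :* (q :* d)) := F :* (xl :* ((p :* q) :* d))) refl (∏ F) Xl (∏ (λ i → pow (X i) n * a i)) (∏< (λ i j → root j - root i)) (det B) ⟩
    ∏ F * (Xl * ((∏ (λ i → pow (X i) n * a i) * ∏< (λ i j → root j - root i)) * det B)) ≈⟨ *-congˡ (*-congˡ (*-congʳ (trans (vandermonde-product n X Xinv a b inv ab) (*-congˡ (*-congʳ (trans (∏-cong bf) (∏-* (λ i → 1# - X i) f))))))) ⟩
    ∏ F * (Xl * ((s * ((O * ∏ f) * D)) * det B))
      ≈⟨ solve 7 (λ F xl s o f d b → F :* (xl :* ((s :* ((o :* f) :* d)) :* b)) := (o :* d) :* ((s :* ((xl :* F) :* f)) :* b)) refl (∏ F) Xl s O (∏ f) D (det B) ⟩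
    (O * D) * ((s * ((Xl * ∏ F) * ∏ f)) * det B)
      ≈⟨ *-congˡ (*-cong (*-congˡ (sym (trans (∏-* (λ i → pow (X i) l * F i) f) (*-congʳ (∏-* (λ i → pow (X i) l) F))))) (sym (famSum-det w E))) ⟩
    Rden n X * (s * ∏ (λ i → pow (X i) l * F i * f i) * famSum standardSign allFamilies E w X Xinv) ∎
    where
    F : Fin n → Carrier
    F i = Xinv i + 1# + w + X i
    B : Fin n → Fin n → Carrier
    B = pathMatrix w E
    Xl s O D : Carrier
    Xl = ∏ (λ i → pow (X i) l)
    s = negOnePow (suc n C 2)
    O = ∏ (λ i → 1# - X i)
    D = ∏< (λ i j → (1# - X i * X j) * (X j - X i))

  -- Here X_i - 1/X_i = -(1 - X_i) (1 + X_i) / X_i, while the denominator of R_m contains only 1 -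
  -- X_i; the surplus 1 + X_i is the additional factor for odd m.
  R-odd : ∀ l w M E → GeneratingFunction w M → OneEnd l M E →
    RmIs n (2 ℕ.* l ℕ.+ 1) w X Xinv (negOnePow (suc n C 2) * factorOdd n l w X Xinv * famSum standardSign allFamilies E w X Xinv)
  R-odd l w M E gf sh = R-as-famSum l (2 ℕ.* l ℕ.+ 1) w E (λ i → X i - Xinv i) (λ i → (1# - X i) * (1# + X i)) (λ i → 1# + X i) ab (λ _ → refl)
    (λ i j → sym (trans (*-congˡ (Entries.rowSum-one l w M gf E sh i j))
      (clear-powers (inv i) (l ℕ.+ n) {suc (rest j ℕ.+ l)} {toℕ j} (exponent-low l (toℕ j) (rest j) n (rest-+ j))
        (trans (*-congˡ (*-identityˡ _)) (trans (sym (pow-+ (X i) (l ℕ.+ n) (suc (rest j ℕ.+ l)))) (reflexive (cong (pow (X i)) (≡.sym (exponent-odd l (toℕ j) (rest j) n (rest-+ j))))))))))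
    where
    ab : ∀ i → X i * (X i - Xinv i) ≈ - ((1# - X i) * (1# + X i))
    ab i = begin
      X i * (X i - Xinv i) ≈⟨ trans (distribˡ _ _ _) (+-congˡ (trans (sym (-‿distribʳ-* _ _)) (-‿cong (inv i)))) ⟩
      X i * X i - 1# ≈⟨ -‿flip _ _ ⟩
      - (1# - X i * X i) ≈⟨ -‿cong (sym (begin
          (1# - X i) * (1# + X i) ≈⟨ solve 2 (λ x nx → (con 1 :+ nx) :* (con 1 :+ x) := (con 1 :+ nx :* x) :+ (x :+ nx)) refl (X i) (- X i) ⟩
          (1# + - X i * X i) + (X i - X i) ≈⟨ trans (+-congˡ (-‿inverseʳ _)) (+-identityʳ _) ⟩
          1# + - X i * X i ≈⟨ +-congˡ (sym (-‿distribˡ-* _ _)) ⟩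
          1# - X i * X i ∎)) ⟩
      - ((1# - X i) * (1# + X i)) ∎

  R-even : ∀ l w M E → GeneratingFunction w M → TwoEnds l M E →
    RmIs n (2 ℕ.* l) w X Xinv (negOnePow (suc n C 2) * factorEven n l w X Xinv * famSum standardSign allFamilies E w X Xinv)
  R-even l w M E gf sh = trans (R-as-famSum l (2 ℕ.* l) w E (λ i → 1# - Xinv i) (λ i → 1# - X i) (λ _ → 1#) ab (λ _ → sym (*-identityʳ _))
    (λ i j → sym (trans (*-congˡ (Entries.rowSum-two l w M gf E sh i j))
      (clear-powers (inv i) (l ℕ.+ n) {suc (rest j ℕ.+ l)} {toℕ j} (exponent-low l (toℕ j) (rest j) n (rest-+ j))
        (trans (*-congˡ (cancel-pair′ (inv i) _)) (trans (sym (pow-+ (X i) (l ℕ.+ n) (rest j ℕ.+ l))) (reflexive (cong (pow (X i)) (≡.sym (exponent-even l (toℕ j) (rest j) n (rest-+ j)))))))))))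
    (*-congˡ (*-congʳ (*-congˡ (∏-cong {n} (λ _ → *-identityʳ _)))))
    where
    ab : ∀ i → X i * (1# - Xinv i) ≈ - (1# - X i)
    ab i = trans (distribˡ _ _ _) (trans (+-cong (*-identityʳ _) (trans (sym (-‿distribʳ-* _ _)) (-‿cong (inv i)))) (-‿flip _ _))

  finWeight-w=1 : ∀ j q bs → finWeight 1# j q bs ≈ 1#
  finWeight-w=1 j q [] = refl
  finWeight-w=1 j q (true ∷ bs) with + j ℤ.- + 1 ℤ.≤ᵇ diagSum q
  ... | true = trans (*-identityˡ _) (finWeight-w=1 j _ bs)
  ... | false = trans (*-identityˡ _) (finWeight-w=1 j _ bs)
  finWeight-w=1 j q (false ∷ bs) = finWeight-w=1 j _ bs

  -- A horizontal step earns w from antidiagonal j on, and a walk that has ended by then takes all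
  -- its steps before it.
  finWeight-short : ∀ w j t q bs → diagSum q ≡ + t → t ℕ.+ length bs ℕ.≤ j → finWeight w (suc j) q bs ≈ 1#
  finWeight-short w j t q [] e t≤j = refl
  finWeight-short w j t q (b ∷ bs) e t≤j = step b
    where
    tail≤ : suc t ℕ.+ length bs ℕ.≤ j
    tail≤ = ℕP.≤-trans (ℕP.≤-reflexive (≡.sym (ℕP.+-suc t (length bs)))) t≤j
    moved : ∀ b → diagSum (q ⊕ finStep b) ≡ + suc t
    moved b = ≡.trans (add diagSum-additive q (finStep b)) (≡.trans (cong₂ ℤ._+_ e (diagSum-finStep b)) (cong +_ (ℕP.+-comm t 1)))
    before : (+ j ℤ.≤ᵇ diagSum q) ≡ false
    before with j ℕ.≤ᵇ t in eq
    ... | false = ≡.trans (cong (+ j ℤ.≤ᵇ_) e) eq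
    ... | true = contradiction (ℕP.≤ᵇ⇒≤ j t (subst Bool.T (≡.sym eq) _)) (ℕP.<⇒≱ (ℕP.≤-trans (ℕP.m≤m+n (suc t) (length bs)) tail≤))
    step : ∀ b → finWeight w (suc j) q (b ∷ bs) ≈ 1#
    step true = trans (*-cong (reflexive (cong (λ c → if c then w else 1#) before)) (finWeight-short w j (suc t) _ bs (moved true) tail≤)) (*-identityˡ 1#)
    step false = finWeight-short w j (suc t) _ bs (moved false) tail≤

  FinWeights1 : Carrier → (Fin n → List Point) → Set _
  FinWeights1 w E = ∀ {i p j e} → e ∈ E j → Adm (suc i) p e → finWeight w (suc (toℕ j)) (turnPt (suc i) p) (fin p) ≈ 1#

  -- The primed endpoints lie on the very line from which w is counted.
  shortLength-finWeights : ∀ l w {E} → EndsNear l (shortLength n l) E → FinWeights1 w E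
  shortLength-finWeights l w near {i} {p} {j} e∈ ad = finWeight-short w (toℕ j) 0 (turnPt (suc i) p) (fin p) (turn-diag ad)
    (ℕP.≤-reflexive (ℤP.+-injective (≡.trans (≡.sym (fin-length ad)) (proj₁ (near e∈)))))

  -- The two exponents have the same sum for every disjoint family, so the two signs differ by a
  -- constant factor.
  famSum-alpha : ∀ w {E} → OrderedEnds E →
    famSum alphaSign disjointPaths E w X Xinv ≈ negOnePow (suc n C 2) * famSum standardSign disjointPaths E w X Xinv
  famSum-alpha w {E} ordered = trans (ΣL-cong Fs (λ {F} F∈ → trans (*-congʳ (sign F (∈-filter⁻ (≡true? (restrictᵇ disjointPaths)) {xs = families n E} F∈))) (*-assoc _ _ _))) (ΣL-*ˡ Fs _ _)
    where
    Fs : List (Family n)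
    Fs = filter (≡true? (restrictᵇ disjointPaths)) (families n E)
    sign : ∀ F → F ∈ families n E × restrictᵇ disjointPaths F ≡ true → negOnePow (signExp alphaSign F) ≈ negOnePow (suc n C 2) * negOnePow (signExp standardSign F)
    sign F (F∈ , dis) = sym (begin
      negOnePow (suc n C 2) * S ≈⟨ *-congʳ (trans (reflexive (cong negOnePow (≡.sym (signExp-disjoint ordered {F} (∈-families⁻ E F∈) dis)))) (negOnePow-+ (signExp standardSign F) (signExp alphaSign F))) ⟩
      S * A * S ≈⟨ solve 2 (λ s a → (s :* a) :* s := (s :* s) :* a) refl S A ⟩
      S * S * A ≈⟨ trans (*-congʳ (negOnePow-square (signExp standardSign F))) (*-identityˡ A) ⟩
      A ∎)
      where
      S A : Carrier
      S = negOnePow (signExp standardSign F)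
      A = negOnePow (signExp alphaSign F)

  module Consequences (m : ℕ) (w k : Carrier) (E : Fin n → List Point)
    (all : RmIs n m w X Xinv (negOnePow (suc n C 2) * k * famSum standardSign allFamilies E w X Xinv)) (unique : ∀ j → Unique (E j)) where

    R-disjointInitial : RmIs n m w X Xinv (negOnePow (suc n C 2) * k * famSum standardSign disjointInitial E w X Xinv)
    R-disjointInitial = trans all (*-congˡ (*-congˡ (sym (famSum-disjoint X Xinv false E w (λ ()) unique))))

    R-disjointPaths : FinWeights1 w E → RmIs n m w X Xinv (negOnePow (suc n C 2) * k * famSum standardSign disjointPaths E w X Xinv)
    R-disjointPaths fw = trans all (*-congˡ (*-congˡ (sym (famSum-disjoint X Xinv true E w (λ _ → fw) unique))))

    R-alpha : FinWeights1 w E → OrderedEnds E → RmIs n m w X Xinv (k * famSum alphaSign disjointPaths E w X Xinv)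
    R-alpha fw ordered = trans (R-disjointPaths fw) (*-congˡ (sym (trans (*-congˡ (famSum-alpha w ordered))
      (trans (*-x∙yz≈y∙xz _ _ _) (sym (*-assoc _ _ _))))))

theorem4p1 : ∀ {c ℓ : Level} (R : CommutativeRing c ℓ) → let open RingPart R in
    (n l : ℕ) → 1 ℕ.≤ n → (X Xinv : Fin n → Carrier) → (∀ i → X i * Xinv i ≈ 1#) →
    ((∀ w → RmIs n (2 ℕ.* l ℕ.+ 1) w X Xinv
    (negOnePow ((suc n) C 2) * factorOdd n l w X Xinv
    * famSum standardSign disjointInitial (E-odd n l) w X Xinv))
    × (∀ w → RmIs n (2 ℕ.* l ℕ.+ 1) w X Xinv
    (negOnePow ((suc n) C 2) * factorOdd n l w X Xinv
    * famSum standardSign allFamilies (E-odd n l) w X Xinv))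
    × RmIs n (2 ℕ.* l ℕ.+ 1) 1# X Xinv
    (negOnePow ((suc n) C 2) * factorOdd n l 1# X Xinv
    * famSum standardSign disjointPaths (E-odd n l) 1# X Xinv)
    × RmIs n (2 ℕ.* l ℕ.+ 1) 0# X Xinv
    (negOnePow ((suc n) C 2) * factorOdd n l 0# X Xinv
    * famSum standardSign disjointPaths (E-odd' n l) 0# X Xinv)
    × RmIs n (2 ℕ.* l ℕ.+ 1) 1# X Xinv
    (factorOdd n l 1# X Xinv * famSum alphaSign disjointPaths (E-odd n l) 1# X Xinv)
    × RmIs n (2 ℕ.* l ℕ.+ 1) 0# X Xinv
    (factorOdd n l 0# X Xinv * famSum alphaSign disjointPaths (E-odd' n l) 0# X Xinv))
    ×
    ((∀ w → RmIs n (2 ℕ.* l) w X Xinv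
    (negOnePow ((suc n) C 2) * factorEven n l w X Xinv
    * famSum standardSign disjointInitial (E-even n l) w X Xinv))
    × (∀ w → RmIs n (2 ℕ.* l) w X Xinv
    (negOnePow ((suc n) C 2) * factorEven n l w X Xinv
    * famSum standardSign allFamilies (E-even n l) w X Xinv))
    × RmIs n (2 ℕ.* l) 1# X Xinv
    (negOnePow ((suc n) C 2) * factorEven n l 1# X Xinv
    * famSum standardSign disjointPaths (E-even n l) 1# X Xinv)
    × RmIs n (2 ℕ.* l) 0# X Xinv
    (negOnePow ((suc n) C 2) * factorEven n l 0# X Xinv
    * famSum standardSign disjointPaths (E-even' n l) 0# X Xinv)
    × RmIs n (2 ℕ.* l) 1# X Xinv
    (factorEven n l 1# X Xinv * famSum alphaSign disjointPaths (E-even n l) 1# X Xinv)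
    × RmIs n (2 ℕ.* l) 0# X Xinv
    (factorEven n l 0# X Xinv * famSum alphaSign disjointPaths (E-even' n l) 0# X Xinv))
theorem4p1 R n l _ X Xinv inv =
  ( (λ w → Odd.R-disjointInitial w)
  , odd-all
  , Odd.R-disjointPaths 1# (fw₁ (E-odd n l))
  , Odd'.R-disjointPaths odd-fw'
  , Odd.R-alpha 1# (fw₁ (E-odd n l)) (near⇒ordered (fullLength-mono n l) (OneEnd⇒near odd-sh))
  , Odd'.R-alpha odd-fw' (near⇒ordered (shortLength-mono n l) (OneEnd⇒near odd-sh')) )
  ,
  ( (λ w → Even.R-disjointInitial w)
  , even-all
  , Even.R-disjointPaths 1# (fw₁ (E-even n l))
  , Even'.R-disjointPaths even-fw'
  , Even.R-alpha 1# (fw₁ (E-even n l)) (near⇒ordered (fullLength-mono n l) (TwoEnds⇒near even-sh))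
  , Even'.R-alpha even-fw' (near⇒ordered (shortLength-mono n l) (TwoEnds⇒near even-sh')) )
  where
  open RingPart R
  open Evaluation R X Xinv inv
  odd-sh : OneEnd l (fullLength n l) (E-odd n l)
  odd-sh = E-odd-shape n l
  odd-sh' : OneEnd l (shortLength n l) (E-odd' n l)
  odd-sh' = E-odd'-shape n l
  even-sh : TwoEnds l (fullLength n l) (E-even n l)
  even-sh = E-even-shape n l
  even-sh' : TwoEnds l (shortLength n l) (E-even' n l)
  even-sh' = E-even'-shape n l
  odd-all : ∀ w → RmIs n (2 ℕ.* l ℕ.+ 1) w X Xinv
    (negOnePow ((suc n) C 2) * factorOdd n l w X Xinv * famSum standardSign allFamilies (E-odd n l) w X Xinv)
  odd-all w = R-odd l w (fullLength n l) (E-odd n l) (fullLength-gf l w) odd-sh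
  odd-all' : RmIs n (2 ℕ.* l ℕ.+ 1) 0# X Xinv
    (negOnePow ((suc n) C 2) * factorOdd n l 0# X Xinv * famSum standardSign allFamilies (E-odd' n l) 0# X Xinv)
  odd-all' = R-odd l 0# (shortLength n l) (E-odd' n l) (shortLength-gf l) odd-sh'
  even-all : ∀ w → RmIs n (2 ℕ.* l) w X Xinv
    (negOnePow ((suc n) C 2) * factorEven n l w X Xinv * famSum standardSign allFamilies (E-even n l) w X Xinv)
  even-all w = R-even l w (fullLength n l) (E-even n l) (fullLength-gf l w) even-sh
  even-all' : RmIs n (2 ℕ.* l) 0# X Xinv
    (negOnePow ((suc n) C 2) * factorEven n l 0# X Xinv * famSum standardSign allFamilies (E-even' n l) 0# X Xinv)
  even-all' = R-even l 0# (shortLength n l) (E-even' n l) (shortLength-gf l) even-sh'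
  -- The unprimed endpoints serve arbitrary w and then w = 1; the primed ones enter through their
  -- own evaluation at w = 0.
  module Odd w = Consequences (2 ℕ.* l ℕ.+ 1) w (factorOdd n l w X Xinv) (E-odd n l) (odd-all w) (OneEnd⇒unique odd-sh)
  module Odd' = Consequences (2 ℕ.* l ℕ.+ 1) 0# (factorOdd n l 0# X Xinv) (E-odd' n l) odd-all' (OneEnd⇒unique odd-sh')
  module Even w = Consequences (2 ℕ.* l) w (factorEven n l w X Xinv) (E-even n l) (even-all w) (TwoEnds⇒unique even-sh)
  module Even' = Consequences (2 ℕ.* l) 0# (factorEven n l 0# X Xinv) (E-even' n l) even-all' (TwoEnds⇒unique even-sh')
  fw₁ : ∀ E → FinWeights1 1# E
  fw₁ _ {i} {p} {j} _ _ = finWeight-w=1 (suc (toℕ j)) (turnPt (suc i) p) (fin p)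
  odd-fw' : FinWeights1 0# (E-odd' n l)
  odd-fw' = shortLength-finWeights l 0# (OneEnd⇒near odd-sh')
  even-fw' : FinWeights1 0# (E-even' n l)
  even-fw' = shortLength-finWeights l 0# (TwoEnds⇒near even-sh')
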